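{- Let $q$ be a prime power and $n\ge1$. Fix $[A]\in\mathrm{PGL}(2,q)$ of order $d$ and set $d_0=\gcd(d,n)$. Then for any positive integer $s$ with $\gcd(s,n)=1$ and any monic irreducible $f\in\mathbb F_{q^n}[x]$ of degree $\frac{d}{d_0}s>2$, the following are equivalent: (i) $f$ is $[A,\sigma_i]$-invariant for some $1\le i\le n$ with $\gcd(i,n)=1$; (ii) $f$ is $[A,\sigma_i]$-invariant for some $1\le i\le n$ with $\gcd(i,n)=1$, and the least positive integer $t$ such that $f\in\mathbb F_{q^t}[x]$ is $t=d_0$; (iii) $f$ divides a monic irreducible polynomial $G\in\mathbb F_q[x]$ of degree $ds$ that is $[A]$-invariant, i.e. $[A]\circ G=G$.
   Context: $\sigma_i$ denotes the $i$-th power of the Frobenius automorphism $\alpha\mapsto\alpha^q$ of $\mathbb F_{q^n}$, extended coefficientwise to $\mathbb F_{q^n}[x]$. For $A=\begin{pmatrix}a&b\\ c&d\end{pmatrix}\in\mathrm{GL}(2,q)$ and a polynomial $h$ of degree $m$, $[A]\circ h$ is the unique monic scalar multiple of $(cx+d)^m h\!\left(\frac{ax+b}{cx+d}\right)$. Viewing $[A]\in\mathrm{PGL}(2,q)\subseteq\mathrm{PGL}(2,q^n)$, $[A,\sigma_i]\ast f:=[A]\circ(\sigma_i(f))$, and $f$ is $[A,\sigma_i]$-invariant if $[A,\sigma_i]\ast f=f$. -}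

module Defs where

open import Data.Nat as ℕ using (ℕ; zero; suc; _∸_; _≤_; _<_)
open import Data.Nat.Primality using (Prime)
open import Data.List using (List; []; _∷_; reverse; length; map)
open import Data.List.Membership.Propositional using (_∈_)
open import Data.List.Relation.Unary.All using (All)
open import Data.List.Relation.Unary.Unique.Propositional using (Unique)
open import Data.Product using (Σ; ∃; _×_)
open import Data.Sum using (_⊎_)
open import Data.Bool using (if_then_else_)
open import Relation.Nullary using (¬_; does)
open import Relation.Binary.Definitions using (DecidableEquality)
open import Relation.Binary.PropositionalEquality using (_≡_; _≢_)
open import Algebra.Structures using (IsCommutativeRing)

IsPrimePower : ℕ → Set
IsPrimePower q = Σ ℕ λ p → Σ ℕ λ k → Prime p × 1 ≤ k × q ≡ p ℕ.^ k

record FiniteField : Set₁ where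
  infixl 7 _*_
  infixl 6 _+_
  field
    Carrier  : Set
    _+_ _*_  : Carrier → Carrier → Carrier
    -_       : Carrier → Carrier
    0# 1#    : Carrier
    isCommutativeRing : IsCommutativeRing _≡_ _+_ _*_ -_ 0# 1#
    inv      : Carrier → Carrier
    inverseʳ : ∀ x → x ≢ 0# → x * inv x ≡ 1#
    0≢1      : 0# ≢ 1#
    _≟_      : DecidableEquality Carrier
    elements : List Carrier
    complete : ∀ x → x ∈ elements
    unique   : Unique elements

  card : ℕ
  card = length elements

-- Everything below lives over a finite field K (playing the role of F_{q^n})
-- and the natural number q.
module FF (K : FiniteField) (q : ℕ) where
  open FiniteField K

  _^ᶜ_ : Carrier → ℕ → Carrier
  x ^ᶜ zero = 1#
  x ^ᶜ suc k = x * (x ^ᶜ k)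

  σ : ℕ → Carrier → Carrier
  σ i α = α ^ᶜ (q ℕ.^ i)

  -- α ∈ F_{q^t} (as a subset of K): α^(q^t) = α
  InFq^ : ℕ → Carrier → Set
  InFq^ t α = σ t α ≡ α

  InFq : Carrier → Set
  InFq = InFq^ 1

  -- Polynomials: lists of coefficients, lowest degree first.
  Poly : Set
  Poly = List Carrier

  coeff : Poly → ℕ → Carrier
  coeff [] _ = 0#
  coeff (c ∷ cs) zero = c
  coeff (c ∷ cs) (suc k) = coeff cs k

  -- equality of polynomials: all coefficients agree (trailing zeros irrelevant)
  _≈ₚ_ : Poly → Poly → Set
  p ≈ₚ r = ∀ k → coeff p k ≡ coeff r k

  _+ₚ_ : Poly → Poly → Poly
  [] +ₚ ys = ys
  (x ∷ xs) +ₚ [] = x ∷ xs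
  (x ∷ xs) +ₚ (y ∷ ys) = (x + y) ∷ (xs +ₚ ys)

  scale : Carrier → Poly → Poly
  scale c p = map (c *_) p

  _*ₚ_ : Poly → Poly → Poly
  [] *ₚ r = []
  (x ∷ xs) *ₚ r = scale x r +ₚ (0# ∷ (xs *ₚ r))

  _^ₚ_ : Poly → ℕ → Poly
  p ^ₚ zero = 1# ∷ []
  p ^ₚ suc k = p *ₚ (p ^ₚ k)

  private
    dropZ : List Carrier → List Carrier
    dropZ [] = []
    dropZ (x ∷ xs) = if does (x ≟ 0#) then dropZ xs else (x ∷ xs)

  strip : Poly → Poly
  strip p = reverse (dropZ (reverse p))

  -- degree (the zero polynomial gets degree 0)
  deg : Poly → ℕ
  deg p = length (strip p) ∸ 1

  lead : Poly → Carrier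
  lead p with dropZ (reverse p)
  ... | [] = 0#
  ... | c ∷ _ = c

  Monic : Poly → Set
  Monic p = lead p ≡ 1#

  CoeffsIn : (Carrier → Set) → Poly → Set
  CoeffsIn P p = All P p

  -- irreducible in R[x], where R ⊆ K is the subring given by P
  IrreducibleIn : (Carrier → Set) → Poly → Set
  IrreducibleIn P f =
    CoeffsIn P f × 1 ≤ deg f ×
    (∀ g h → CoeffsIn P g → CoeffsIn P h → f ≈ₚ (g *ₚ h) → deg g ≡ 0 ⊎ deg h ≡ 0)

  Irreducible : Poly → Set
  Irreducible = IrreducibleIn (λ _ → Carrier)

  _∣ₚ_ : Poly → Poly → Set
  f ∣ₚ g = Σ Poly λ h → g ≈ₚ (f *ₚ h)

  record Mat : Set where
    constructor mat
    field a b c d : Carrier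

  _*ₘ_ : Mat → Mat → Mat
  mat a b c d *ₘ mat a' b' c' d' =
    mat (a * a' + b * c') (a * b' + b * d') (c * a' + d * c') (c * b' + d * d')

  idₘ : Mat
  idₘ = mat 1# 0# 0# 1#

  _^ₘ_ : Mat → ℕ → Mat
  A ^ₘ zero = idₘ
  A ^ₘ suc k = A *ₘ (A ^ₘ k)

  det : Mat → Carrier
  det (mat a b c d) = a * d + - (b * c)

  InGL2q : Mat → Set
  InGL2q (mat a b c d) = InFq a × InFq b × InFq c × InFq d × det (mat a b c d) ≢ 0#

  -- A is a scalar matrix, i.e. [A] is the identity of PGL
  Scalar : Mat → Set
  Scalar (mat a b c d) = b ≡ 0# × c ≡ 0# × a ≡ d

  PGLOrder : Mat → ℕ → Set
  PGLOrder A e = 1 ≤ e × Scalar (A ^ₘ e) × (∀ e' → 1 ≤ e' → e' < e → ¬ Scalar (A ^ₘ e'))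

  -- [A] ∘ h : the monic multiple of (cx+d)^m h((ax+b)/(cx+d)), m = deg h
  _∘ₚ_ : Mat → Poly → Poly
  mat a b c d ∘ₚ h = scale (inv (lead H)) H
    where
      m = deg h
      L M : Poly
      L = b ∷ a ∷ []
      M = d ∷ c ∷ []
      go : ℕ → List Carrier → Poly
      go k [] = []
      go k (hk ∷ hs) = scale hk ((L ^ₚ k) *ₚ (M ^ₚ (m ∸ k))) +ₚ go (suc k) hs
      H : Poly
      H = go 0 (strip h)

  σₚ : ℕ → Poly → Poly
  σₚ i f = map (σ i) f

  _∗[_]_ : Mat → ℕ → Poly → Poly
  A ∗[ i ] f = A ∘ₚ σₚ i f

  Invariant : Mat → ℕ → Poly → Set
  Invariant A i f = (A ∗[ i ] f) ≈ₚ f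

{-# OPTIONS --safe #-}

-- Let α be a root of f in L = K[x]/(f), σ the q-Frobenius of L and D the degree of α over 𝔽_q, i.e. the
-- period of α under σ.  For e ∣ n the product ∏ⱼ (x − σ^{ej} α) over one orbit of σ^e has coefficients in
-- K ∩ 𝔽_{q^e} and is the minimal polynomial of α there; hence f is this product for e = n, and an irreducible
-- G ∈ 𝔽_q[x] with f ∣ G is the one for e = 1.  Both invariance conditions therefore amount to A·α = σ^κ α
-- for some κ (with κ ≡ i mod n, resp. arbitrary).  As deg f > 2, a power of A that fixes α is scalar, so D
-- divides κr exactly when d ∣ r, that is D = d gcd(D , κ); likewise D = (deg f) gcd(D , n).  These two
-- equations give D = ds and gcd(D , n) = d₀ from gcd(κ , n) = 1, and conversely gcd(κ , d₀) = 1 from D = ds;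
-- in the latter case κ may be replaced by some i ≡ κ mod d₀ that is coprime to n, as f has coefficients in 𝔽_{q^d₀}.
module Submission where

open import Defs
open import Level using (0ℓ)
open import Data.Nat as ℕ using (ℕ; zero; suc; _≤_; _<_; z≤n; s≤s; _∸_; _!; nonTrivial⇒n>1; NonZero; >-nonZero; ≢-nonZero)
import Data.Nat.Properties as ℕₚ
import Data.Nat.Combinatorics as Comb
open import Data.Nat.Coprimality as Coprimality using (Coprime; coprime-divisor; gcd≡1⇒coprime; coprime⇒gcd≡1)
open import Data.Nat.Divisibility
open import Data.Nat.DivMod using (_%_; _/_; m≡m%n+[m/n]*n; m%n<n; m/n*n≡m)
open import Data.Nat.GCD using (gcd; gcd[m,n]∣m; gcd[m,n]∣n; gcd-greatest; gcd[m,n]≡0⇒m≡0)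
open import Data.Nat.ListAction using (product)
open import Data.Nat.Primality using (Prime; euclidsLemma; prime⇒nonZero; prime⇒nonTrivial; prime⇒irreducible)
open import Data.Nat.Primality.Factorisation using (factorise; PrimeFactorisation)
open import Data.Fin using (Fin; toℕ; zero; suc; inject₁; fromℕ)
import Data.Fin.Properties as Finₚ
open import Data.List using (List; []; _∷_; _∷ʳ_; _++_; length; map; foldr; take; reverse; applyUpTo; cartesianProductWith)
import Data.List.Properties as Listₚ
open import Data.List.Reverse using (Reverse; reverseView; []; _∶_∶ʳ_)
open import Data.List.Membership.Propositional using (_∈_; find)
import Data.List.Membership.Propositional.Properties as ∈ₚ
open import Data.List.Membership.Propositional.Properties.WithK using (unique∧set⇒bag)
open import Data.List.Relation.Binary.BagAndSetEquality using (∼bag⇒↭)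
open import Data.List.Relation.Binary.Permutation.Propositional using (_↭_; prep; swap; ↭⇒↭ₛ) renaming (refl to ↭refl; trans to ↭trans)
import Data.List.Relation.Binary.Permutation.Propositional.Properties as ↭ₚ
import Data.List.Relation.Binary.Permutation.Setoid.Properties as ↭ₛₚ
open import Data.List.Relation.Unary.Any using (here; there; any?)
open import Data.List.Relation.Unary.All as All using (All; []; _∷_; universal)
import Data.List.Relation.Unary.All.Properties as Allₚ
open import Data.List.Relation.Unary.AllPairs as AllPairs using ([]; _∷_)
open import Data.List.Relation.Unary.Unique.Propositional using (Unique)
import Data.List.Relation.Unary.Unique.Propositional.Properties as Uniqueₚ
open import Data.Vec as Vec using (Vec; []; _∷_; zipWith; replicate; toList)
import Data.Vec.Properties as Vecₚ
open import Data.Product using (Σ; _×_; _,_; proj₁; proj₂)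
open import Data.Sum using (_⊎_; inj₁; inj₂)
open import Data.Empty using (⊥; ⊥-elim)
open import Data.Unit using (⊤; tt)
open import Function using (_∘_; id)
open import Function.Bundles using (_⇔_; mk⇔)
open import Relation.Nullary using (¬_; Dec; yes; no)
open import Relation.Binary.Definitions using (tri<; tri≈; tri>)
open import Relation.Binary.PropositionalEquality
open import Algebra.Bundles using (CommutativeRing)
open import Algebra.Structures using (IsCommutativeRing)
import Algebra.Properties.CommutativeSemigroup as CommutativeSemigroupProperties
import Algebra.Properties.Ring as RingProperties
import Algebra.Properties.Semiring.Mult as SemiringMult
import Algebra.Properties.Semiring.Exp as SemiringExp
import Algebra.Properties.CommutativeSemiring.Exp as CSExp
import Algebra.Properties.CommutativeSemiring.Binomial as BinomialThm
import Algebra.Properties.Semiring.Binomial as BinomialTerms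
import Algebra.Properties.Semiring.Sum as SemiringSum
import Algebra.Solver.Ring.NaturalCoefficients.Default as NaturalCoefficients

-- No algebraic closure is available, so α has to live in a field built by hand: coefficient vectors
-- of length deg f, enumerated, with q^N elements for N = n deg f. That count is the source of
-- everything Galois-theoretic. It gives σ^N = 1 on L, so Frobenius is bijective, orbits close up,
-- and a negative exponent -j can be written as j(N - 1). Counting the roots of x^(q^n) - x
-- identifies ι K with the fixed field of σ^n, so products over orbits descend to K. The Möbius
-- action meets two obstacles. First, A·α must not be infinity: cα + d = 0 would be a linear
-- relation for α over K. Secondly, the polynomial (cx+d)^m h((ax+b)/(cx+d)) has degree at most m
-- and the right roots, but it could vanish identically, and then making it monic would mean
-- nothing. This is excluded by evaluating it at a point of K that A sends to a point of K, where h
-- has no root. A itself commutes with σ because its entries lie in 𝔽_q; hence A·α = σ^κ α alone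
-- determines A on every conjugate and every power of A on α.

private
  ↭-unique : ∀ {A : Set} {xs ys : List A} → Unique xs → Unique ys →
             (∀ x → x ∈ xs → x ∈ ys) → (∀ x → x ∈ ys → x ∈ xs) → xs ↭ ys
  ↭-unique u v f g = ∼bag⇒↭ (unique∧set⇒bag u v (λ {x} → mk⇔ (f x) (g x)))

  n∣n! : ∀ n → .{{ℕ.NonZero n}} → n ∣ n !
  n∣n! (suc r) = m∣m*n (r !)

-- Finite fields: x^card = x, the characteristic, additivity of p-power maps.

module FieldLemmas (F : FiniteField) where
  open FiniteField F

  commutativeRing : CommutativeRing 0ℓ 0ℓ
  commutativeRing = record { isCommutativeRing = isCommutativeRing }

  open CommutativeRing commutativeRing public
    using (+-assoc; +-comm; +-identityˡ; +-identityʳ; -‿inverseˡ; -‿inverseʳ;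
           *-assoc; *-comm; *-identityˡ; *-identityʳ; distribˡ; distribʳ; zeroˡ; zeroʳ;
           ring; semiring; commutativeSemiring)
  open RingProperties ring public
    using (-‿distribˡ-*; -‿distribʳ-*; -0#≈0#; +-cancelˡ; +-cancelʳ; -‿involutive)
  open SemiringMult semiring public using (×1-homo-*; ×-assoc-*) renaming (_×_ to _·_)
  open SemiringExp semiring public using (_^_; ^-homo-*; ^-assocʳ)
  open CSExp commutativeSemiring public using (^-distrib-*)

  open CommutativeSemigroupProperties (CommutativeRing.+-commutativeSemigroup commutativeRing) public
    using () renaming (interchange to +-interchange)
  open CommutativeSemigroupProperties (CommutativeRing.*-commutativeSemigroup commutativeRing) public
    using () renaming (interchange to *-interchange)

  open NaturalCoefficients commutativeSemiring public
    using (solve; _:=_; _:+_; _:*_)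

  x-y≡0⇒x≡y : ∀ {x y} → x + - y ≡ 0# → x ≡ y
  x-y≡0⇒x≡y {x} {y} e = begin
    x               ≡⟨ +-identityʳ x ⟨
    x + 0#          ≡⟨ cong (x +_) (-‿inverseˡ y) ⟨
    x + (- y + y)   ≡⟨ +-assoc x (- y) y ⟨
    (x + - y) + y   ≡⟨ cong (_+ y) e ⟩
    0# + y          ≡⟨ +-identityˡ y ⟩
    y               ∎
    where open ≡-Reasoning

  inverseˡ : ∀ x → x ≢ 0# → inv x * x ≡ 1#
  inverseˡ x ne = trans (*-comm _ _) (inverseʳ x ne)

  xy≡0⇒y≡0 : ∀ {x y} → x ≢ 0# → x * y ≡ 0# → y ≡ 0#
  xy≡0⇒y≡0 {x} {y} ne e = begin
    y                 ≡⟨ *-identityˡ y ⟨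
    1# * y            ≡⟨ cong (_* y) (inverseˡ x ne) ⟨
    inv x * x * y     ≡⟨ *-assoc _ _ _ ⟩
    inv x * (x * y)   ≡⟨ cong (inv x *_) e ⟩
    inv x * 0#        ≡⟨ zeroʳ _ ⟩
    0#                ∎
    where open ≡-Reasoning

  *-nonZero : ∀ {x y} → x ≢ 0# → y ≢ 0# → x * y ≢ 0#
  *-nonZero nx ny e = ny (xy≡0⇒y≡0 nx e)

  xy≡0⇒x≡0∨y≡0 : ∀ {x y} → x * y ≡ 0# → x ≡ 0# ⊎ y ≡ 0#
  xy≡0⇒x≡0∨y≡0 {x} e with x ≟ 0#
  ... | yes x≡0 = inj₁ x≡0
  ... | no x≢0  = inj₂ (xy≡0⇒y≡0 x≢0 e)

  *-cancelˡ : ∀ {x y z} → x ≢ 0# → x * y ≡ x * z → y ≡ z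
  *-cancelˡ {x} {y} {z} ne e = x-y≡0⇒x≡y (xy≡0⇒y≡0 ne (begin
    x * (y + - z)     ≡⟨ distribˡ _ _ _ ⟩
    x * y + x * - z   ≡⟨ cong₂ _+_ e (sym (-‿distribʳ-* x z)) ⟩
    x * z + - (x * z) ≡⟨ -‿inverseʳ _ ⟩
    0#                ∎))
    where open ≡-Reasoning

  ^-nonZero : ∀ {x} → x ≢ 0# → ∀ k → x ^ k ≢ 0#
  ^-nonZero ne zero    e = 0≢1 (sym e)
  ^-nonZero ne (suc k) e = *-nonZero ne (^-nonZero ne k) e

  x^n≡0⇒x≡0 : ∀ {x} n → x ^ n ≡ 0# → x ≡ 0#
  x^n≡0⇒x≡0 {x} n e with x ≟ 0#
  ... | yes p = p
  ... | no ne = ⊥-elim (^-nonZero ne n e)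

  private
    Sum Product : List Carrier → Carrier
    Sum     = foldr _+_ 0#
    Product = foldr _*_ 1#

    Sum-↭ : ∀ {xs ys} → xs ↭ ys → Sum xs ≡ Sum ys
    Sum-↭ ↭refl        = refl
    Sum-↭ (prep x p)   = cong (x +_) (Sum-↭ p)
    Sum-↭ (swap {xs} {ys} x y p) = begin
      x + (y + Sum xs)   ≡⟨ +-assoc _ _ _ ⟨
      x + y + Sum xs     ≡⟨ cong₂ _+_ (+-comm x y) (Sum-↭ p) ⟩
      y + x + Sum ys     ≡⟨ +-assoc _ _ _ ⟩
      y + (x + Sum ys)   ∎
      where open ≡-Reasoning
    Sum-↭ (↭trans p r) = trans (Sum-↭ p) (Sum-↭ r)

    Product-↭ : ∀ {xs ys} → xs ↭ ys → Product xs ≡ Product ys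
    Product-↭ ↭refl        = refl
    Product-↭ (prep x p)   = cong (x *_) (Product-↭ p)
    Product-↭ (swap {xs} {ys} x y p) = begin
      x * (y * Product xs)   ≡⟨ *-assoc _ _ _ ⟨
      x * y * Product xs     ≡⟨ cong₂ _*_ (*-comm x y) (Product-↭ p) ⟩
      y * x * Product ys     ≡⟨ *-assoc _ _ _ ⟩
      y * (x * Product ys)   ∎
      where open ≡-Reasoning
    Product-↭ (↭trans p r) = trans (Product-↭ p) (Product-↭ r)

    Sum-translate : ∀ c xs → Sum (map (c +_) xs) ≡ length xs · c + Sum xs
    Sum-translate c []       = sym (+-identityˡ 0#)
    Sum-translate c (x ∷ xs) = begin
      c + x + Sum (map (c +_) xs)          ≡⟨ cong (c + x +_) (Sum-translate c xs) ⟩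
      c + x + (length xs · c + Sum xs)     ≡⟨ +-interchange c x (length xs · c) (Sum xs) ⟩
      (c + length xs · c) + (x + Sum xs)   ∎
      where open ≡-Reasoning

    Product-scale : ∀ c xs → Product (map (c *_) xs) ≡ c ^ length xs * Product xs
    Product-scale c []       = sym (*-identityˡ 1#)
    Product-scale c (x ∷ xs) = begin
      c * x * Product (map (c *_) xs)             ≡⟨ cong (c * x *_) (Product-scale c xs) ⟩
      c * x * (c ^ length xs * Product xs)        ≡⟨ *-interchange c x (c ^ length xs) (Product xs) ⟩
      (c * c ^ length xs) * (x * Product xs)      ∎
      where open ≡-Reasoning

    Product-nonZero : ∀ xs → All (_≢ 0#) xs → Product xs ≢ 0#
    Product-nonZero []       []         e = 0≢1 (sym e)
    Product-nonZero (x ∷ xs) (nx ∷ nxs) e = *-nonZero nx (Product-nonZero xs nxs) e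

  -- Translation by 1 permutes the field, so the sum over all elements equals itself plus `card`
  -- copies of 1.
  card·1≡0 : card · 1# ≡ 0#
  card·1≡0 = +-cancelʳ (Sum elements) _ _ (begin
    card · 1# + Sum elements      ≡⟨ Sum-translate 1# elements ⟨
    Sum (map (1# +_) elements)    ≡⟨ Sum-↭ perm ⟩
    Sum elements                  ≡⟨ +-identityˡ _ ⟨
    0# + Sum elements             ∎)
    where
      open ≡-Reasoning
      perm : map (1# +_) elements ↭ elements
      perm = ↭-unique (Uniqueₚ.map⁺ (+-cancelˡ 1# _ _) unique) unique
        (λ x _ → complete x)
        (λ x _ → subst (_∈ map (1# +_) elements)
          (trans (sym (+-assoc 1# (- 1#) x)) (trans (cong (_+ x) (-‿inverseʳ 1#)) (+-identityˡ x)))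
          (∈ₚ.∈-map⁺ (1# +_) (complete (- 1# + x))))

  private
    zero-split : Σ (List Carrier) λ nz → elements ↭ 0# ∷ nz
    zero-split with ∈ₚ.∈-∃++ (complete 0#)
    ... | as , bs , e = as ++ bs , subst (_↭ 0# ∷ as ++ bs) (sym e) (↭ₚ.shift 0# as bs)

  -- Multiplication by a nonzero x permutes the nonzero elements, so their product P satisfies P =
  -- x^(card - 1) P, and P is nonzero.
  x^card≡x : ∀ x → x ^ card ≡ x
  x^card≡x x with zero-split
  ... | nz , perm with ↭ₚ.↭-length perm
  ...   | len rewrite len with x ≟ 0#
  ...     | yes refl = zeroˡ _
  ...     | no x≢0   = trans (cong (x *_) x^[card-1]≡1) (*-identityʳ x)
    where
      open ≡-Reasoning
      unique′ : Unique (0# ∷ nz)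
      unique′ = ↭ₛₚ.Unique-resp-↭ (setoid Carrier) (↭⇒↭ₛ perm) unique

      complete′ : ∀ y → y ∈ 0# ∷ nz
      complete′ y = ↭ₚ.∈-resp-↭ perm (complete y)

      perm′ : map (x *_) (0# ∷ nz) ↭ 0# ∷ nz
      perm′ = ↭-unique (Uniqueₚ.map⁺ (*-cancelˡ x≢0) unique′) unique′
        (λ y _ → complete′ y)
        (λ y _ → subst (_∈ map (x *_) (0# ∷ nz))
          (trans (sym (*-assoc x (inv x) y)) (trans (cong (_* y) (inverseʳ x x≢0)) (*-identityˡ y)))
          (∈ₚ.∈-map⁺ (x *_) (complete′ (inv x * y))))

      -- As x · 0 = 0, both lists begin with 0; dropping it leaves a permutation of the nonzero
      -- elements.
      perm″ : map (x *_) nz ↭ nz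
      perm″ = ↭ₚ.drop-∷ (subst (λ z → z ∷ map (x *_) nz ↭ 0# ∷ nz) (zeroʳ x) perm′)

      nz-nonZero : All (_≢ 0#) nz
      nz-nonZero = All.map (λ ne e → ne (sym e)) (AllPairs.head unique′)

      x^[card-1]≡1 : x ^ length nz ≡ 1#
      x^[card-1]≡1 = *-cancelˡ (Product-nonZero nz nz-nonZero) (begin
        Product nz * x ^ length nz     ≡⟨ *-comm _ _ ⟩
        x ^ length nz * Product nz     ≡⟨ Product-scale x nz ⟨
        Product (map (x *_) nz)        ≡⟨ Product-↭ perm″ ⟩
        Product nz                     ≡⟨ *-identityʳ _ ⟨
        Product nz * 1#                ∎)

  [p^k]·1 : ∀ p k → (p ℕ.^ k) · 1# ≡ (p · 1#) ^ k
  [p^k]·1 p zero    = +-identityʳ 1#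
  [p^k]·1 p (suc k) = trans (×1-homo-* p (p ℕ.^ k)) (cong (p · 1# *_) ([p^k]·1 p k))

  -- `card · 1#` is the k-th power of `p · 1#` and vanishes; a field has no nonzero nilpotents.
  card≡p^k⇒p·1≡0 : ∀ p k → card ≡ p ℕ.^ k → p · 1# ≡ 0#
  card≡p^k⇒p·1≡0 p k e = x^n≡0⇒x≡0 k (begin
    (p · 1#) ^ k     ≡⟨ [p^k]·1 p k ⟨
    (p ℕ.^ k) · 1#   ≡⟨ cong (_· 1#) e ⟨
    card · 1#        ≡⟨ card·1≡0 ⟩
    0#               ∎)
    where open ≡-Reasoning

  private module PrimeCharacteristic {p : ℕ} (pr : Prime p) (p·1≡0 : p · 1# ≡ 0#) where
    ∣-·≡0 : ∀ {m} → p ∣ m → ∀ x → m · x ≡ 0#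
    ∣-·≡0 (divides c refl) x = begin
      (c ℕ.* p) · x              ≡⟨ cong ((c ℕ.* p) ·_) (*-identityˡ x) ⟨
      (c ℕ.* p) · (1# * x)       ≡⟨ ×-assoc-* (c ℕ.* p) 1# x ⟨
      ((c ℕ.* p) · 1#) * x       ≡⟨ cong (_* x) (×1-homo-* c p) ⟩
      ((c · 1#) * (p · 1#)) * x  ≡⟨ cong (λ z → ((c · 1#) * z) * x) p·1≡0 ⟩
      ((c · 1#) * 0#) * x        ≡⟨ cong (_* x) (zeroʳ _) ⟩
      0# * x                     ≡⟨ zeroˡ x ⟩
      0#                         ∎
      where open ≡-Reasoning

    p∤k! : ∀ k → k < p → ¬ p ∣ k !
    p∤k! zero    _   p∣1 = ℕₚ.<⇒≱ (nonTrivial⇒n>1 p) (∣⇒≤ p∣1)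
      where instance _ = prime⇒nonTrivial pr
    p∤k! (suc k) k<p p∣  with euclidsLemma (suc k) (k !) pr p∣
    ... | inj₁ p∣k+1 = ℕₚ.<⇒≱ k<p (∣⇒≤ p∣k+1)
    ... | inj₂ p∣k!  = p∤k! k (ℕₚ.<⇒≤ k<p) p∣k!

    p∣p! : p ∣ p !
    p∣p! = n∣n! p {{prime⇒nonZero pr}}

    p∣pCk*k![p-k]! : ∀ k → k < p → p ∣ (p Comb.C k) ℕ.* (k ! ℕ.* (p ∸ k) !)
    p∣pCk*k![p-k]! k k<p = subst (p ∣_) (sym (trans
      (cong (ℕ._* (k ! ℕ.* (p ∸ k) !)) (Comb.nCk≡n!/k![n-k]! (ℕₚ.<⇒≤ k<p)))
      (m/n*n≡m (Comb.k![n∸k]!∣n! (ℕₚ.<⇒≤ k<p))))) p∣p!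
      where instance _ = ℕₚ._!*_!≢0 k (p ∸ k)

    -- p divides p! = C(p, k) k! (p - k)! but neither factorial, since both are products of numbers
    -- below p.
    p∣pCk : ∀ k → 0 < k → k < p → p ∣ p Comb.C k
    p∣pCk k 0<k k<p with euclidsLemma (p Comb.C k) (k ! ℕ.* (p ∸ k) !) pr (p∣pCk*k![p-k]! k k<p)
    ... | inj₁ d = d
    ... | inj₂ d with euclidsLemma (k !) ((p ∸ k) !) pr d
    ...   | inj₁ e = ⊥-elim (p∤k! k k<p e)
    ...   | inj₂ e = ⊥-elim (p∤k! (p ∸ k) (ℕₚ.∸-monoʳ-< 0<k (ℕₚ.<⇒≤ k<p)) e)

  open SemiringSum semiring using (sum; sum-cong-≗; sum-replicate-zero; sum-init-last)

  -- The two outer terms of the binomial expansion are split off; every inner coefficient is a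
  -- multiple of p and vanishes in the field.
  ^p-distrib-+ : ∀ {p} → Prime p → p · 1# ≡ 0# → ∀ x y → (x + y) ^ p ≡ x ^ p + y ^ p
  ^p-distrib-+ {zero}  pr _ x y with () ← prime⇒nonZero pr
  ^p-distrib-+ {suc r} pr p·1≡0 x y = begin
    (x + y) ^ suc r                                   ≡⟨ BinomialThm.theorem commutativeSemiring (suc r) x y ⟩
    term zero + sum (term ∘ suc)                      ≡⟨ cong (term zero +_) (sum-init-last (term ∘ suc)) ⟩
    term zero + (sum inner + term (suc (fromℕ r)))    ≡⟨ cong (λ z → term zero + (z + term (suc (fromℕ r)))) inner≡0 ⟩
    term zero + (0# + term (suc (fromℕ r)))           ≡⟨ cong₂ _+_ first (trans (+-identityˡ _) last) ⟩
    y ^ suc r + x ^ suc r                             ≡⟨ +-comm _ _ ⟩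
    x ^ suc r + y ^ suc r                             ∎
    where
      open ≡-Reasoning
      open PrimeCharacteristic pr p·1≡0
      term : Fin (suc (suc r)) → Carrier
      term = BinomialTerms.binomialTerm semiring x y (suc r)

      inner : Fin r → Carrier
      inner i = term (suc (inject₁ i))

      inner≡0 : sum inner ≡ 0#
      inner≡0 = trans (sum-cong-≗ (λ i → ∣-·≡0 (p∣pCk (suc (toℕ (inject₁ i))) (s≤s z≤n)
        (s≤s (subst (_< r) (sym (Finₚ.toℕ-inject₁ i)) (Finₚ.toℕ<n i)))) _)) (sum-replicate-zero r)

      first : term zero ≡ y ^ suc r
      first = trans (+-identityʳ _) (*-identityˡ _)

      last : term (suc (fromℕ r)) ≡ x ^ suc r
      last rewrite Finₚ.toℕ-fromℕ r | Comb.nCn≡1 (suc r) | ℕₚ.n∸n≡0 r =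
        trans (+-identityʳ _) (*-identityʳ _)

  ^[p^k]-distrib-+ : ∀ {p} → Prime p → p · 1# ≡ 0# → ∀ k x y →
                     (x + y) ^ (p ℕ.^ k) ≡ x ^ (p ℕ.^ k) + y ^ (p ℕ.^ k)
  ^[p^k]-distrib-+ pr p0 zero x y = begin
    (x + y) * 1#      ≡⟨ distribʳ _ _ _ ⟩
    x * 1# + y * 1#   ∎
    where open ≡-Reasoning
  ^[p^k]-distrib-+ {p} pr p0 (suc k) x y = begin
    (x + y) ^ (p ℕ.* p ℕ.^ k)                         ≡⟨ ^-assocʳ (x + y) p (p ℕ.^ k) ⟨
    ((x + y) ^ p) ^ (p ℕ.^ k)                         ≡⟨ cong (_^ (p ℕ.^ k)) (^p-distrib-+ pr p0 x y) ⟩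
    (x ^ p + y ^ p) ^ (p ℕ.^ k)                       ≡⟨ ^[p^k]-distrib-+ pr p0 k _ _ ⟩
    (x ^ p) ^ (p ℕ.^ k) + (y ^ p) ^ (p ℕ.^ k)         ≡⟨ cong₂ _+_ (^-assocʳ x p _) (^-assocʳ y p _) ⟩
    x ^ (p ℕ.* p ℕ.^ k) + y ^ (p ℕ.* p ℕ.^ k)         ∎
    where open ≡-Reasoning

-- Polynomials as coefficient lists: products, degree bounds, evaluation, counting roots.

module Polynomials (F : FiniteField) (q : ℕ) where
  open FiniteField F
  open FieldLemmas F
  open FF F q

  ≈ₚ-sym : ∀ {p r} → p ≈ₚ r → r ≈ₚ p
  ≈ₚ-sym e k = sym (e k)

  ≈ₚ-trans : ∀ {p r s} → p ≈ₚ r → r ≈ₚ s → p ≈ₚ s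
  ≈ₚ-trans e e′ k = trans (e k) (e′ k)

  coeff-+ₚ : ∀ p r k → coeff (p +ₚ r) k ≡ coeff p k + coeff r k
  coeff-+ₚ []      r       k       = sym (+-identityˡ _)
  coeff-+ₚ (x ∷ p) []      k       = sym (+-identityʳ _)
  coeff-+ₚ (x ∷ p) (y ∷ r) zero    = refl
  coeff-+ₚ (x ∷ p) (y ∷ r) (suc k) = coeff-+ₚ p r k

  coeff-scale : ∀ c p k → coeff (scale c p) k ≡ c * coeff p k
  coeff-scale c []      k       = sym (zeroʳ c)
  coeff-scale c (x ∷ p) zero    = refl
  coeff-scale c (x ∷ p) (suc k) = coeff-scale c p k

  coeff-*ₚ-zero : ∀ x p r → coeff ((x ∷ p) *ₚ r) 0 ≡ x * coeff r 0
  coeff-*ₚ-zero x p r = trans (coeff-+ₚ (scale x r) _ 0)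
    (trans (+-identityʳ _) (coeff-scale x r 0))

  coeff-*ₚ-suc : ∀ x p r k → coeff ((x ∷ p) *ₚ r) (suc k) ≡ x * coeff r (suc k) + coeff (p *ₚ r) k
  coeff-*ₚ-suc x p r k = trans (coeff-+ₚ (scale x r) _ (suc k))
    (cong (_+ coeff (p *ₚ r) k) (coeff-scale x r (suc k)))

  *ₚ-zeroʳ : ∀ p → (p *ₚ []) ≈ₚ []
  *ₚ-zeroʳ []      k       = refl
  *ₚ-zeroʳ (x ∷ p) zero    = refl
  *ₚ-zeroʳ (x ∷ p) (suc k) = *ₚ-zeroʳ p k

  *ₚ-congˡ : ∀ p r s → r ≈ₚ s → (p *ₚ r) ≈ₚ (p *ₚ s)
  *ₚ-congˡ []      r s e k       = refl
  *ₚ-congˡ (x ∷ p) r s e zero    = trans (coeff-*ₚ-zero x p r) (trans (cong (x *_) (e 0)) (sym (coeff-*ₚ-zero x p s)))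
  *ₚ-congˡ (x ∷ p) r s e (suc k) = trans (coeff-*ₚ-suc x p r k)
    (trans (cong₂ (λ a b → x * a + b) (e (suc k)) (*ₚ-congˡ p r s e k)) (sym (coeff-*ₚ-suc x p s k)))

  -- `_*ₚ_` recurses on its left factor; this is the mirror recursion in the right factor, on which
  -- commutativity rests.
  coeff-*ₚ-sucʳ : ∀ p x r k → coeff (p *ₚ (x ∷ r)) (suc k) ≡ x * coeff p (suc k) + coeff (p *ₚ r) k
  coeff-*ₚ-sucʳ []      x r k       = sym (trans (+-identityʳ _) (zeroʳ x))
  coeff-*ₚ-sucʳ (y ∷ p) x r zero    = begin
    coeff ((y ∷ p) *ₚ (x ∷ r)) 1                     ≡⟨ coeff-*ₚ-suc y p (x ∷ r) 0 ⟩
    y * coeff r 0 + coeff (p *ₚ (x ∷ r)) 0           ≡⟨ cong (y * coeff r 0 +_) (constant p) ⟩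
    y * coeff r 0 + x * coeff p 0                    ≡⟨ +-comm _ _ ⟩
    x * coeff p 0 + y * coeff r 0                    ≡⟨ cong (x * coeff p 0 +_) (coeff-*ₚ-zero y p r) ⟨
    x * coeff p 0 + coeff ((y ∷ p) *ₚ r) 0           ∎
    where
      open ≡-Reasoning
      constant : ∀ p → coeff (p *ₚ (x ∷ r)) 0 ≡ x * coeff p 0
      constant []      = sym (zeroʳ x)
      constant (z ∷ p) = trans (coeff-*ₚ-zero z p (x ∷ r)) (*-comm z x)
  coeff-*ₚ-sucʳ (y ∷ p) x r (suc k) = begin
    coeff ((y ∷ p) *ₚ (x ∷ r)) (suc (suc k))
      ≡⟨ coeff-*ₚ-suc y p (x ∷ r) (suc k) ⟩
    y * coeff r (suc k) + coeff (p *ₚ (x ∷ r)) (suc k)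
      ≡⟨ cong (y * coeff r (suc k) +_) (coeff-*ₚ-sucʳ p x r k) ⟩
    y * coeff r (suc k) + (x * coeff p (suc k) + coeff (p *ₚ r) k)
      ≡⟨ solve 3 (λ a b c → (a :+ (b :+ c)) := (b :+ (a :+ c))) refl _ _ _ ⟩
    x * coeff p (suc k) + (y * coeff r (suc k) + coeff (p *ₚ r) k)
      ≡⟨ cong (x * coeff p (suc k) +_) (coeff-*ₚ-suc y p r k) ⟨
    x * coeff p (suc k) + coeff ((y ∷ p) *ₚ r) (suc k)
      ∎
    where open ≡-Reasoning

  *ₚ-comm : ∀ p r → (p *ₚ r) ≈ₚ (r *ₚ p)
  *ₚ-comm []      r k       = sym (*ₚ-zeroʳ r k)
  *ₚ-comm (x ∷ p) [] zero    = refl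
  *ₚ-comm (x ∷ p) (y ∷ r) zero    = trans (coeff-*ₚ-zero x p (y ∷ r))
    (trans (*-comm x y) (sym (coeff-*ₚ-zero y r (x ∷ p))))
  *ₚ-comm (x ∷ p) r (suc k) = begin
    coeff ((x ∷ p) *ₚ r) (suc k)                ≡⟨ coeff-*ₚ-suc x p r k ⟩
    x * coeff r (suc k) + coeff (p *ₚ r) k      ≡⟨ cong (x * coeff r (suc k) +_) (*ₚ-comm p r k) ⟩
    x * coeff r (suc k) + coeff (r *ₚ p) k      ≡⟨ coeff-*ₚ-sucʳ r x p k ⟨
    coeff (r *ₚ (x ∷ p)) (suc k)                ∎
    where open ≡-Reasoning

  -- A bound stated through coefficients respects `_≈ₚ_` and covers the zero polynomial, which the
  -- length of the list does not.
  DegLE : Poly → ℕ → Set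
  DegLE p d = ∀ k → d < k → coeff p k ≡ 0#

  coeff-beyond : ∀ p k → length p ≤ k → coeff p k ≡ 0#
  coeff-beyond []      k       _       = refl
  coeff-beyond (x ∷ p) (suc k) (s≤s h) = coeff-beyond p k h

  coeff-take : ∀ n p k → k < n → coeff (take n p) k ≡ coeff p k
  coeff-take (suc n) []      k       _       = refl
  coeff-take (suc n) (x ∷ p) zero    _       = refl
  coeff-take (suc n) (x ∷ p) (suc k) (s≤s h) = coeff-take n p k h

  take-≈ : ∀ n p → (∀ k → n ≤ k → coeff p k ≡ 0#) → take n p ≈ₚ p
  take-≈ n p h k with k ℕ.<? n
  ... | yes k<n = coeff-take n p k k<n
  ... | no k≮n  = trans (coeff-beyond (take n p) k (ℕₚ.≤-trans (subst (_≤ n) (sym (Listₚ.length-take n p)) (ℕₚ.m⊓n≤m n _)) n≤k)) (sym (h k n≤k))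
    where n≤k = ℕₚ.≮⇒≥ k≮n

  DegLE-+ₚ : ∀ {p r d} → DegLE p d → DegLE r d → DegLE (p +ₚ r) d
  DegLE-+ₚ {p} {r} hp hr k d<k = trans (coeff-+ₚ p r k)
    (trans (cong₂ _+_ (hp k d<k) (hr k d<k)) (+-identityˡ 0#))

  DegLE-scale : ∀ {p d} c → DegLE p d → DegLE (scale c p) d
  DegLE-scale {p} c hp k d<k = trans (coeff-scale c p k) (trans (cong (c *_) (hp k d<k)) (zeroʳ c))

  *ₚ-≈0ˡ : ∀ p r → p ≈ₚ [] → (p *ₚ r) ≈ₚ []
  *ₚ-≈0ˡ []      r e k       = refl
  *ₚ-≈0ˡ (x ∷ p) r e zero    = trans (coeff-*ₚ-zero x p r) (trans (cong (_* coeff r 0) (e 0)) (zeroˡ _))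
  *ₚ-≈0ˡ (x ∷ p) r e (suc k) = trans (coeff-*ₚ-suc x p r k) (trans
    (cong₂ _+_ (trans (cong (_* coeff r (suc k)) (e 0)) (zeroˡ _)) (*ₚ-≈0ˡ p r (e ∘ suc) k))
    (+-identityˡ 0#))

  coeff-*ₚ-constant : ∀ p r → DegLE p 0 → ∀ k → coeff (p *ₚ r) k ≡ coeff p 0 * coeff r k
  coeff-*ₚ-constant []      r h k       = sym (zeroˡ _)
  coeff-*ₚ-constant (x ∷ p) r h zero    = coeff-*ₚ-zero x p r
  coeff-*ₚ-constant (x ∷ p) r h (suc k) = trans (coeff-*ₚ-suc x p r k) (trans
    (cong (x * coeff r (suc k) +_) (*ₚ-≈0ˡ p r (λ j → h (suc j) (s≤s z≤n)) k)) (+-identityʳ _))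

  DegLE-tail : ∀ {x p d} → DegLE (x ∷ p) (suc d) → DegLE p d
  DegLE-tail h k d<k = h (suc k) (s≤s d<k)

  DegLE-*ₚ : ∀ p r {a b} → DegLE p a → DegLE r b → DegLE (p *ₚ r) (a ℕ.+ b)
  DegLE-*ₚ p r {zero} hp hr k h = trans (coeff-*ₚ-constant p r hp k) (trans (cong (coeff p 0 *_) (hr k h)) (zeroʳ _))
  DegLE-*ₚ []      r {suc a} hp hr k h = refl
  DegLE-*ₚ (x ∷ p) r {suc a} {b} hp hr (suc k) (s≤s h) = trans (coeff-*ₚ-suc x p r k) (trans (cong₂ _+_
    (trans (cong (x *_) (hr (suc k) (ℕₚ.≤-trans (s≤s (ℕₚ.m≤n+m b a)) (ℕₚ.m≤n⇒m≤1+n h)))) (zeroʳ x))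
    (DegLE-*ₚ p r (DegLE-tail {x} {p} hp) hr k h)) (+-identityˡ 0#))

  coeff-*ₚ-top : ∀ p r a b → DegLE p a → DegLE r b → coeff (p *ₚ r) (a ℕ.+ b) ≡ coeff p a * coeff r b
  coeff-*ₚ-top p       r zero    b hp hr = coeff-*ₚ-constant p r hp b
  coeff-*ₚ-top []      r (suc a) b hp hr = sym (zeroˡ _)
  coeff-*ₚ-top (x ∷ p) r (suc a) b hp hr = trans (coeff-*ₚ-suc x p r (a ℕ.+ b)) (trans (cong₂ _+_
    (trans (cong (x *_) (hr (suc (a ℕ.+ b)) (s≤s (ℕₚ.m≤n+m b a)))) (zeroʳ x))
    (coeff-*ₚ-top p r a b (DegLE-tail {x} {p} hp) hr)) (+-identityˡ _))

  DegLE-^ₚ : ∀ p k → DegLE p 1 → DegLE (p ^ₚ k) k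
  DegLE-^ₚ p zero    h j 0<j = coeff-beyond (1# ∷ []) j 0<j
  DegLE-^ₚ p (suc k) h       = DegLE-*ₚ p (p ^ₚ k) h (DegLE-^ₚ p k h)

  eval : Poly → Carrier → Carrier
  eval []      x = 0#
  eval (c ∷ p) x = c + x * eval p x

  eval-+ₚ : ∀ p r x → eval (p +ₚ r) x ≡ eval p x + eval r x
  eval-+ₚ []      r       x = sym (+-identityˡ _)
  eval-+ₚ (a ∷ p) []      x = sym (+-identityʳ _)
  eval-+ₚ (a ∷ p) (b ∷ r) x = trans (cong (λ z → a + b + x * z) (eval-+ₚ p r x))
    (solve 5 (λ a b x y z → (a :+ b :+ x :* (y :+ z)) := (a :+ x :* y :+ (b :+ x :* z))) refl a b x _ _)

  eval-scale : ∀ c p x → eval (scale c p) x ≡ c * eval p x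
  eval-scale c []      x = sym (zeroʳ c)
  eval-scale c (a ∷ p) x = trans (cong (λ z → c * a + x * z) (eval-scale c p x))
    (solve 4 (λ c a x y → (c :* a :+ x :* (c :* y)) := (c :* (a :+ x :* y))) refl c a x _)

  eval-*ₚ : ∀ p r x → eval (p *ₚ r) x ≡ eval p x * eval r x
  eval-*ₚ []      r x = sym (zeroˡ _)
  eval-*ₚ (a ∷ p) r x = begin
    eval (scale a r +ₚ (0# ∷ (p *ₚ r))) x            ≡⟨ eval-+ₚ (scale a r) _ x ⟩
    eval (scale a r) x + (0# + x * eval (p *ₚ r) x)  ≡⟨ cong₂ _+_ (eval-scale a r x) (trans (+-identityˡ _) (cong (x *_) (eval-*ₚ p r x))) ⟩
    a * eval r x + x * (eval p x * eval r x)         ≡⟨ solve 4 (λ a r x p → (a :* r :+ x :* (p :* r)) := ((a :+ x :* p) :* r)) refl a _ x _ ⟩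
    (a + x * eval p x) * eval r x                    ∎
    where open ≡-Reasoning

  eval-linear : ∀ a b x → eval (b ∷ a ∷ []) x ≡ a * x + b
  eval-linear a b x = trans (cong (λ z → b + x * (a + z)) (zeroʳ x))
    (trans (cong (λ z → b + x * z) (+-identityʳ a)) (trans (+-comm _ _) (cong (_+ b) (*-comm x a))))

  eval-≈0 : ∀ {p} → p ≈ₚ [] → ∀ x → eval p x ≡ 0#
  eval-≈0 {[]}    e x = refl
  eval-≈0 {c ∷ p} e x = trans (cong₂ _+_ (e 0) (trans (cong (x *_) (eval-≈0 {p} (e ∘ suc) x)) (zeroʳ x))) (+-identityˡ 0#)

  eval-cong : ∀ {p r} → p ≈ₚ r → ∀ x → eval p x ≡ eval r x
  eval-cong {[]}    {r}     e x = sym (eval-≈0 {r} (≈ₚ-sym {[]} {r} e) x)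
  eval-cong {c ∷ p} {[]}    e x = eval-≈0 {c ∷ p} e x
  eval-cong {c ∷ p} {d ∷ r} e x = cong₂ (λ u v → u + x * v) (e 0) (eval-cong {p} {r} (e ∘ suc) x)

  private
    -- Synthetic division of `c ∷ p` by x - r: the Horner values of the successive tails at r are
    -- the coefficients of the quotient.
    quot : Carrier → Carrier → Poly → Poly
    quot r c []       = []
    quot r c (d ∷ ds) = eval (d ∷ ds) r ∷ quot r d ds

    length-quot : ∀ r c p → length (quot r c p) ≡ length p
    length-quot r c []      = refl
    length-quot r c (d ∷ p) = cong suc (length-quot r d p)

    -- This is P(x) - P(r) = (x - r) Q(x), rearranged without subtraction so that semiring reasoning
    -- suffices.
    eval-quot : ∀ r c p x → eval (c ∷ p) x + r * eval (quot r c p) x ≡ eval (c ∷ p) r + x * eval (quot r c p) x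
    eval-quot r c [] x = cong₂ _+_ (cong (c +_) (trans (zeroʳ x) (sym (zeroʳ r)))) (trans (zeroʳ r) (sym (zeroʳ x)))
    eval-quot r c (d ∷ p) x = begin
      c + x * P + r * (R + x * Q)   ≡⟨ solve 6 (λ c x P r R Q → (c :+ x :* P :+ r :* (R :+ x :* Q)) := (c :+ r :* R :+ x :* (P :+ r :* Q))) refl c x P r R Q ⟩
      c + r * R + x * (P + r * Q)   ≡⟨ cong (λ z → c + r * R + x * z) (eval-quot r d p x) ⟩
      c + r * R + x * (R + x * Q)   ∎
      where
        open ≡-Reasoning
        P = eval (d ∷ p) x
        R = eval (d ∷ p) r
        Q = eval (quot r d p) x

    quot≈0 : ∀ r c p → eval (c ∷ p) r ≡ 0# → quot r c p ≈ₚ [] → (c ∷ p) ≈ₚ []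
    quot≈0 r c [] e h zero    = trans (sym (trans (cong (c +_) (zeroʳ r)) (+-identityʳ c))) e
    quot≈0 r c [] e h (suc k) = refl
    quot≈0 r c (d ∷ p) e h = λ where
        zero    → trans (sym (trans (cong (c +_) (trans (cong (r *_) (h 0)) (zeroʳ r))) (+-identityʳ c))) e
        (suc k) → quot≈0 r d p (h 0) (h ∘ suc) k

  -- Dividing by x - r shortens the polynomial by one coefficient and keeps every root other than r.
  too-many-roots : ∀ p rs → Unique rs → length p ≤ length rs → All (λ r → eval p r ≡ 0#) rs → p ≈ₚ []
  too-many-roots []      rs       _        _       _        = λ _ → refl
  too-many-roots (c ∷ p) (r ∷ rs) (r∉ ∷ u) (s≤s l) (e ∷ es) =
    quot≈0 r c p e (too-many-roots (quot r c p) rs u (subst (_≤ length rs) (sym (length-quot r c p)) l)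
      (All.zipWith (λ (r≢s , s-root) → quot-root r≢s s-root) (r∉ , es)))
    where
      quot-root : ∀ {s} → r ≢ s → eval (c ∷ p) s ≡ 0# → eval (quot r c p) s ≡ 0#
      quot-root {s} r≢s s-root with eval (quot r c p) s ≟ 0#
      ... | yes z = z
      ... | no nz = ⊥-elim (r≢s (*-cancelˡ nz (begin
        Q * r               ≡⟨ trans (*-comm Q r) (sym (+-identityˡ _)) ⟩
        0# + r * Q          ≡⟨ cong (_+ r * Q) s-root ⟨
        eval (c ∷ p) s + r * Q   ≡⟨ eval-quot r c p s ⟩
        eval (c ∷ p) r + s * Q   ≡⟨ cong (_+ s * Q) e ⟩
        0# + s * Q          ≡⟨ trans (+-identityˡ _) (*-comm s Q) ⟩
        Q * s               ∎)))
        where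
          open ≡-Reasoning
          Q = eval (quot r c p) s

  too-many-roots-deg : ∀ p rs → Unique rs → (∀ k → length rs ≤ k → coeff p k ≡ 0#) →
                       All (λ r → eval p r ≡ 0#) rs → p ≈ₚ []
  too-many-roots-deg p rs u deg< roots = ≈ₚ-trans {p} {take l p} {[]} (≈ₚ-sym {take l p} {p} (take-≈ l p deg<))
    (too-many-roots (take l p) rs u
      (subst (_≤ l) (sym (Listₚ.length-take l p)) (ℕₚ.m⊓n≤m l _))
      (All.map (λ {r} → trans (eval-cong {take l p} {p} (take-≈ l p deg<) r)) roots))
    where l = length rs

  too-many-roots′ : ∀ p r (ρ : ℕ → Carrier) → (∀ {i j} → i < j → j < r → ρ i ≢ ρ j) →
                    (∀ j → eval p (ρ j) ≡ 0#) → (∀ k → r ≤ k → coeff p k ≡ 0#) → p ≈ₚ []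
  too-many-roots′ p r ρ inj root deg<r = too-many-roots-deg p (applyUpTo ρ r) (Uniqueₚ.applyUpTo⁺₁ ρ r inj)
    (λ k h → deg<r k (subst (_≤ k) (Listₚ.length-applyUpTo ρ r) h)) (Allₚ.applyUpTo⁺₂ ρ r root)

  -- Subtracting from `p` its top coefficient times `s` cancels degree r, and what is left still has
  -- r distinct roots.
  monic-unique : ∀ p s r (ρ : ℕ → Carrier) → (∀ {i j} → i < j → j < r → ρ i ≢ ρ j) →
                 (∀ j → eval p (ρ j) ≡ 0#) → (∀ j → eval s (ρ j) ≡ 0#) →
                 DegLE p r → DegLE s r → coeff s r ≡ 1# → p ≈ₚ scale (coeff p r) s
  monic-unique p s r ρ inj p-root s-root hp hs s-monic k = x-y≡0⇒x≡y (begin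
    coeff p k + - coeff (scale u s) k               ≡⟨ cong (λ z → coeff p k + - z) (coeff-scale u s k) ⟩
    coeff p k + - (u * coeff s k)                   ≡⟨ coeff-d k ⟨
    coeff d k                                       ≡⟨ too-many-roots′ d r ρ inj d-root d-small k ⟩
    0#                                              ∎)
    where
      open ≡-Reasoning
      u = coeff p r
      d = p +ₚ scale (- u) s

      coeff-d : ∀ k → coeff d k ≡ coeff p k + - (u * coeff s k)
      coeff-d k = trans (coeff-+ₚ p _ k) (cong (coeff p k +_) (trans (coeff-scale (- u) s k) (sym (-‿distribˡ-* u _))))

      d-root : ∀ j → eval d (ρ j) ≡ 0#
      d-root j = trans (eval-+ₚ p _ (ρ j)) (trans (cong₂ _+_ (p-root j)
        (trans (eval-scale (- u) s (ρ j)) (trans (cong (- u *_) (s-root j)) (zeroʳ _)))) (+-identityˡ 0#))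

      d-small : ∀ k → r ≤ k → coeff d k ≡ 0#
      d-small k r≤k with ℕₚ.m≤n⇒m<n∨m≡n r≤k
      ... | inj₁ r<k  = DegLE-+ₚ {p} {scale (- u) s} hp (DegLE-scale {s} (- u) hs) k r<k
      ... | inj₂ refl = trans (coeff-d r) (trans (cong (λ z → u + - (u * z)) s-monic)
        (trans (cong (λ z → u + - z) (*-identityʳ u)) (-‿inverseʳ u)))

-- Degree, leading coefficient and division with remainder.

module Degrees (F : FiniteField) (q : ℕ) where
  open FiniteField F
  open FieldLemmas F
  open FF F q
  open Polynomials F q

  private
    strip-∷ʳ-0 : ∀ xs → strip (xs ∷ʳ 0#) ≡ strip xs
    strip-∷ʳ-0 xs rewrite Listₚ.reverse-++ xs (0# ∷ []) with 0# ≟ 0#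
    ... | yes _ = refl
    ... | no c with () ← c refl

    strip-∷ʳ : ∀ xs {x} → x ≢ 0# → strip (xs ∷ʳ x) ≡ xs ∷ʳ x
    strip-∷ʳ xs {x} ne rewrite Listₚ.reverse-++ xs (x ∷ []) with x ≟ 0#
    ... | yes e with () ← ne e
    ... | no c = trans (Listₚ.unfold-reverse x (reverse xs)) (cong (_∷ʳ x) (Listₚ.reverse-involutive xs))

    lead-∷ʳ-0 : ∀ xs → lead (xs ∷ʳ 0#) ≡ lead xs
    lead-∷ʳ-0 xs rewrite Listₚ.reverse-++ xs (0# ∷ []) with 0# ≟ 0#
    ... | yes _ = refl
    ... | no c with () ← c refl

    lead-∷ʳ : ∀ xs {x} → x ≢ 0# → lead (xs ∷ʳ x) ≡ x
    lead-∷ʳ xs {x} ne rewrite Listₚ.reverse-++ xs (x ∷ []) with x ≟ 0#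
    ... | yes e with () ← ne e
    ... | no c = refl

    ∷ʳ-0-≈ : ∀ xs → (xs ∷ʳ 0#) ≈ₚ xs
    ∷ʳ-0-≈ []       zero    = refl
    ∷ʳ-0-≈ []       (suc k) = refl
    ∷ʳ-0-≈ (x ∷ xs) zero    = refl
    ∷ʳ-0-≈ (x ∷ xs) (suc k) = ∷ʳ-0-≈ xs k

    coeff-∷ʳ : ∀ xs x → coeff (xs ∷ʳ x) (length xs) ≡ x
    coeff-∷ʳ []       x = refl
    coeff-∷ʳ (y ∷ xs) x = coeff-∷ʳ xs x

  -- `deg` is 0 both for the zero polynomial and for nonzero constants; this view tells them apart.
  data Size (p : Poly) : Set where
    zero    : strip p ≡ [] → lead p ≡ 0# → p ≈ₚ [] → Size p
    nonZero : length (strip p) ≡ suc (deg p) → lead p ≢ 0# → coeff p (deg p) ≡ lead p → DegLE p (deg p) → Size p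

  private
    -- `strip` works from the end of the list, hence the induction along the reversed view: a
    -- trailing zero changes nothing, and the first nonzero coefficient from the end settles degree
    -- and leading coefficient.
    size′ : ∀ p → strip p ≈ₚ p × Size p
    size′ p = go (reverseView p)
      where
      go : ∀ {p} → Reverse p → strip p ≈ₚ p × Size p
      go [] = (λ _ → refl) , zero refl refl (λ _ → refl)
      go (xs ∶ r ∶ʳ x) with x ≟ 0# | go r
      ... | yes refl | e , s = (subst (_≈ₚ (xs ∷ʳ 0#)) (sym (strip-∷ʳ-0 xs)) (≈ₚ-trans {strip xs} {xs} {xs ∷ʳ 0#} e (λ k → sym (∷ʳ-0-≈ xs k)))) , size s
        where
        size : Size xs → Size (xs ∷ʳ 0#)
        size (zero h l z) = zero (trans (strip-∷ʳ-0 xs) h) (trans (lead-∷ʳ-0 xs) l) (≈ₚ-trans {xs ∷ʳ 0#} {xs} {[]} (∷ʳ-0-≈ xs) z)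
        size (nonZero h l c d) rewrite sym (strip-∷ʳ-0 xs) | sym (lead-∷ʳ-0 xs) =
          nonZero h l (trans (∷ʳ-0-≈ xs _) c) (λ k h → trans (∷ʳ-0-≈ xs k) (d k h))
      ... | no x≢0   | _     = (λ k → cong (λ z → coeff z k) stripped) ,
        nonZero (trans length′ (sym (cong suc deg′))) (λ e → x≢0 (trans (sym (lead-∷ʳ xs x≢0)) e))
          (trans (cong (coeff (xs ∷ʳ x)) deg′) (trans (coeff-∷ʳ xs x) (sym (lead-∷ʳ xs x≢0))))
          (λ k h → coeff-beyond (xs ∷ʳ x) k (subst (_≤ k) (trans (cong suc deg′) (sym (Listₚ.length-++-comm xs (x ∷ [])))) h))
        where
        stripped = strip-∷ʳ xs x≢0
        length′ : length (strip (xs ∷ʳ x)) ≡ suc (length xs)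
        length′ = trans (cong length stripped) (Listₚ.length-++-comm xs (x ∷ []))
        deg′ : deg (xs ∷ʳ x) ≡ length xs
        deg′ = cong (_∸ 1) length′

  strip-≈ : ∀ p → strip p ≈ₚ p
  strip-≈ p = proj₁ (size′ p)

  size : ∀ p → Size p
  size p = proj₂ (size′ p)

  DegLE-deg : ∀ p → DegLE p (deg p)
  DegLE-deg p with size p
  ... | zero _ _ z        = λ k _ → z k
  ... | nonZero _ _ _ h   = h

  coeff-deg : ∀ p → coeff p (deg p) ≡ lead p
  coeff-deg p with size p
  ... | zero _ l z        = trans (z _) (sym l)
  ... | nonZero _ _ c _   = c

  length-strip : ∀ p → length (strip p) ≤ suc (deg p)
  length-strip p with size p
  ... | zero h _ _ rewrite h = z≤n
  ... | nonZero h _ _ _   = ℕₚ.≤-reflexive h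

  lead≡0⇒≈0 : ∀ p → lead p ≡ 0# → p ≈ₚ []
  lead≡0⇒≈0 p l with size p
  ... | zero _ _ z        = z
  ... | nonZero _ n _ _   = ⊥-elim (n l)

  deg-unique : ∀ p {d} → DegLE p d → coeff p d ≢ 0# → deg p ≡ d
  deg-unique p {d} h n with size p
  ... | zero _ _ z        = ⊥-elim (n (z d))
  ... | nonZero _ n′ c h′ with ℕₚ.<-cmp (deg p) d
  ...   | tri< lt _ _ = ⊥-elim (n (h′ d lt))
  ...   | tri≈ _ eq _ = eq
  ...   | tri> _ _ gt = ⊥-elim (n′ (trans (sym c) (h (deg p) gt)))

  lead-unique : ∀ p {d} → DegLE p d → coeff p d ≢ 0# → lead p ≡ coeff p d
  lead-unique p h n = trans (sym (coeff-deg p)) (cong (coeff p) (deg-unique p h n))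

  1≢0 : 1# ≢ 0#
  1≢0 e = 0≢1 (sym e)

  coeff≡1⇒≢0 : ∀ {p d} → coeff p d ≡ 1# → coeff p d ≢ 0#
  coeff≡1⇒≢0 m e = 1≢0 (trans (sym m) e)

  deg-* : ∀ p r → lead p ≢ 0# → lead r ≢ 0# → deg (p *ₚ r) ≡ deg p ℕ.+ deg r
  deg-* p r np nr = deg-unique (p *ₚ r) (DegLE-*ₚ p r (DegLE-deg p) (DegLE-deg r))
    (λ e → *-nonZero np nr (trans (sym (trans (coeff-*ₚ-top p r (deg p) (deg r) (DegLE-deg p) (DegLE-deg r))
      (cong₂ _*_ (coeff-deg p) (coeff-deg r)))) e))

  deg-cong : ∀ p r → p ≈ₚ r → deg p ≡ deg r
  deg-cong p r e with size r
  ... | nonZero _ n c h = deg-unique p (λ k lt → trans (e k) (h k lt)) (λ z → n (trans (sym c) (trans (sym (e _)) z)))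
  ... | zero s _ z rewrite s with size p
  ...   | zero s′ _ _ rewrite s′ = refl
  ...   | nonZero _ n c _ = ⊥-elim (n (trans (sym c) (trans (e _) (z _))))

  module Division (P : Carrier → Set)
    (P0 : P 0#) (P+ : ∀ {x y} → P x → P y → P (x + y)) (P* : ∀ {x y} → P x → P y → P (x * y)) (P- : ∀ {x} → P x → P (- x)) where

    CoeffsIn-+ₚ : ∀ {p r} → CoeffsIn P p → CoeffsIn P r → CoeffsIn P (p +ₚ r)
    CoeffsIn-+ₚ []       hr       = hr
    CoeffsIn-+ₚ (a ∷ hp) []       = a ∷ hp
    CoeffsIn-+ₚ (a ∷ hp) (b ∷ hr) = P+ a b ∷ CoeffsIn-+ₚ hp hr

    CoeffsIn-scale : ∀ {c p} → P c → CoeffsIn P p → CoeffsIn P (scale c p)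
    CoeffsIn-scale hc []       = []
    CoeffsIn-scale hc (a ∷ hp) = P* hc a ∷ CoeffsIn-scale hc hp

    CoeffsIn-coeff : ∀ {p} → CoeffsIn P p → ∀ k → P (coeff p k)
    CoeffsIn-coeff []       k       = P0
    CoeffsIn-coeff (a ∷ hp) zero    = a
    CoeffsIn-coeff (a ∷ hp) (suc k) = CoeffsIn-coeff hp k

    -- From p = dv + r follows c + xp = (xd)v + (c + xr). The new remainder has degree at most deg
    -- v, and subtracting its top coefficient times v restores the bound. As v is monic nothing is
    -- inverted, so the coefficients stay in the subring `P`.
    divMod : ∀ v {e} → DegLE v (suc e) → coeff v (suc e) ≡ 1# → CoeffsIn P v → ∀ p → CoeffsIn P p →
             Σ Poly λ d → Σ Poly λ r → CoeffsIn P d × CoeffsIn P r × length r ≤ suc e × p ≈ₚ ((d *ₚ v) +ₚ r)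
    divMod v hv mv Pv [] [] = [] , [] , [] , [] , z≤n , λ _ → refl
    divMod v {e} hv mv Pv (c ∷ p) (Pc ∷ Pp) with divMod v hv mv Pv p Pp
    ... | d , r , Pd , Pr , lr , eq =
      -- The coefficients of `s` vanish from index e + 1 on, but its list may be longer; truncation
      -- yields a genuine length bound.
      t ∷ d , take (suc e) s , Pt ∷ Pd , Allₚ.take⁺ (suc e) Ps ,
      ℕₚ.≤-trans (ℕₚ.≤-reflexive (Listₚ.length-take (suc e) s)) (ℕₚ.m⊓n≤m (suc e) _) ,
      eq′
      where
      open ≡-Reasoning
      t = coeff (c ∷ r) (suc e)
      s = (c ∷ r) +ₚ scale (- t) v
      Pt = CoeffsIn-coeff (Pc ∷ Pr) (suc e)
      Ps = CoeffsIn-+ₚ (Pc ∷ Pr) (CoeffsIn-scale (P- Pt) Pv)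

      coeff-s : ∀ k → coeff s k ≡ coeff (c ∷ r) k + - (t * coeff v k)
      coeff-s k = trans (coeff-+ₚ (c ∷ r) (scale (- t) v) k) (cong (coeff (c ∷ r) k +_) (trans (coeff-scale (- t) v k) (sym (-‿distribˡ-* t _))))

      s-small : ∀ k → suc e ≤ k → coeff s k ≡ 0#
      s-small k h with ℕₚ.m≤n⇒m<n∨m≡n h
      ... | inj₂ refl = trans (coeff-s (suc e)) (trans (cong (λ z → t + - (t * z)) mv)
        (trans (cong (λ z → t + - z) (*-identityʳ t)) (-‿inverseʳ t)))
      ... | inj₁ lt   = trans (coeff-s k) (trans (cong₂ (λ x y → x + - (t * y))
        (coeff-beyond (c ∷ r) k (ℕₚ.≤-trans (s≤s lr) lt)) (hv k lt))
        (trans (cong (λ z → 0# + - z) (zeroʳ t)) (-‿inverseʳ 0#)))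

      shifted : ∀ k → coeff (c ∷ p) k ≡ coeff (0# ∷ (d *ₚ v)) k + coeff (c ∷ r) k
      shifted zero    = sym (+-identityˡ c)
      shifted (suc k) = trans (eq k) (coeff-+ₚ (d *ₚ v) r k)

      eq′ : (c ∷ p) ≈ₚ (((t ∷ d) *ₚ v) +ₚ take (suc e) s)
      eq′ k = sym (begin
        coeff (((t ∷ d) *ₚ v) +ₚ take (suc e) s) k
          ≡⟨ coeff-+ₚ ((t ∷ d) *ₚ v) _ k ⟩
        coeff ((t ∷ d) *ₚ v) k + coeff (take (suc e) s) k
          ≡⟨ cong₂ _+_ (trans (coeff-+ₚ (scale t v) _ k) (cong (_+ coeff (0# ∷ (d *ₚ v)) k) (coeff-scale t v k)))
                       (trans (take-≈ (suc e) s s-small k) (coeff-s k)) ⟩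
        t * coeff v k + coeff (0# ∷ (d *ₚ v)) k + (coeff (c ∷ r) k + - (t * coeff v k))
          ≡⟨ solve 4 (λ a b c d → (a :+ b :+ (c :+ d)) := (b :+ c :+ (a :+ d))) refl _ _ _ _ ⟩
        coeff (0# ∷ (d *ₚ v)) k + coeff (c ∷ r) k + (t * coeff v k + - (t * coeff v k))
          ≡⟨ trans (cong (coeff (0# ∷ (d *ₚ v)) k + coeff (c ∷ r) k +_) (-‿inverseʳ _)) (+-identityʳ _) ⟩
        coeff (0# ∷ (d *ₚ v)) k + coeff (c ∷ r) k
          ≡⟨ shifted k ⟨
        coeff (c ∷ p) k ∎)

-- Field homomorphisms, and the quotient of K[x] by a monic polynomial.

record Hom (F G : FiniteField) : Set where
  private
    module F = FiniteField F
    module G = FiniteField G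
  field
    fun   : F.Carrier → G.Carrier
    hom-0 : fun F.0# ≡ G.0#
    hom-1 : fun F.1# ≡ G.1#
    hom-+ : ∀ x y → fun (x F.+ y) ≡ fun x G.+ fun y
    hom-* : ∀ x y → fun (x F.* y) ≡ fun x G.* fun y

module Padding (K : FiniteField) where
  open FiniteField K

  pad : ∀ k → List Carrier → Vec Carrier k
  pad zero    p       = []
  pad (suc k) []      = 0# ∷ pad k []
  pad (suc k) (c ∷ p) = c ∷ pad k p

-- The ring K[x]/(x^(m+1) − g) on coefficient vectors: T multiplies by x, and u ⊠ v = u(T) v.
module QuotientRing (K : FiniteField) (q : ℕ) {m : ℕ} (g : Vec (FiniteField.Carrier K) (suc m)) where
  open FiniteField K
  open FieldLemmas K
  open FF K q
  open Polynomials K q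

  open Padding K public

  V : ℕ → Set
  V = Vec Carrier

  infixl 6 _⊞_
  infixr 7 _∙_

  _⊞_ : ∀ {k} → V k → V k → V k
  _⊞_ = zipWith _+_

  _∙_ : ∀ {k} → Carrier → V k → V k
  c ∙ v = Vec.map (c *_) v

  0ᵥ : ∀ {k} → V k
  0ᵥ = replicate _ 0#

  -- `c ∷ v` has one entry too many: `shift c v` is the part that fits and `top c v` is the entry
  -- that overflows, to be reduced by g.
  shift : ∀ {k} → Carrier → V k → V k
  shift c []      = []
  shift c (x ∷ v) = c ∷ shift x v

  top : ∀ {k} → Carrier → V k → Carrier
  top c []      = c
  top c (x ∷ v) = top x v

  T : V (suc m) → V (suc m)
  T v = shift 0# v ⊞ top 0# v ∙ g

  -- Horner's scheme for p(T) v. It accepts polynomials of any length, so reduction modulo x^(m+1) -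
  -- g happens on the way.
  act : Poly → V (suc m) → V (suc m)
  act []      v = 0ᵥ
  act (c ∷ p) v = c ∙ v ⊞ T (act p v)

  ⊞-assoc : ∀ {k} (u v w : V k) → (u ⊞ v) ⊞ w ≡ u ⊞ (v ⊞ w)
  ⊞-assoc = Vecₚ.zipWith-assoc +-assoc

  ⊞-comm : ∀ {k} (u v : V k) → u ⊞ v ≡ v ⊞ u
  ⊞-comm = Vecₚ.zipWith-comm +-comm

  ⊞-identityˡ : ∀ {k} (v : V k) → 0ᵥ ⊞ v ≡ v
  ⊞-identityˡ = Vecₚ.zipWith-identityˡ +-identityˡ

  ⊞-identityʳ : ∀ {k} (v : V k) → v ⊞ 0ᵥ ≡ v
  ⊞-identityʳ = Vecₚ.zipWith-identityʳ +-identityʳ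

  ⊞-interchange : ∀ {k} (a b c d : V k) → (a ⊞ b) ⊞ (c ⊞ d) ≡ (a ⊞ c) ⊞ (b ⊞ d)
  ⊞-interchange []      []      []      []      = refl
  ⊞-interchange (w ∷ a) (x ∷ b) (y ∷ c) (z ∷ d) = cong₂ _∷_ (+-interchange w x y z) (⊞-interchange a b c d)

  ∙-⊞ : ∀ {k} c (u v : V k) → c ∙ (u ⊞ v) ≡ c ∙ u ⊞ c ∙ v
  ∙-⊞ c []      []      = refl
  ∙-⊞ c (x ∷ u) (y ∷ v) = cong₂ _∷_ (distribˡ c x y) (∙-⊞ c u v)

  +-∙ : ∀ {k} c d (v : V k) → (c + d) ∙ v ≡ c ∙ v ⊞ d ∙ v
  +-∙ c d []      = refl
  +-∙ c d (x ∷ v) = cong₂ _∷_ (distribʳ x c d) (+-∙ c d v)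

  *-∙ : ∀ {k} c d (v : V k) → (c * d) ∙ v ≡ c ∙ d ∙ v
  *-∙ c d []      = refl
  *-∙ c d (x ∷ v) = cong₂ _∷_ (*-assoc c d x) (*-∙ c d v)

  ∙-comm : ∀ {k} c d (v : V k) → c ∙ d ∙ v ≡ d ∙ c ∙ v
  ∙-comm c d v = trans (sym (*-∙ c d v)) (trans (cong (_∙ v) (*-comm c d)) (*-∙ d c v))

  0-∙ : ∀ {k} (v : V k) → 0# ∙ v ≡ 0ᵥ
  0-∙ []      = refl
  0-∙ (x ∷ v) = cong₂ _∷_ (zeroˡ x) (0-∙ v)

  1-∙ : ∀ {k} (v : V k) → 1# ∙ v ≡ v
  1-∙ []      = refl
  1-∙ (x ∷ v) = cong₂ _∷_ (*-identityˡ x) (1-∙ v)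

  shift-⊞ : ∀ {k} c d (u v : V k) → shift (c + d) (u ⊞ v) ≡ shift c u ⊞ shift d v
  shift-⊞ c d []      []      = refl
  shift-⊞ c d (x ∷ u) (y ∷ v) = cong (c + d ∷_) (shift-⊞ x y u v)

  top-⊞ : ∀ {k} c d (u v : V k) → top (c + d) (u ⊞ v) ≡ top c u + top d v
  top-⊞ c d []      []      = refl
  top-⊞ c d (x ∷ u) (y ∷ v) = top-⊞ x y u v

  shift-∙ : ∀ {k} c x (v : V k) → shift (c * x) (c ∙ v) ≡ c ∙ shift x v
  shift-∙ c x []      = refl
  shift-∙ c x (y ∷ v) = cong (c * x ∷_) (shift-∙ c y v)

  top-∙ : ∀ {k} c x (v : V k) → top (c * x) (c ∙ v) ≡ c * top x v
  top-∙ c x []      = refl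
  top-∙ c x (y ∷ v) = top-∙ c y v

  T-⊞ : ∀ u v → T (u ⊞ v) ≡ T u ⊞ T v
  T-⊞ u v = begin
    shift 0# (u ⊞ v) ⊞ top 0# (u ⊞ v) ∙ g
      ≡⟨ cong₂ (λ z z′ → shift z (u ⊞ v) ⊞ top z′ (u ⊞ v) ∙ g) (+-identityˡ 0#) (+-identityˡ 0#) ⟨
    shift (0# + 0#) (u ⊞ v) ⊞ top (0# + 0#) (u ⊞ v) ∙ g
      ≡⟨ cong₂ (λ a b → a ⊞ b ∙ g) (shift-⊞ 0# 0# u v) (top-⊞ 0# 0# u v) ⟩
    (shift 0# u ⊞ shift 0# v) ⊞ (top 0# u + top 0# v) ∙ g
      ≡⟨ cong ((shift 0# u ⊞ shift 0# v) ⊞_) (+-∙ _ _ g) ⟩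
    (shift 0# u ⊞ shift 0# v) ⊞ (top 0# u ∙ g ⊞ top 0# v ∙ g)
      ≡⟨ ⊞-interchange _ _ _ _ ⟩
    T u ⊞ T v ∎
    where open ≡-Reasoning

  T-∙ : ∀ c v → T (c ∙ v) ≡ c ∙ T v
  T-∙ c v = begin
    shift 0# (c ∙ v) ⊞ top 0# (c ∙ v) ∙ g
      ≡⟨ cong₂ (λ z z′ → shift z (c ∙ v) ⊞ top z′ (c ∙ v) ∙ g) (zeroʳ c) (zeroʳ c) ⟨
    shift (c * 0#) (c ∙ v) ⊞ top (c * 0#) (c ∙ v) ∙ g
      ≡⟨ cong₂ (λ a b → a ⊞ b ∙ g) (shift-∙ c 0# v) (top-∙ c 0# v) ⟩
    c ∙ shift 0# v ⊞ (c * top 0# v) ∙ g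
      ≡⟨ cong (c ∙ shift 0# v ⊞_) (*-∙ c _ g) ⟩
    c ∙ shift 0# v ⊞ c ∙ top 0# v ∙ g
      ≡⟨ ∙-⊞ c _ _ ⟨
    c ∙ T v ∎
    where open ≡-Reasoning

  T-0 : T 0ᵥ ≡ 0ᵥ
  T-0 = trans (cong T (sym (0-∙ 0ᵥ))) (trans (T-∙ 0# 0ᵥ) (0-∙ _))

  act-⊞ : ∀ p u v → act p (u ⊞ v) ≡ act p u ⊞ act p v
  act-⊞ []      u v = sym (⊞-identityˡ 0ᵥ)
  act-⊞ (c ∷ p) u v = trans
    (cong₂ _⊞_ (∙-⊞ c u v) (trans (cong T (act-⊞ p u v)) (T-⊞ _ _))) (⊞-interchange _ _ _ _)

  act-∙ : ∀ p c v → act p (c ∙ v) ≡ c ∙ act p v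
  act-∙ []      c v = sym (trans (cong (c ∙_) (sym (0-∙ 0ᵥ))) (trans (∙-comm c 0# 0ᵥ) (0-∙ _)))
  act-∙ (d ∷ p) c v = trans
    (cong₂ _⊞_ (∙-comm d c v) (trans (cong T (act-∙ p c v)) (T-∙ c _))) (sym (∙-⊞ c _ _))

  act-0 : ∀ p → act p 0ᵥ ≡ 0ᵥ
  act-0 p = trans (cong (act p) (sym (0-∙ 0ᵥ))) (trans (act-∙ p 0# 0ᵥ) (0-∙ _))

  act-T : ∀ p v → act p (T v) ≡ T (act p v)
  act-T []      v = sym T-0
  act-T (c ∷ p) v = trans (cong₂ _⊞_ (sym (T-∙ c v)) (cong T (act-T p v))) (sym (T-⊞ _ _))

  -- Polynomials in the single operator T commute; commutativity and associativity of `_⊠_` both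
  -- come from this.
  act-comm : ∀ p r v → act p (act r v) ≡ act r (act p v)
  act-comm []      r v = sym (act-0 r)
  act-comm (c ∷ p) r v = sym (trans (act-⊞ r _ _)
    (cong₂ _⊞_ (act-∙ r c v) (trans (act-T r _) (cong T (sym (act-comm p r v))))))

  act-+ₚ : ∀ p r v → act (p +ₚ r) v ≡ act p v ⊞ act r v
  act-+ₚ []      r       v = sym (⊞-identityˡ _)
  act-+ₚ (c ∷ p) []      v = sym (⊞-identityʳ _)
  act-+ₚ (c ∷ p) (d ∷ r) v = trans (cong₂ _⊞_ (+-∙ c d v) (trans (cong T (act-+ₚ p r v)) (T-⊞ _ _)))
    (⊞-interchange _ _ _ _)

  act-scale : ∀ c p v → act (scale c p) v ≡ c ∙ act p v
  act-scale c []      v = act-∙ [] c v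
  act-scale c (d ∷ p) v = trans (cong₂ _⊞_ (*-∙ c d v) (trans (cong T (act-scale c p v)) (T-∙ c _)))
    (sym (∙-⊞ c _ _))

  act-*ₚ : ∀ p r v → act (p *ₚ r) v ≡ act p (act r v)
  act-*ₚ []      r v = refl
  act-*ₚ (c ∷ p) r v = trans (act-+ₚ (scale c r) _ v) (cong₂ _⊞_ (act-scale c r v)
    (trans (cong₂ _⊞_ (0-∙ v) (cong T (act-*ₚ p r v))) (⊞-identityˡ _)))

  act-≈0 : ∀ p → p ≈ₚ [] → ∀ v → act p v ≡ 0ᵥ
  act-≈0 []      e v = refl
  act-≈0 (c ∷ p) e v = trans (cong₂ _⊞_ (trans (cong (_∙ v) (e 0)) (0-∙ v))
    (trans (cong T (act-≈0 p (e ∘ suc) v)) T-0)) (⊞-identityˡ 0ᵥ)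

  act-cong : ∀ p r → p ≈ₚ r → ∀ v → act p v ≡ act r v
  act-cong []      r       e v = sym (act-≈0 r (≈ₚ-sym {[]} {r} e) v)
  act-cong (c ∷ p) []      e v = act-≈0 (c ∷ p) e v
  act-cong (c ∷ p) (d ∷ r) e v = cong₂ (λ a w → a ∙ v ⊞ T w) (e 0) (act-cong p r (e ∘ suc) v)

  pad-[] : ∀ k → pad k [] ≡ 0ᵥ
  pad-[] zero    = refl
  pad-[] (suc k) = cong (0# ∷_) (pad-[] k)

  pad-toList : ∀ {k} (v : V k) → pad k (toList v) ≡ v
  pad-toList []      = refl
  pad-toList (x ∷ v) = cong (x ∷_) (pad-toList v)

  pad-≡0 : ∀ k p → length p ≤ k → pad k p ≡ 0ᵥ → p ≈ₚ []
  pad-≡0 k       []      _       _ j       = refl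
  pad-≡0 (suc k) (c ∷ p) (s≤s l) e zero    = cong Vec.head e
  pad-≡0 (suc k) (c ∷ p) (s≤s l) e (suc j) = pad-≡0 k p l (cong Vec.tail e) j

  pad-+ₚ : ∀ k p r → pad k (p +ₚ r) ≡ pad k p ⊞ pad k r
  pad-+ₚ zero    p       r       = refl
  pad-+ₚ (suc k) []      []      = cong₂ _∷_ (sym (+-identityˡ 0#)) (pad-+ₚ k [] [])
  pad-+ₚ (suc k) []      (d ∷ r) = cong₂ _∷_ (sym (+-identityˡ d)) (pad-+ₚ k [] r)
  pad-+ₚ (suc k) (c ∷ p) []      = cong₂ _∷_ (sym (+-identityʳ c))
    (sym (trans (cong (pad k p ⊞_) (pad-[] k)) (⊞-identityʳ _)))
  pad-+ₚ (suc k) (c ∷ p) (d ∷ r) = cong (c + d ∷_) (pad-+ₚ k p r)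

  pad-scale : ∀ k c p → pad k (scale c p) ≡ c ∙ pad k p
  pad-scale zero    c p       = refl
  pad-scale (suc k) c []      = cong₂ _∷_ (sym (zeroʳ c)) (pad-scale k c [])
  pad-scale (suc k) c (d ∷ p) = cong (c * d ∷_) (pad-scale k c p)

  shift-pad : ∀ k c p → shift c (pad k p) ≡ pad k (c ∷ p)
  shift-pad zero    c p       = refl
  shift-pad (suc k) c []      = cong (c ∷_) (trans (shift-pad k 0# []) (zeros k))
    where
    zeros : ∀ k → pad k (0# ∷ []) ≡ pad k []
    zeros zero    = refl
    zeros (suc k) = refl
  shift-pad (suc k) c (d ∷ p) = cong (c ∷_) (shift-pad k d p)

  top-pad : ∀ k c p → top c (pad k p) ≡ coeff (c ∷ p) k
  top-pad zero    c p             = refl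
  top-pad (suc k) c []            = trans (top-pad k 0# []) (zeros k)
    where
    zeros : ∀ k → coeff (0# ∷ []) k ≡ 0#
    zeros zero    = refl
    zeros (suc k) = refl
  top-pad (suc k) c (d ∷ p)       = top-pad k d p

  ι : Carrier → V (suc m)
  ι c = pad (suc m) (c ∷ [])

  1ᵥ : V (suc m)
  1ᵥ = ι 1#

  ι-∙ : ∀ c d → ι (c * d) ≡ c ∙ ι d
  ι-∙ c d = pad-scale (suc m) c (d ∷ [])

  ι-≡∙1 : ∀ c → ι c ≡ c ∙ 1ᵥ
  ι-≡∙1 c = trans (cong ι (sym (*-identityʳ c))) (ι-∙ c 1#)

  -- Isolates the only possible overflow. For short p its coefficient is 0, which gives `act-1`; for
  -- f it is 1 and gives f(T) 1 = 0.
  act-1-∷ : ∀ c p → act p 1ᵥ ≡ pad (suc m) p → act (c ∷ p) 1ᵥ ≡ pad (suc m) (c ∷ p) ⊞ coeff p m ∙ g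
  act-1-∷ c p e = begin
    c ∙ 1ᵥ ⊞ T (act p 1ᵥ)                                     ≡⟨ cong₂ _⊞_ (sym (ι-≡∙1 c)) (cong T e) ⟩
    ι c ⊞ T (pad (suc m) p)                                    ≡⟨ cong₂ (λ a b → ι c ⊞ (a ⊞ b ∙ g)) (shift-pad (suc m) 0# p) (top-pad (suc m) 0# p) ⟩
    ι c ⊞ (pad (suc m) (0# ∷ p) ⊞ coeff p m ∙ g)              ≡⟨ ⊞-assoc _ _ _ ⟨
    (ι c ⊞ pad (suc m) (0# ∷ p)) ⊞ coeff p m ∙ g              ≡⟨ cong (_⊞ coeff p m ∙ g) (pad-+ₚ (suc m) (c ∷ []) (0# ∷ p)) ⟨
    pad (suc m) (c + 0# ∷ p) ⊞ coeff p m ∙ g                  ≡⟨ cong (λ z → pad (suc m) (z ∷ p) ⊞ coeff p m ∙ g) (+-identityʳ c) ⟩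
    pad (suc m) (c ∷ p) ⊞ coeff p m ∙ g                       ∎
    where open ≡-Reasoning

  act-1 : ∀ p → length p ≤ suc m → act p 1ᵥ ≡ pad (suc m) p
  act-1 []      l       = sym (pad-[] (suc m))
  act-1 (c ∷ p) (s≤s l) = trans (act-1-∷ c p (act-1 p (ℕₚ.m≤n⇒m≤1+n l)))
    (trans (cong (λ z → pad (suc m) (c ∷ p) ⊞ z ∙ g) (coeff-beyond p m l)) (trans (cong (pad (suc m) (c ∷ p) ⊞_) (0-∙ g)) (⊞-identityʳ _)))

  _⊠_ : V (suc m) → V (suc m) → V (suc m)
  u ⊠ v = act (toList u) v

  length-toList : ∀ {k} (v : V k) → length (toList v) ≤ k
  length-toList v = ℕₚ.≤-reflexive (Vecₚ.length-toList v)

  ⊠-identityʳ : ∀ u → u ⊠ 1ᵥ ≡ u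
  ⊠-identityʳ u = trans (act-1 (toList u) (length-toList u)) (pad-toList u)

  ⊠-comm : ∀ u v → u ⊠ v ≡ v ⊠ u
  ⊠-comm u v = trans (cong (u ⊠_) (sym (⊠-identityʳ v))) (trans (act-comm (toList u) (toList v) 1ᵥ)
    (cong (v ⊠_) (⊠-identityʳ u)))

  ⊠-assoc : ∀ u v w → (u ⊠ v) ⊠ w ≡ u ⊠ (v ⊠ w)
  ⊠-assoc u v w = trans (⊠-comm (u ⊠ v) w) (trans (act-comm (toList w) (toList u) v) (cong (u ⊠_) (⊠-comm w v)))

  toList-⊞ : ∀ {k} (u v : V k) → toList (u ⊞ v) ≡ toList u +ₚ toList v
  toList-⊞ []      []      = refl
  toList-⊞ (x ∷ u) (y ∷ v) = cong (x + y ∷_) (toList-⊞ u v)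

  ⊠-distribˡ : ∀ u v w → u ⊠ (v ⊞ w) ≡ (u ⊠ v) ⊞ (u ⊠ w)
  ⊠-distribˡ u = act-⊞ (toList u)

  ⊠-distribʳ : ∀ u v w → (v ⊞ w) ⊠ u ≡ (v ⊠ u) ⊞ (w ⊠ u)
  ⊠-distribʳ u v w = trans (cong (λ z → act z u) (toList-⊞ v w)) (act-+ₚ (toList v) (toList w) u)

  isCommutativeRingᵥ : IsCommutativeRing _≡_ _⊞_ _⊠_ (Vec.map -_) 0ᵥ 1ᵥ
  isCommutativeRingᵥ = record
    { isRing = record
      { +-isAbelianGroup = record
        { isGroup = record
          { isMonoid = record
            { isSemigroup = record
              { isMagma = record { isEquivalence = isEquivalence ; ∙-cong = cong₂ _⊞_ }
              ; assoc   = ⊞-assoc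
              }
            ; identity = ⊞-identityˡ , ⊞-identityʳ
            }
          ; inverse = Vecₚ.zipWith-inverseˡ -‿inverseˡ , Vecₚ.zipWith-inverseʳ -‿inverseʳ
          ; ⁻¹-cong = cong _
          }
        ; comm = ⊞-comm
        }
      ; *-cong     = cong₂ _⊠_
      ; *-assoc    = ⊠-assoc
      ; *-identity = (λ u → trans (⊠-comm 1ᵥ u) (⊠-identityʳ u)) , ⊠-identityʳ
      ; distrib    = ⊠-distribˡ , ⊠-distribʳ
      }
    ; *-comm = ⊠-comm
    }

  ι-⊠ : ∀ c v → ι c ⊠ v ≡ c ∙ v
  ι-⊠ c v = trans (⊠-comm (ι c) v) (trans (cong (v ⊠_) (ι-≡∙1 c))
    (trans (act-∙ (toList v) c 1ᵥ) (cong (c ∙_) (⊠-identityʳ v))))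

  α : V (suc m)
  α = T 1ᵥ

  α-⊠ : ∀ v → α ⊠ v ≡ T v
  α-⊠ v = trans (⊠-comm α v) (trans (act-T (toList v) 1ᵥ) (cong T (⊠-identityʳ v)))

  vectors : ∀ k → List (V k)
  vectors zero    = [] ∷ []
  vectors (suc k) = cartesianProductWith _∷_ elements (vectors k)

  vectors-complete : ∀ {k} (v : V k) → v ∈ vectors k
  vectors-complete []      = here refl
  vectors-complete (x ∷ v) = ∈ₚ.∈-cartesianProductWith⁺ _∷_ (complete x) (vectors-complete v)

  vectors-unique : ∀ k → Unique (vectors k)
  vectors-unique zero    = [] ∷ []
  vectors-unique (suc k) = Uniqueₚ.cartesianProductWith⁺ _∷_ Vecₚ.∷-injective unique (vectors-unique k)

  length-vectors : ∀ k → length (vectors k) ≡ card ℕ.^ k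
  length-vectors zero    = refl
  length-vectors (suc k) = trans (length-products elements) (cong (card ℕ.*_) (length-vectors k))
    where
    length-products : ∀ xs → length (cartesianProductWith Vec._∷_ xs (vectors k)) ≡ length xs ℕ.* length (vectors k)
    length-products []       = refl
    length-products (x ∷ xs) = trans (Listₚ.length-++ (map (x Vec.∷_) (vectors k)))
      (cong₂ ℕ._+_ (Listₚ.length-map (x Vec.∷_) (vectors k)) (length-products xs))

-- All that the Galois argument needs of K[x]/(f); the coefficient vectors stay hidden behind it.
-- `independent` says that no nonzero polynomial of degree below deg f vanishes at α.
record SimpleExtension (K : FiniteField) (q : ℕ) (f : FF.Poly K q) : Set₁ where
  field
    L    : FiniteField
    ι    : Hom K L
    α    : FiniteField.Carrier L
    card-L : FiniteField.card L ≡ FiniteField.card K ℕ.^ FF.deg K q f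
    root : Polynomials.eval L q (map (Hom.fun ι) f) α ≡ FiniteField.0# L
    independent : ∀ p → length p ≤ FF.deg K q f →
                  Polynomials.eval L q (map (Hom.fun ι) p) α ≡ FiniteField.0# L → FF._≈ₚ_ K q p []

-- For irreducible f the quotient is a field containing a root of f.

module Quotient (K : FiniteField) (q : ℕ) (f : FF.Poly K q) (monic : FF.Monic K q f)
  (irreducible : FF.Irreducible K q f) (m : ℕ) (deg-f : FF.deg K q f ≡ suc m) where
  open FiniteField K
  open FieldLemmas K
  open FF K q
  open Polynomials K q
  open Degrees K q

  DegLE-f : DegLE f (suc m)
  DegLE-f = subst (DegLE f) deg-f (DegLE-deg f)

  coeff-f : coeff f (suc m) ≡ 1#
  coeff-f = trans (cong (coeff f) (sym deg-f)) (trans (coeff-deg f) monic)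

  -- `pad` cuts off the leading 1 of f, so g represents x^(m+1) - f and the modulus x^(m+1) - g is
  -- f.
  open QuotientRing K q (Vec.map -_ (Padding.pad K (suc m) (strip f)))

  act-f-1 : act f 1ᵥ ≡ 0ᵥ
  act-f-1 = trans (act-cong f (strip f) (≈ₚ-sym {strip f} {f} (strip-≈ f)) 1ᵥ)
    (go (strip f) refl (trans (strip-≈ f (suc m)) coeff-f) (subst (λ z → length (strip f) ≤ suc z) deg-f (length-strip f)))
    where
    go : ∀ p → strip f ≡ p → coeff p (suc m) ≡ 1# → length p ≤ suc (suc m) → act p 1ᵥ ≡ 0ᵥ
    go (c ∷ p) e h (s≤s l) = trans (act-1-∷ c p (act-1 p l)) (trans
      (cong₂ (λ z v → pad (suc m) (c ∷ p) ⊞ z ∙ v) h (cong (Vec.map -_) (cong (pad (suc m)) e)))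
      (trans (cong (pad (suc m) (c ∷ p) ⊞_) (1-∙ _)) (Vecₚ.zipWith-inverseʳ -‿inverseʳ (pad (suc m) (c ∷ p)))))
    go [] e h l = ⊥-elim (0≢1 h)

  act-f : ∀ v → act f v ≡ 0ᵥ
  act-f v = trans (cong (act f) (sym (⊠-identityʳ v))) (trans (act-comm f (toList v) 1ᵥ)
    (trans (cong (act (toList v)) act-f-1) (act-0 (toList v))))

  private
    neg-unique : ∀ {k} (u v : V k) → u ⊞ v ≡ 0ᵥ → Vec.map -_ u ≡ v
    neg-unique u v e = begin
      Vec.map -_ u                ≡⟨ ⊞-identityʳ _ ⟨
      Vec.map -_ u ⊞ 0ᵥ           ≡⟨ cong (Vec.map -_ u ⊞_) e ⟨
      Vec.map -_ u ⊞ (u ⊞ v)      ≡⟨ ⊞-assoc _ _ _ ⟨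
      (Vec.map -_ u ⊞ u) ⊞ v      ≡⟨ cong (_⊞ v) (Vecₚ.zipWith-inverseˡ -‿inverseˡ u) ⟩
      0ᵥ ⊞ v                      ≡⟨ ⊞-identityˡ v ⟩
      v                           ∎
      where open ≡-Reasoning

    neg≡-1∙ : ∀ {k} (u : V k) → Vec.map -_ u ≡ (- 1#) ∙ u
    neg≡-1∙ u = neg-unique u _ (trans (cong (_⊞ (- 1#) ∙ u) (sym (1-∙ u)))
      (trans (sym (+-∙ 1# (- 1#) u)) (trans (cong (_∙ u) (-‿inverseʳ 1#)) (0-∙ u))))

  -- Euclid's algorithm: an inverse of the remainder of f by p gives one of p.
  act-inverse : ∀ n p → deg p < n → lead p ≢ 0# → deg p < suc m → Σ (V (suc m)) λ w → act p w ≡ 1ᵥ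
  act-inverse (suc n) p (s≤s deg-p≤n) lead≢0 deg-p<deg-f with deg p in deg-p
  ... | zero = c ∙ 1ᵥ , (begin
    act p (c ∙ 1ᵥ)                      ≡⟨ act-cong p (lead p ∷ []) p≈constant _ ⟩
    lead p ∙ c ∙ 1ᵥ ⊞ T 0ᵥ              ≡⟨ trans (cong (lead p ∙ c ∙ 1ᵥ ⊞_) T-0) (⊞-identityʳ (lead p ∙ c ∙ 1ᵥ)) ⟩
    lead p ∙ c ∙ 1ᵥ                     ≡⟨ *-∙ _ _ _ ⟨
    (lead p * c) ∙ 1ᵥ                   ≡⟨ cong (_∙ 1ᵥ) (inverseʳ _ lead≢0) ⟩
    1# ∙ 1ᵥ                             ≡⟨ 1-∙ 1ᵥ ⟩
    1ᵥ                                  ∎)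
    where
    open ≡-Reasoning
    c = inv (lead p)
    p≈constant : p ≈ₚ (lead p ∷ [])
    p≈constant zero    = trans (cong (coeff p) (sym deg-p)) (coeff-deg p)
    p≈constant (suc k) = DegLE-deg p (suc k) (subst (_< suc k) (sym deg-p) (s≤s z≤n))
  ... | suc e = conclude (divMod v DegLE-v coeff-v (All.universal (λ _ → tt) v) f (All.universal (λ _ → tt) f))
    where
    open Division (λ _ → ⊤) tt (λ _ _ → tt) (λ _ _ → tt) (λ _ → tt)
    c = inv (lead p)
    v = scale c p

    DegLE-v : DegLE v (suc e)
    DegLE-v = DegLE-scale {p} c (subst (DegLE p) deg-p (DegLE-deg p))

    coeff-v : coeff v (suc e) ≡ 1#
    coeff-v = trans (coeff-scale c p (suc e)) (trans
      (cong (c *_) (trans (cong (coeff p) (sym deg-p)) (coeff-deg p))) (inverseˡ _ lead≢0))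

    deg-v : deg v ≡ suc e
    deg-v = deg-unique v DegLE-v (coeff≡1⇒≢0 {v} coeff-v)

    conclude : (Σ Poly λ d → Σ Poly λ r → CoeffsIn (λ _ → ⊤) d × CoeffsIn (λ _ → ⊤) r × length r ≤ suc e × f ≈ₚ ((d *ₚ v) +ₚ r)) →
               Σ (V (suc m)) λ w → act p w ≡ 1ᵥ
    conclude (d , r , _ , _ , l , eq) with lead r ≟ 0#
    -- With remainder 0, v would be a factor of f of degree e + 1, strictly between 0 and deg f.
    ... | yes lead-r = ⊥-elim (no-factor (proj₂ (proj₂ irreducible) d v (All.universal id d) (All.universal id v) f≈dv))
      where
      f≈dv : f ≈ₚ (d *ₚ v)
      f≈dv k = trans (eq k) (trans (coeff-+ₚ (d *ₚ v) r k)
        (trans (cong (coeff (d *ₚ v) k +_) (lead≡0⇒≈0 r lead-r k)) (+-identityʳ _)))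

      no-factor : deg d ≡ 0 ⊎ deg v ≡ 0 → ⊥
      no-factor (inj₁ deg-d) = coeff≡1⇒≢0 {f} coeff-f (trans (f≈dv (suc m))
        (DegLE-*ₚ d v (subst (DegLE d) deg-d (DegLE-deg d)) DegLE-v (suc m) deg-p<deg-f))
      no-factor (inj₂ deg-v≡0) = ℕₚ.1+n≢0 (trans (sym deg-v) deg-v≡0)
    -- f = dv + r acts as 0 and r(T) w = 1, so v(T) sends -d(T) w to 1; the factor c converts v = cp
    -- back to p.
    ... | no lead-r = c ∙ (- 1#) ∙ act d w , (begin
        act p (c ∙ (- 1#) ∙ act d w)      ≡⟨ act-∙ p c _ ⟩
        c ∙ act p ((- 1#) ∙ act d w)      ≡⟨ act-scale c p _ ⟨
        act v ((- 1#) ∙ act d w)          ≡⟨ act-∙ v (- 1#) _ ⟩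
        (- 1#) ∙ act v (act d w)          ≡⟨ cong ((- 1#) ∙_) (act-comm v d w) ⟩
        (- 1#) ∙ act d (act v w)          ≡⟨ neg≡-1∙ _ ⟨
        Vec.map -_ (act d (act v w))      ≡⟨ neg-unique _ _ dv+1≡0 ⟩
        1ᵥ                                ∎)
      where
      open ≡-Reasoning
      deg-r≤e : deg r ≤ e
      deg-r≤e with size r
      ... | zero _ l0 _ = ⊥-elim (lead-r l0)
      ... | nonZero _ n≢0 c≡ _ = ℕₚ.≮⇒≥ (λ e<deg → n≢0 (trans (sym c≡) (coeff-beyond r (deg r) (ℕₚ.≤-trans l e<deg))))

      ih : Σ (V (suc m)) λ w → act r w ≡ 1ᵥ
      ih = act-inverse n r (ℕₚ.≤-trans (s≤s deg-r≤e) deg-p≤n) lead-r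
             (ℕₚ.≤-trans (s≤s deg-r≤e) (ℕₚ.<⇒≤ deg-p<deg-f))
      w = proj₁ ih

      dv+1≡0 : act d (act v w) ⊞ 1ᵥ ≡ 0ᵥ
      dv+1≡0 = begin
        act d (act v w) ⊞ 1ᵥ              ≡⟨ cong₂ _⊞_ (act-*ₚ d v w) (proj₂ ih) ⟨
        act (d *ₚ v) w ⊞ act r w          ≡⟨ act-+ₚ (d *ₚ v) r w ⟨
        act ((d *ₚ v) +ₚ r) w             ≡⟨ act-cong f ((d *ₚ v) +ₚ r) eq w ⟨
        act f w                           ≡⟨ act-f w ⟩
        0ᵥ                                ∎

  private
    _≟ᵥ_ = Vecₚ.≡-dec {n = suc m} _≟_

    ⊠-inverse : ∀ u → u ≢ 0ᵥ → Σ (V (suc m)) λ w → u ⊠ w ≡ 1ᵥ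
    ⊠-inverse u u≢0 = act-inverse (suc (deg (toList u))) (toList u) ℕₚ.≤-refl lead≢0 deg<
      where
      lead≢0 : lead (toList u) ≢ 0#
      lead≢0 e = u≢0 (trans (sym (pad-toList u)) (trans (sym (act-1 (toList u) (length-toList u)))
        (act-≈0 (toList u) (lead≡0⇒≈0 (toList u) e) 1ᵥ)))

      deg< : deg (toList u) < suc m
      deg< = ℕₚ.≰⇒> (λ h → lead≢0 (trans (sym (coeff-deg (toList u)))
        (coeff-beyond (toList u) _ (ℕₚ.≤-trans (length-toList u) h))))

    invᵥ : V (suc m) → V (suc m)
    invᵥ u with u ≟ᵥ 0ᵥ
    ... | yes _   = 0ᵥ
    ... | no u≢0  = proj₁ (⊠-inverse u u≢0)

    invᵥ-inverse : ∀ u → u ≢ 0ᵥ → u ⊠ invᵥ u ≡ 1ᵥ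
    invᵥ-inverse u u≢0 with u ≟ᵥ 0ᵥ
    ... | yes u≡0 = ⊥-elim (u≢0 u≡0)
    ... | no u≢0′ = proj₂ (⊠-inverse u u≢0′)

  field′ : FiniteField
  field′ = record
    { Carrier = V (suc m) ; _+_ = _⊞_ ; _*_ = _⊠_ ; -_ = Vec.map -_ ; 0# = 0ᵥ ; 1# = 1ᵥ
    ; isCommutativeRing = isCommutativeRingᵥ
    ; inv = invᵥ ; inverseʳ = invᵥ-inverse
    ; 0≢1 = λ e → 0≢1 (cong Vec.head e)
    ; _≟_ = _≟ᵥ_
    ; elements = vectors (suc m) ; complete = vectors-complete ; unique = vectors-unique (suc m)
    }

  ι-hom : Hom K field′
  ι-hom = record
    { fun   = ι
    ; hom-0 = cong (0# ∷_) (pad-[] m)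
    ; hom-1 = refl
    ; hom-+ = λ x y → pad-+ₚ (suc m) (x ∷ []) (y ∷ [])
    ; hom-* = λ x y → trans (ι-∙ x y) (sym (ι-⊠ x (ι y)))
    }

  open Polynomials field′ q using () renaming (eval to evalᵥ)

  eval≡act : ∀ p → evalᵥ (map ι p) α ≡ act p 1ᵥ
  eval≡act []      = refl
  eval≡act (c ∷ p) = cong₂ _⊞_ (ι-≡∙1 c) (trans (α-⊠ _) (cong T (eval≡act p)))

  extension : SimpleExtension K q f
  extension = record
    { L = field′ ; ι = ι-hom ; α = α
    ; card-L = trans (length-vectors (suc m)) (cong (card ℕ.^_) (sym deg-f))
    ; root = trans (eval≡act f) act-f-1
    ; independent = λ p l e → pad-≡0 (suc m) p (subst (length p ≤_) deg-f l)
        (trans (sym (act-1 p (subst (length p ≤_) deg-f l))) (trans (sym (eval≡act p)) e))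
    }

-- Transport of polynomials along homomorphisms.

module HomLemmas {F G : FiniteField} (h : Hom F G) (q : ℕ) where
  open Hom h public
  private
    module F where
      open FiniteField F public
      open FieldLemmas F public
      open FF F q public
      open Polynomials F q public
      open Degrees F q public
    module G where
      open FiniteField G public
      open FieldLemmas G public
      open FF G q public
      open Polynomials G q public
      open Degrees G q public

  hom-neg : ∀ x → fun (F.- x) ≡ G.- fun x
  hom-neg x = G.+-cancelʳ (fun x) _ _ (begin
    fun (F.- x) G.+ fun x    ≡⟨ hom-+ _ _ ⟨
    fun (F.- x F.+ x)        ≡⟨ cong fun (F.-‿inverseˡ x) ⟩
    fun F.0#                 ≡⟨ hom-0 ⟩
    G.0#                     ≡⟨ G.-‿inverseˡ _ ⟨
    G.- fun x G.+ fun x      ∎)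
    where open ≡-Reasoning

  hom-≡0 : ∀ {x} → fun x ≡ G.0# → x ≡ F.0#
  hom-≡0 {x} e with x F.≟ F.0#
  ... | yes x≡0 = x≡0
  ... | no x≢0  = ⊥-elim (G.1≢0 (begin
    G.1#                      ≡⟨ hom-1 ⟨
    fun F.1#                  ≡⟨ cong fun (F.inverseʳ x x≢0) ⟨
    fun (x F.* F.inv x)       ≡⟨ hom-* _ _ ⟩
    fun x G.* fun (F.inv x)   ≡⟨ cong (G._* _) e ⟩
    G.0# G.* fun (F.inv x)    ≡⟨ G.zeroˡ _ ⟩
    G.0#                      ∎))
    where open ≡-Reasoning

  hom-injective : ∀ {x y} → fun x ≡ fun y → x ≡ y
  hom-injective {x} {y} e = F.x-y≡0⇒x≡y (hom-≡0 (trans (hom-+ x (F.- y))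
    (trans (cong₂ G._+_ e (hom-neg y)) (G.-‿inverseʳ _))))

  hom-^ : ∀ x k → fun (x F.^ k) ≡ fun x G.^ k
  hom-^ x zero    = hom-1
  hom-^ x (suc k) = trans (hom-* x _) (cong (fun x G.*_) (hom-^ x k))

  coeff-map : ∀ p k → G.coeff (map fun p) k ≡ fun (F.coeff p k)
  coeff-map []      k       = sym hom-0
  coeff-map (c ∷ p) zero    = refl
  coeff-map (c ∷ p) (suc k) = coeff-map p k

  map-≈ : ∀ p r → p F.≈ₚ r → map fun p G.≈ₚ map fun r
  map-≈ p r e k = trans (coeff-map p k) (trans (cong fun (e k)) (sym (coeff-map r k)))

  map-≈-injective : ∀ p r → map fun p G.≈ₚ map fun r → p F.≈ₚ r
  map-≈-injective p r e k = hom-injective (trans (sym (coeff-map p k)) (trans (e k) (coeff-map r k)))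

  DegLE-map : ∀ {p d} → F.DegLE p d → G.DegLE (map fun p) d
  DegLE-map {p} hp k lt = trans (coeff-map p k) (trans (cong fun (hp k lt)) hom-0)

  map-+ₚ : ∀ p r → map fun (p F.+ₚ r) ≡ map fun p G.+ₚ map fun r
  map-+ₚ []      r       = refl
  map-+ₚ (c ∷ p) []      = refl
  map-+ₚ (c ∷ p) (d ∷ r) = cong₂ _∷_ (hom-+ c d) (map-+ₚ p r)

  map-scale : ∀ c p → map fun (F.scale c p) ≡ G.scale (fun c) (map fun p)
  map-scale c []      = refl
  map-scale c (d ∷ p) = cong₂ _∷_ (hom-* c d) (map-scale c p)

  map-*ₚ : ∀ p r → map fun (p F.*ₚ r) ≡ map fun p G.*ₚ map fun r
  map-*ₚ []      r = refl
  map-*ₚ (c ∷ p) r = trans (map-+ₚ (F.scale c r) _)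
    (cong₂ G._+ₚ_ (map-scale c r) (cong₂ _∷_ hom-0 (map-*ₚ p r)))

  eval-map : ∀ p x → G.eval (map fun p) (fun x) ≡ fun (F.eval p x)
  eval-map []      x = sym hom-0
  eval-map (c ∷ p) x = trans (cong (λ z → fun c G.+ fun x G.* z) (eval-map p x))
    (sym (trans (hom-+ c _) (cong (fun c G.+_) (hom-* x _))))

-- Products of linear factors.

module ProductOfRoots (F : FiniteField) (q : ℕ) where
  open FiniteField F
  open FieldLemmas F
  open FF F q
  open Polynomials F q
  open Degrees F q

  fromRoots : List Carrier → Poly
  fromRoots []       = 1# ∷ []
  fromRoots (x ∷ xs) = (- x ∷ 1# ∷ []) *ₚ fromRoots xs

  private
    DegLE-linear : ∀ a b → DegLE (a ∷ b ∷ []) 1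
    DegLE-linear a b k h = coeff-beyond (a ∷ b ∷ []) k h

  DegLE-fromRoots : ∀ xs → DegLE (fromRoots xs) (length xs)
  DegLE-fromRoots []       k h = coeff-beyond (1# ∷ []) k h
  DegLE-fromRoots (x ∷ xs)     = DegLE-*ₚ (- x ∷ 1# ∷ []) (fromRoots xs) (DegLE-linear (- x) 1#) (DegLE-fromRoots xs)

  coeff-fromRoots : ∀ xs → coeff (fromRoots xs) (length xs) ≡ 1#
  coeff-fromRoots []       = refl
  coeff-fromRoots (x ∷ xs) = trans (coeff-*ₚ-top (- x ∷ 1# ∷ []) (fromRoots xs) 1 (length xs) (DegLE-linear (- x) 1#) (DegLE-fromRoots xs))
    (trans (*-identityˡ _) (coeff-fromRoots xs))

  private
    eval-X-x : ∀ x y → eval (- x ∷ 1# ∷ []) y ≡ y + - x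
    eval-X-x x y = trans (eval-linear 1# (- x) y) (cong (_+ - x) (*-identityˡ y))

  eval-fromRoots : ∀ {xs y} → y ∈ xs → eval (fromRoots xs) y ≡ 0#
  eval-fromRoots {x ∷ xs} {y} y∈ = trans (eval-*ₚ (- x ∷ 1# ∷ []) (fromRoots xs) y) (go y∈)
    where
    go : y ∈ x ∷ xs → eval (- x ∷ 1# ∷ []) y * eval (fromRoots xs) y ≡ 0#
    go (here refl) = trans (cong (_* eval (fromRoots xs) y) (trans (eval-X-x y y) (-‿inverseʳ y))) (zeroˡ _)
    go (there y∈)  = trans (cong (eval (- x ∷ 1# ∷ []) y *_) (eval-fromRoots y∈)) (zeroʳ _)

  fromRoots-root : ∀ xs {y} → eval (fromRoots xs) y ≡ 0# → y ∈ xs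
  fromRoots-root [] {y} e = ⊥-elim (1≢0 (trans (sym (trans (cong (1# +_) (zeroʳ y)) (+-identityʳ 1#))) e))
  fromRoots-root (x ∷ xs) {y} e with xy≡0⇒x≡0∨y≡0 (trans (sym (eval-*ₚ (- x ∷ 1# ∷ []) (fromRoots xs) y)) e)
  ... | inj₁ y-x≡0 = here (x-y≡0⇒x≡y (trans (sym (eval-X-x x y)) y-x≡0))
  ... | inj₂ e′    = there (fromRoots-root xs e′)

-- The powers of the q-Frobenius on a field with q^N elements.

module Frobenius (F : FiniteField) (p k N : ℕ) (pr : Prime p) (card≡ : FiniteField.card F ≡ (p ℕ.^ k) ℕ.^ N) where
  open FiniteField F
  open FieldLemmas F
  private q = p ℕ.^ k
  open FF F q

  ^ᶜ≡^ : ∀ x j → x ^ᶜ j ≡ x ^ j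
  ^ᶜ≡^ x zero    = refl
  ^ᶜ≡^ x (suc j) = cong (x *_) (^ᶜ≡^ x j)

  σ≡^ : ∀ i x → σ i x ≡ x ^ (p ℕ.^ (k ℕ.* i))
  σ≡^ i x = trans (^ᶜ≡^ x (q ℕ.^ i)) (cong (x ^_) (ℕₚ.^-*-assoc p k i))

  private
    p·1≡0 : p · 1# ≡ 0#
    p·1≡0 = card≡p^k⇒p·1≡0 p (k ℕ.* N) (trans card≡ (ℕₚ.^-*-assoc p k N))

    1^ : ∀ j → 1# ^ j ≡ 1#
    1^ zero    = refl
    1^ (suc j) = trans (*-identityˡ _) (1^ j)

    -- Additivity at 0 + 0 gives this without having to show that the exponent is positive.
    0^p^ : ∀ j → 0# ^ (p ℕ.^ j) ≡ 0#
    0^p^ j = +-cancelˡ (0# ^ (p ℕ.^ j)) _ _ (trans (sym (^[p^k]-distrib-+ pr p·1≡0 j 0# 0#))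
      (trans (cong (_^ (p ℕ.^ j)) (+-identityˡ 0#)) (sym (+-identityʳ _))))

  σ-hom : ℕ → Hom F F
  σ-hom i = record
    { fun   = σ i
    ; hom-0 = trans (σ≡^ i 0#) (0^p^ (k ℕ.* i))
    ; hom-1 = trans (σ≡^ i 1#) (1^ (p ℕ.^ (k ℕ.* i)))
    ; hom-+ = λ x y → trans (σ≡^ i _) (trans (^[p^k]-distrib-+ pr p·1≡0 (k ℕ.* i) x y)
                (sym (cong₂ _+_ (σ≡^ i x) (σ≡^ i y))))
    ; hom-* = λ x y → trans (σ≡^ i _) (trans (^-distrib-* x y (p ℕ.^ (k ℕ.* i)))
                (sym (cong₂ _*_ (σ≡^ i x) (σ≡^ i y))))
    }

  σ-zero : ∀ x → σ 0 x ≡ x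
  σ-zero x = *-identityʳ x

  σ-+ : ∀ i j x → σ (i ℕ.+ j) x ≡ σ i (σ j x)
  σ-+ i j x = begin
    x ^ᶜ (q ℕ.^ (i ℕ.+ j))            ≡⟨ ^ᶜ≡^ x (q ℕ.^ (i ℕ.+ j)) ⟩
    x ^ (q ℕ.^ (i ℕ.+ j))             ≡⟨ cong (x ^_) (trans (ℕₚ.^-distribˡ-+-* q i j) (ℕₚ.*-comm (q ℕ.^ i) _)) ⟩
    x ^ (q ℕ.^ j ℕ.* q ℕ.^ i)         ≡⟨ ^-assocʳ x (q ℕ.^ j) (q ℕ.^ i) ⟨
    (x ^ (q ℕ.^ j)) ^ (q ℕ.^ i)       ≡⟨ cong (_^ (q ℕ.^ i)) (^ᶜ≡^ x (q ℕ.^ j)) ⟨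
    σ j x ^ (q ℕ.^ i)                 ≡⟨ ^ᶜ≡^ (σ j x) (q ℕ.^ i) ⟨
    σ i (σ j x)                       ∎
    where open ≡-Reasoning

  σ-comm : ∀ i j x → σ i (σ j x) ≡ σ j (σ i x)
  σ-comm i j x = trans (sym (σ-+ i j x)) (trans (cong (λ z → σ z x) (ℕₚ.+-comm i j)) (σ-+ j i x))

  σ-fixed-* : ∀ i {x} → σ i x ≡ x → ∀ t → σ (t ℕ.* i) x ≡ x
  σ-fixed-* i {x} e zero    = σ-zero x
  σ-fixed-* i {x} e (suc t) = trans (σ-+ i _ x) (trans (cong (σ i) (σ-fixed-* i e t)) e)

  σ-N : ∀ x → σ N x ≡ x
  σ-N x = trans (^ᶜ≡^ x (q ℕ.^ N)) (trans (cong (x ^_) (sym card≡)) (x^card≡x x))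

  σ-injective : ∀ i {x y} → σ i x ≡ σ i y → x ≡ y
  σ-injective i = HomLemmas.hom-injective (σ-hom i) q

  -- σ^(iN) is the identity, so iN - i further steps undo i of them; i ≤ iN keeps the exponent
  -- natural.
  σ-surjective : 1 ≤ N → ∀ i x → Σ Carrier λ y → σ i y ≡ x
  σ-surjective 1≤N i x = σ (i ℕ.* N ∸ i) x , trans (sym (σ-+ i _ x)) (trans
    (cong (λ z → σ z x) (ℕₚ.m+[n∸m]≡n (ℕₚ.m≤m*n i N {{ℕ.>-nonZero 1≤N}}))) (σ-fixed-* N (σ-N x) i))

private
  least-positive : ∀ {P : ℕ → Set} → (∀ j → Dec (P j)) → ∀ N → 1 ≤ N → P N →
                   Σ ℕ λ r → 1 ≤ r × P r × (∀ j → 1 ≤ j → j < r → ¬ P j)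
  least-positive {P} P? N 1≤N PN = go (N ∸ 1) 1 (ℕₚ.m∸n+n≡m 1≤N) ℕₚ.≤-refl (λ j 1≤j j<1 → ⊥-elim (ℕₚ.<⇒≱ j<1 1≤j))
    where
    go : ∀ gap r → gap ℕ.+ r ≡ N → 1 ≤ r → (∀ j → 1 ≤ j → j < r → ¬ P j) →
         Σ ℕ λ r → 1 ≤ r × P r × (∀ j → 1 ≤ j → j < r → ¬ P j)
    go gap r e 1≤r below with P? r
    go gap       r e 1≤r below | yes Pr = r , 1≤r , Pr , below
    go zero      r e 1≤r below | no ¬Pr = ⊥-elim (¬Pr (subst P (sym e) PN))
    go (suc gap) r e 1≤r below | no ¬Pr = go gap (suc r) (trans (ℕₚ.+-suc gap r) e) (s≤s z≤n) below′
      where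
      below′ : ∀ j → 1 ≤ j → j < suc r → ¬ P j
      below′ j 1≤j (s≤s j≤r) with ℕₚ.m≤n⇒m<n∨m≡n j≤r
      ... | inj₁ j<r  = below j 1≤j j<r
      ... | inj₂ refl = ¬Pr

-- Conjugates of α and its minimal polynomials over subfields of K.

module Conjugates (K : FiniteField) (p k n : ℕ) (pr : Prime p) (1≤n : 1 ≤ n)
  (card-K : FiniteField.card K ≡ (p ℕ.^ k) ℕ.^ n)
  (f : FF.Poly K (p ℕ.^ k)) (monic : FF.Monic K (p ℕ.^ k) f) (irreducible : FF.Irreducible K (p ℕ.^ k) f)
  (extension : SimpleExtension K (p ℕ.^ k) f) where

  q : ℕ
  q = p ℕ.^ k

  open SimpleExtension extension public using (L; α; root; independent; card-L) renaming (ι to ι-hom)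

  module K where
    open FiniteField K public
    open FieldLemmas K public
    open FF K q public
    open Polynomials K q public
    open Degrees K q public

  module L where
    open FiniteField L public
    open FieldLemmas L public
    open FF L q public
    open Polynomials L q public
    open Degrees L q public

  deg-f : ℕ
  deg-f = K.deg f

  1≤deg-f : 1 ≤ deg-f
  1≤deg-f = proj₁ (proj₂ irreducible)

  N : ℕ
  N = n ℕ.* deg-f

  1≤N : 1 ≤ N
  1≤N = ℕₚ.*-mono-≤ 1≤n 1≤deg-f

  module σK = Frobenius K p k n pr card-K
  module σL = Frobenius L p k N pr (trans card-L (trans (cong (ℕ._^ deg-f) card-K) (ℕₚ.^-*-assoc q n deg-f)))
  module ι = HomLemmas ι-hom q

  ι : K.Carrier → L.Carrier
  ι = Hom.fun ι-hom

  σ : ℕ → L.Carrier → L.Carrier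
  σ = L.σ

  ev : K.Poly → L.Carrier → L.Carrier
  ev g = L.eval (map ι g)

  σ-ι : ∀ i c → σ i (ι c) ≡ ι (K.σ i c)
  σ-ι i c = trans (σL.^ᶜ≡^ (ι c) (q ℕ.^ i)) (trans (sym (ι.hom-^ c (q ℕ.^ i))) (cong ι (sym (σK.^ᶜ≡^ c (q ℕ.^ i)))))

  ev-cong : ∀ {g h} → g K.≈ₚ h → ∀ x → ev g x ≡ ev h x
  ev-cong {g} {h} e = L.eval-cong {map ι g} {map ι h} (ι.map-≈ g h e)

  ev-*ₚ : ∀ g h x → ev (g K.*ₚ h) x ≡ ev g x L.* ev h x
  ev-*ₚ g h x = trans (cong (λ z → L.eval z x) (ι.map-*ₚ g h)) (L.eval-*ₚ (map ι g) (map ι h) x)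

  ev-+ₚ : ∀ g h x → ev (g K.+ₚ h) x ≡ ev g x L.+ ev h x
  ev-+ₚ g h x = trans (cong (λ z → L.eval z x) (ι.map-+ₚ g h)) (L.eval-+ₚ (map ι g) (map ι h) x)

  ev-scale : ∀ c g x → ev (K.scale c g) x ≡ ι c L.* ev g x
  ev-scale c g x = trans (cong (λ z → L.eval z x) (ι.map-scale c g)) (L.eval-scale (ι c) (map ι g) x)

  ev-σₚ : ∀ i g x → ev (K.σₚ i g) (σ i x) ≡ σ i (ev g x)
  ev-σₚ i g x = trans (cong (λ z → L.eval z (σ i x)) (σₚ-map g)) (HomLemmas.eval-map (σL.σ-hom i) q (map ι g) x)
    where
    σₚ-map : ∀ g → map ι (K.σₚ i g) ≡ map (σ i) (map ι g)
    σₚ-map []      = refl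
    σₚ-map (c ∷ g) = cong₂ _∷_ (sym (σ-ι i c)) (σₚ-map g)

  σ-* : ∀ i {x} → σ i x ≡ x → ∀ t → σ (i ℕ.* t) x ≡ x
  σ-* i {x} e t = trans (cong (λ z → σ z x) (ℕₚ.*-comm i t)) (σL.σ-fixed-* i e t)

  σ-fixed-∣ : ∀ {i t} → i ∣ t → ∀ {x} → σ i x ≡ x → σ t x ≡ x
  σ-fixed-∣ {i} (divides c refl) h = σL.σ-fixed-* i h c

  σₚ-fixed : ∀ i g → K.CoeffsIn (K.InFq^ i) g → K.σₚ i g ≡ g
  σₚ-fixed i []      []      = refl
  σₚ-fixed i (c ∷ g) (e ∷ h) = cong₂ _∷_ e (σₚ-fixed i g h)

  -- σ^i fixes the coefficients of g, so g(σ^i x) = σ^i(g(x)).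
  ev-σ-root : ∀ i g → K.CoeffsIn (K.InFq^ i) g → ∀ {x} → ev g x ≡ L.0# → ev g (σ i x) ≡ L.0#
  ev-σ-root i g h {x} e = trans (cong (λ z → ev z (σ i x)) (sym (σₚ-fixed i g h)))
    (trans (ev-σₚ i g x) (trans (cong (σ i) e) (Hom.hom-0 (σL.σ-hom i))))

  ev-conjugate-root : ∀ i g → K.CoeffsIn (K.InFq^ i) g → ∀ {x} → ev g x ≡ L.0# → ∀ j → ev g (σ (i ℕ.* j) x) ≡ L.0#
  ev-conjugate-root i g h {x} e j = subst (λ z → ev g (σ z x) ≡ L.0#) (ℕₚ.*-comm j i) (go j)
    where
    go : ∀ j → ev g (σ (j ℕ.* i) x) ≡ L.0#
    go zero    = trans (cong (ev g) (σL.σ-zero x)) e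
    go (suc j) = trans (cong (ev g) (σL.σ-+ i (j ℕ.* i) x)) (ev-σ-root i g h (go j))

  σn-ι : ∀ c → σ n (ι c) ≡ ι c
  σn-ι c = trans (σ-ι n c) (cong ι (σK.σ-N c))

  private
    -- Keeps the term -x strictly below the leading term of x^Q - x.
    2≤card : 2 ≤ K.card
    2≤card = go K.elements (K.complete K.0#) (K.complete K.1#)
      where
      go : ∀ xs → K.0# ∈ xs → K.1# ∈ xs → 2 ≤ length xs
      go (x ∷ [])     (here e) (here e′) = ⊥-elim (K.0≢1 (trans e (sym e′)))
      go (x ∷ y ∷ xs) _        _         = s≤s (s≤s z≤n)

    monomial : ℕ → L.Poly
    monomial zero    = L.1# ∷ []
    monomial (suc j) = L.0# ∷ monomial j

    eval-monomial : ∀ j x → L.eval (monomial j) x ≡ x L.^ j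
    eval-monomial zero    x = trans (cong (L.1# L.+_) (L.zeroʳ x)) (L.+-identityʳ _)
    eval-monomial (suc j) x = trans (L.+-identityˡ _) (cong (x L.*_) (eval-monomial j x))

    coeff-monomial : ∀ j → L.coeff (monomial j) j ≡ L.1#
    coeff-monomial zero    = refl
    coeff-monomial (suc j) = coeff-monomial j

    length-monomial : ∀ j → length (monomial j) ≡ suc j
    length-monomial zero    = refl
    length-monomial (suc j) = cong suc (length-monomial j)

  -- x^(q^n) − x has at most q^n roots in L, and ι K already provides that many.
  σn-fixed⇒ι : ∀ y → σ n y ≡ y → Σ K.Carrier λ c → ι c ≡ y
  σn-fixed⇒ι y fixed with any? (λ c → ι c L.≟ y) K.elements
  ... | yes found = let c , _ , e = find found in c , e
  ... | no ¬found = ⊥-elim (L.coeff≡1⇒≢0 {X^Q-X} {Q} top (L.too-many-roots-deg X^Q-X roots unique-roots small all-roots Q))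
    where
    Q = K.card
    X^Q-X = monomial Q L.+ₚ (L.0# ∷ L.- L.1# ∷ [])
    roots = y ∷ map ι K.elements

    unique-roots = Allₚ.map⁺ (All.map (λ ne e → ne (sym e)) (Allₚ.¬Any⇒All¬ K.elements ¬found))
      ∷ Uniqueₚ.map⁺ ι.hom-injective K.unique

    top : L.coeff X^Q-X Q ≡ L.1#
    top = trans (L.coeff-+ₚ (monomial Q) _ Q) (trans
      (cong₂ L._+_ (coeff-monomial Q) (L.coeff-beyond (L.0# ∷ L.- L.1# ∷ []) Q 2≤card)) (L.+-identityʳ _))

    small : ∀ j → length roots ≤ j → L.coeff X^Q-X j ≡ L.0#
    small j h = trans (L.coeff-+ₚ (monomial Q) _ j) (trans (cong₂ L._+_
      (L.coeff-beyond (monomial Q) j (subst (_≤ j) (sym (length-monomial Q)) h′))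
      (L.coeff-beyond (L.0# ∷ L.- L.1# ∷ []) j (ℕₚ.≤-trans 2≤card (ℕₚ.<⇒≤ h′)))) (L.+-identityˡ _))
      where
      h′ : suc Q ≤ j
      h′ = subst (λ z → suc z ≤ j) (Listₚ.length-map ι K.elements) h

    is-root : ∀ {x} → σ n x ≡ x → L.eval X^Q-X x ≡ L.0#
    is-root {x} e = begin
      L.eval X^Q-X x                                       ≡⟨ L.eval-+ₚ (monomial Q) _ x ⟩
      L.eval (monomial Q) x L.+ L.eval (L.0# ∷ L.- L.1# ∷ []) x
        ≡⟨ cong₂ L._+_ (trans (eval-monomial Q x) (trans (cong (x L.^_) card-K) (trans (sym (σL.^ᶜ≡^ x (q ℕ.^ n))) e)))
                       (trans (L.eval-linear (L.- L.1#) L.0# x) (L.+-identityʳ _)) ⟩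
      x L.+ L.- L.1# L.* x                                 ≡⟨ cong (x L.+_) (L.-‿distribˡ-* L.1# x) ⟨
      x L.+ L.- (L.1# L.* x)                               ≡⟨ cong (λ z → x L.+ L.- z) (L.*-identityˡ x) ⟩
      x L.+ L.- x                                          ≡⟨ L.-‿inverseʳ x ⟩
      L.0#                                                 ∎
      where open ≡-Reasoning

    all-roots : All (λ x → L.eval X^Q-X x ≡ L.0#) roots
    all-roots = is-root fixed ∷ Allₚ.map⁺ (All.universal (λ c → is-root (σn-ι c)) K.elements)

  module Orbit (e : ℕ) where
    ρ : ℕ → L.Carrier
    ρ j = σ (e ℕ.* j) α

    private abstract
      -- σ^N is the identity, so the search for the first return to α ends at N at the latest.
      least : Σ ℕ λ r → 1 ≤ r × ρ r ≡ α × (∀ j → 1 ≤ j → j < r → ρ j ≢ α)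
      least = least-positive (λ j → ρ j L.≟ α) N 1≤N
        (trans (cong (λ z → σ z α) (ℕₚ.*-comm e N)) (σ-* N (σL.σ-N α) e))

    period : ℕ
    period = proj₁ least

    1≤period : 1 ≤ period
    1≤period = proj₁ (proj₂ least)

    instance
      period-nonZero : NonZero period
      period-nonZero = ℕ.>-nonZero 1≤period

    ρ-period : ρ period ≡ α
    ρ-period = proj₁ (proj₂ (proj₂ least))

    ρ-+ : ∀ i j → ρ (i ℕ.+ j) ≡ σ (e ℕ.* i) (ρ j)
    ρ-+ i j = trans (cong (λ z → σ z α) (ℕₚ.*-distribˡ-+ e i j)) (σL.σ-+ (e ℕ.* i) (e ℕ.* j) α)

    ρ-zero : ρ 0 ≡ α
    ρ-zero = trans (cong (λ z → σ z α) (ℕₚ.*-zeroʳ e)) (σL.σ-zero α)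

    ρ-suc : ∀ j → ρ (suc j) ≡ σ e (ρ j)
    ρ-suc j = trans (ρ-+ 1 j) (cong (λ z → σ z (ρ j)) (ℕₚ.*-identityʳ e))

    ρ-multiple : ∀ t → ρ (t ℕ.* period) ≡ α
    ρ-multiple t = trans (cong (λ z → σ z α) (trans (cong (e ℕ.*_) (ℕₚ.*-comm t period)) (sym (ℕₚ.*-assoc e period t))))
      (σ-* (e ℕ.* period) ρ-period t)

    ρ-% : ∀ j → ρ j ≡ ρ (j % period)
    ρ-% j = trans (cong ρ (m≡m%n+[m/n]*n j period)) (trans (ρ-+ (j % period) (j / period ℕ.* period))
      (cong (σ (e ℕ.* (j % period))) (ρ-multiple (j / period))))

    period-∣ : ∀ {t} → ρ t ≡ α → period ∣ t
    period-∣ {t} eq = m%n≡0⇒n∣m t period (zero-remainder (t % period) (m%n<n t period) (trans (sym (ρ-% t)) eq))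
      where
      zero-remainder : ∀ j → j < period → ρ j ≡ α → j ≡ 0
      zero-remainder zero    _  _ = refl
      zero-remainder (suc j) lt h = ⊥-elim (proj₂ (proj₂ (proj₂ least)) (suc j) (s≤s z≤n) lt h)

    ∣-period : ∀ {t} → period ∣ t → ρ t ≡ α
    ∣-period (divides t refl) = ρ-multiple t

    -- Cancelling the injective σ^(ei) from a repetition would give a return to α after j - i steps,
    -- before the period.
    ρ-distinct : ∀ {i j} → i < j → j < period → ρ i ≢ ρ j
    ρ-distinct {i} {j} i<j j<r eq = proj₂ (proj₂ (proj₂ least)) (j ∸ i) (ℕₚ.m<n⇒0<n∸m i<j)
      (ℕₚ.≤-<-trans (ℕₚ.m∸n≤m j i) j<r) (sym (σL.σ-injective (e ℕ.* i) (begin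
        σ (e ℕ.* i) α              ≡⟨ eq ⟩
        ρ j                        ≡⟨ cong ρ (ℕₚ.m+[n∸m]≡n (ℕₚ.<⇒≤ i<j)) ⟨
        ρ (i ℕ.+ (j ∸ i))          ≡⟨ ρ-+ i (j ∸ i) ⟩
        σ (e ℕ.* i) (ρ (j ∸ i))    ∎)))
      where open ≡-Reasoning

    private
      ρs = applyUpTo ρ period
      length-ρs = Listₚ.length-applyUpTo ρ period
      open ProductOfRoots L q

      Π : L.Poly
      Π = fromRoots ρs

      ρ∈ρs : ∀ j → ρ j ∈ ρs
      ρ∈ρs j = subst (_∈ ρs) (sym (ρ-% j)) (∈ₚ.∈-applyUpTo⁺ ρ (m%n<n j period))

      DegLE-Π : L.DegLE Π period
      DegLE-Π = subst (L.DegLE Π) length-ρs (DegLE-fromRoots ρs)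

      coeff-Π : L.coeff Π period ≡ L.1#
      coeff-Π = trans (cong (L.coeff Π) (sym length-ρs)) (coeff-fromRoots ρs)

      module σe = HomLemmas (σL.σ-hom e) q

      -- σ^e permutes the orbit, so σ^e Π and Π are monic with the same roots. They are compared on
      -- the orbit shifted by one step, where both visibly vanish.
      Π-fixed : ∀ j → σ e (L.coeff Π j) ≡ L.coeff Π j
      Π-fixed j = begin
        σ e (L.coeff Π j)
          ≡⟨ σe.coeff-map Π j ⟨
        L.coeff σΠ j
          ≡⟨ L.monic-unique σΠ Π period (λ j → ρ (suc j)) distinct
               (λ j → trans (cong (L.eval σΠ) (ρ-suc j)) (trans (σe.eval-map Π (ρ j)) (trans (cong (σ e) (eval-fromRoots (ρ∈ρs j))) σe.hom-0)))
               (λ j → eval-fromRoots (ρ∈ρs (suc j))) (σe.DegLE-map {Π} DegLE-Π) DegLE-Π coeff-Π j ⟩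
        L.coeff (L.scale (L.coeff σΠ period) Π) j
          ≡⟨ L.coeff-scale _ Π j ⟩
        L.coeff σΠ period L.* L.coeff Π j
          ≡⟨ cong (L._* L.coeff Π j) (trans (σe.coeff-map Π period) (trans (cong (σ e) coeff-Π) σe.hom-1)) ⟩
        L.1# L.* L.coeff Π j
          ≡⟨ L.*-identityˡ _ ⟩
        L.coeff Π j ∎
        where
        open ≡-Reasoning
        σΠ = map (σ e) Π
        distinct : ∀ {i j} → i < j → j < period → ρ (suc i) ≢ ρ (suc j)
        distinct i<j j<r eq = ρ-distinct i<j j<r (σL.σ-injective e (trans (sym (ρ-suc _)) (trans eq (ρ-suc _))))

    module _ (e∣n : e ∣ n) where
      private
        -- Since e ∣ n, a coefficient fixed by σ^e is fixed by σ^n and so comes from K; injectivity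
        -- of ι carries the fixedness down with it.
        descend : ∀ g → (∀ j → σ e (L.coeff g j) ≡ L.coeff g j) →
                  Σ K.Poly λ h → map ι h ≡ g × K.CoeffsIn (K.InFq^ e) h
        descend []      fixed = [] , refl , []
        descend (y ∷ g) fixed with descend g (fixed ∘ suc) | σn-fixed⇒ι y (σ-fixed-∣ e∣n (fixed 0))
        ... | h , refl , Ph | c , refl = c ∷ h , refl , ι.hom-injective (trans (sym (σ-ι e c)) (fixed 0)) ∷ Ph

        abstract
          descended : Σ K.Poly λ h → map ι h ≡ Π × K.CoeffsIn (K.InFq^ e) h
          descended = descend Π Π-fixed

      minPoly : K.Poly
      minPoly = proj₁ descended

      private
        map-minPoly : map ι minPoly ≡ Π
        map-minPoly = proj₁ (proj₂ descended)

      minPoly-coeffs : K.CoeffsIn (K.InFq^ e) minPoly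
      minPoly-coeffs = proj₂ (proj₂ descended)

      DegLE-minPoly : K.DegLE minPoly period
      DegLE-minPoly j lt = ι.hom-≡0 (trans (sym (ι.coeff-map minPoly j))
        (trans (cong (λ z → L.coeff z j) map-minPoly) (DegLE-Π j lt)))

      coeff-minPoly : K.coeff minPoly period ≡ K.1#
      coeff-minPoly = ι.hom-injective (trans (sym (ι.coeff-map minPoly period))
        (trans (cong (λ z → L.coeff z period) map-minPoly) (trans coeff-Π (sym ι.hom-1))))

      deg-minPoly : K.deg minPoly ≡ period
      deg-minPoly = K.deg-unique minPoly DegLE-minPoly (K.coeff≡1⇒≢0 {minPoly} coeff-minPoly)

      minPoly-monic : K.Monic minPoly
      minPoly-monic = trans (K.lead-unique minPoly DegLE-minPoly (K.coeff≡1⇒≢0 {minPoly} coeff-minPoly)) coeff-minPoly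

      ev-minPoly : ∀ j → ev minPoly (ρ j) ≡ L.0#
      ev-minPoly j = trans (cong (λ z → L.eval z (ρ j)) map-minPoly) (eval-fromRoots (ρ∈ρs j))

      minPoly-root : ∀ {x} → ev minPoly x ≡ L.0# → Σ ℕ λ j → x ≡ ρ j
      minPoly-root {x} h = let j , _ , eq = ∈ₚ.∈-applyUpTo⁻ ρ (fromRoots-root ρs (trans (cong (λ z → L.eval z x) (sym map-minPoly)) h))
                           in j , eq

      conjugates-roots⇒≈0 : ∀ g → (∀ j → ev g (ρ j) ≡ L.0#) → (∀ j → period ≤ j → K.coeff g j ≡ K.0#) → g K.≈ₚ []
      conjugates-roots⇒≈0 g roots small = ι.map-≈-injective g [] (L.too-many-roots′ (map ι g) period ρ ρ-distinct roots
        (λ j h → trans (ι.coeff-map g j) (trans (cong ι (small j h)) ι.hom-0)))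

      ≈-scale-minPoly : ∀ g → K.DegLE g period → (∀ j → ev g (ρ j) ≡ L.0#) → g K.≈ₚ K.scale (K.coeff g period) minPoly
      ≈-scale-minPoly g hg roots = ι.map-≈-injective g (K.scale c minPoly) (λ j → trans
        (L.monic-unique (map ι g) (map ι minPoly) period ρ ρ-distinct roots ev-minPoly
          (ι.DegLE-map {g} hg) (ι.DegLE-map {minPoly} DegLE-minPoly)
          (trans (ι.coeff-map minPoly period) (trans (cong ι coeff-minPoly) ι.hom-1)) j)
        (cong (λ z → L.coeff z j) (trans (cong (λ c → L.scale c (map ι minPoly)) (ι.coeff-map g period))
          (sym (ι.map-scale c minPoly)))))
        where c = K.coeff g period

      private
        module σKe = HomLemmas (σK.σ-hom e) q
        open K.Division (K.InFq^ e) σKe.hom-0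
          (λ {x} {y} hx hy → trans (σKe.hom-+ x y) (cong₂ K._+_ hx hy))
          (λ {x} {y} hx hy → trans (σKe.hom-* x y) (cong₂ K._*_ hx hy))
          (λ {x} hx → trans (σKe.hom-neg x) (cong K.-_ hx))

      -- The division takes place over the fixed field of σ^e. There a root α of g forces the whole
      -- orbit to be roots, hence also roots of the remainder, which is too short for that many.
      minPoly-divides : ∀ g → K.CoeffsIn (K.InFq^ e) g → ev g α ≡ L.0# →
                        Σ K.Poly λ d → K.CoeffsIn (K.InFq^ e) d × g K.≈ₚ (d K.*ₚ minPoly)
      minPoly-divides g hg root =
        conclude (divMod minPoly (subst (K.DegLE minPoly) period≡ DegLE-minPoly)
          (trans (cong (K.coeff minPoly) (sym period≡)) coeff-minPoly) minPoly-coeffs g hg)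
        where
        period≡ : period ≡ suc (ℕ.pred period)
        period≡ = sym (ℕₚ.suc-pred period)

        conclude : (Σ K.Poly λ d → Σ K.Poly λ s → K.CoeffsIn (K.InFq^ e) d × K.CoeffsIn (K.InFq^ e) s ×
                      length s ≤ suc (ℕ.pred period) × g K.≈ₚ ((d K.*ₚ minPoly) K.+ₚ s)) →
                   Σ K.Poly λ d → K.CoeffsIn (K.InFq^ e) d × g K.≈ₚ (d K.*ₚ minPoly)
        conclude (d , s , hd , hs , ls , eq) = d , hd , λ j → trans (eq j) (trans (K.coeff-+ₚ (d K.*ₚ minPoly) s j)
            (trans (cong (K.coeff (d K.*ₚ minPoly) j K.+_) (s≈0 j)) (K.+-identityʳ _)))
          where
          ev-s : ∀ j → ev s (ρ j) ≡ L.0#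
          ev-s j = begin
            ev s (ρ j)                                            ≡⟨ L.+-identityˡ _ ⟨
            L.0# L.+ ev s (ρ j)                                   ≡⟨ cong (L._+ ev s (ρ j)) (trans (ev-*ₚ d minPoly (ρ j)) (trans (cong (ev d (ρ j) L.*_) (ev-minPoly j)) (L.zeroʳ _))) ⟨
            ev (d K.*ₚ minPoly) (ρ j) L.+ ev s (ρ j)              ≡⟨ ev-+ₚ (d K.*ₚ minPoly) s (ρ j) ⟨
            ev ((d K.*ₚ minPoly) K.+ₚ s) (ρ j)                    ≡⟨ ev-cong {g} {(d K.*ₚ minPoly) K.+ₚ s} eq (ρ j) ⟨
            ev g (ρ j)                                            ≡⟨ ev-conjugate-root e g hg root j ⟩
            L.0#                                                  ∎
            where open ≡-Reasoning
          s≈0 = conjugates-roots⇒≈0 s ev-s (λ j h → K.coeff-beyond s j (ℕₚ.≤-trans ls (subst (_≤ j) period≡ h)))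

      -- The cofactor of `minPoly` in g is constant by irreducibility, and comparing leading
      -- coefficients makes it 1.
      irreducible⇒minPoly : ∀ g → K.Monic g → K.IrreducibleIn (K.InFq^ e) g → ev g α ≡ L.0# →
                            g K.≈ₚ minPoly × K.deg g ≡ period
      irreducible⇒minPoly g g-monic (hg , _ , g-irr) root = conclude (minPoly-divides g hg root)
        where
        conclude : (Σ K.Poly λ d → K.CoeffsIn (K.InFq^ e) d × g K.≈ₚ (d K.*ₚ minPoly)) → g K.≈ₚ minPoly × K.deg g ≡ period
        conclude (d , hd , eq) = split (g-irr d minPoly hd minPoly-coeffs eq)
          where
          constant : K.deg d ≡ 0 → g K.≈ₚ minPoly × K.deg g ≡ period
          constant deg0 = g≈ , trans (K.deg-cong g minPoly g≈) deg-minPoly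
            where
            open ≡-Reasoning
            c = K.coeff d 0
            g≈c : ∀ j → K.coeff g j ≡ c K.* K.coeff minPoly j
            g≈c j = trans (eq j) (K.coeff-*ₚ-constant d minPoly (subst (K.DegLE d) deg0 (K.DegLE-deg d)) j)

            DegLE-g : K.DegLE g period
            DegLE-g j lt = trans (g≈c j) (trans (cong (c K.*_) (DegLE-minPoly j lt)) (K.zeroʳ c))

            coeff-g : K.coeff g period ≡ c
            coeff-g = trans (g≈c period) (trans (cong (c K.*_) coeff-minPoly) (K.*-identityʳ c))

            c≢0 : c ≢ K.0#
            c≢0 c≡0 = K.coeff≡1⇒≢0 {g} (trans (K.coeff-deg g) g-monic)
              (trans (g≈c _) (trans (cong (K._* _) c≡0) (K.zeroˡ _)))

            c≡1 : c ≡ K.1#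
            c≡1 = trans (sym coeff-g) (trans (sym (K.lead-unique g DegLE-g (λ z → c≢0 (trans (sym coeff-g) z)))) g-monic)

            g≈ : g K.≈ₚ minPoly
            g≈ j = trans (g≈c j) (trans (cong (K._* K.coeff minPoly j) c≡1) (K.*-identityˡ _))

          split : K.deg d ≡ 0 ⊎ K.deg minPoly ≡ 0 → g K.≈ₚ minPoly × K.deg g ≡ period
          split (inj₁ deg0) = constant deg0
          split (inj₂ deg0) = ⊥-elim (ℕₚ.<⇒≢ 1≤period (trans (sym deg0) deg-minPoly))

      private
        -- A factor vanishing at α vanishes on the whole orbit and so has degree at least `period`,
        -- which leaves degree 0 for the other.
        factor-degree : ∀ g h → K.CoeffsIn (K.InFq^ e) g → minPoly K.≈ₚ (g K.*ₚ h) → ev g α ≡ L.0# → K.deg h ≡ 0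
        factor-degree g h hg eq root = ℕₚ.m+n≡0⇒n≡0 (K.deg g ∸ period) (ℕₚ.+-cancelˡ-≡ period _ _ (begin
          period ℕ.+ (K.deg g ∸ period ℕ.+ K.deg h)   ≡⟨ ℕₚ.+-assoc period _ _ ⟨
          period ℕ.+ (K.deg g ∸ period) ℕ.+ K.deg h   ≡⟨ cong (ℕ._+ K.deg h) (ℕₚ.m+[n∸m]≡n period≤deg) ⟩
          K.deg g ℕ.+ K.deg h                         ≡⟨ K.deg-* g h (proj₁ leads≢0) (proj₂ leads≢0) ⟨
          K.deg (g K.*ₚ h)                            ≡⟨ K.deg-cong minPoly (g K.*ₚ h) eq ⟨
          K.deg minPoly                               ≡⟨ deg-minPoly ⟩
          period                                      ≡⟨ ℕₚ.+-identityʳ period ⟨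
          period ℕ.+ 0                                ∎))
          where
          open ≡-Reasoning
          minPoly≉0 : ¬ minPoly K.≈ₚ []
          minPoly≉0 z = K.coeff≡1⇒≢0 {minPoly} coeff-minPoly (z period)

          g≉0 : ¬ g K.≈ₚ []
          g≉0 z = minPoly≉0 (λ j → trans (eq j) (K.*ₚ-≈0ˡ g h z j))

          leads≢0 : K.lead g ≢ K.0# × K.lead h ≢ K.0#
          leads≢0 = (λ z → g≉0 (K.lead≡0⇒≈0 g z)) ,
                    (λ z → minPoly≉0 (λ j → trans (eq j) (trans (K.*ₚ-comm g h j) (K.*ₚ-≈0ˡ h g (K.lead≡0⇒≈0 h z) j))))

          period≤deg : period ≤ K.deg g
          period≤deg = ℕₚ.≮⇒≥ (λ lt → g≉0 (conjugates-roots⇒≈0 g (ev-conjugate-root e g hg root)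
            (λ j h → K.DegLE-deg g j (ℕₚ.<-≤-trans lt h))))

      minPoly-irreducible : K.IrreducibleIn (K.InFq^ e) minPoly
      minPoly-irreducible = minPoly-coeffs , subst (1 ≤_) (sym deg-minPoly) 1≤period , split
        where
        split : ∀ g h → K.CoeffsIn (K.InFq^ e) g → K.CoeffsIn (K.InFq^ e) h → minPoly K.≈ₚ (g K.*ₚ h) → K.deg g ≡ 0 ⊎ K.deg h ≡ 0
        split g h hg hh eq = cases (L.xy≡0⇒x≡0∨y≡0 (trans (sym (ev-*ₚ g h α)) (trans (sym (ev-cong {minPoly} {g K.*ₚ h} eq α))
                               (trans (cong (ev minPoly) (sym ρ-zero)) (ev-minPoly 0)))))
          where
          cases : ev g α ≡ L.0# ⊎ ev h α ≡ L.0# → K.deg g ≡ 0 ⊎ K.deg h ≡ 0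
          cases (inj₁ root) = inj₂ (factor-degree g h hg eq root)
          cases (inj₂ root) = inj₁ (factor-degree h g hh (K.≈ₚ-trans {minPoly} {g K.*ₚ h} {h K.*ₚ g} eq (K.*ₚ-comm g h)) root)

-- Arithmetic of the period D.

module Arithmetic where
  open import Data.Nat using (_+_; _*_; _/_)
  open import Data.Nat.Solver using (module +-*-Solver)

  -- D divides nr exactly when D / gcd(D, n) divides r, because that quotient is coprime to n /
  -- gcd(D, n). The hypotheses make m the generator of the same set of exponents r.
  period-formula : ∀ D n m → 1 ≤ D → (∀ r → D ∣ n * r → m ∣ r) → D ∣ n * m → D ≡ m * gcd D n
  period-formula D n m 1≤D to from = trans D≡ (cong (_* h) (∣-antisym D′∣m m∣D′))
    where
    h = gcd D n
    instance
      h≢0 : NonZero h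
      h≢0 = ≢-nonZero (λ e → ℕₚ.<⇒≢ 1≤D (sym (gcd[m,n]≡0⇒m≡0 e)))
    D′ = quotient (gcd[m,n]∣m D n)
    n′ = quotient (gcd[m,n]∣n D n)
    D≡ : D ≡ D′ * h
    D≡ = _∣_.equality (gcd[m,n]∣m D n)
    n≡ : n ≡ n′ * h
    n≡ = _∣_.equality (gcd[m,n]∣n D n)

    m∣D′ : m ∣ D′
    m∣D′ = to D′ (divides n′ (begin
      n * D′         ≡⟨ cong (_* D′) n≡ ⟩
      n′ * h * D′    ≡⟨ ℕₚ.*-assoc n′ h D′ ⟩
      n′ * (h * D′)  ≡⟨ cong (n′ *_) (trans (ℕₚ.*-comm h D′) (sym D≡)) ⟩
      n′ * D         ∎))
      where open ≡-Reasoning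

    coprime : Coprime D′ n′
    coprime {i} (i∣D′ , i∣n′) = ∣1⇒≡1 (*-cancelʳ-∣ h (subst (i * h ∣_) (sym (ℕₚ.*-identityˡ h))
      (gcd-greatest (subst (i * h ∣_) (sym D≡) (*-monoˡ-∣ h i∣D′)) (subst (i * h ∣_) (sym n≡) (*-monoˡ-∣ h i∣n′)))))

    D′∣m : D′ ∣ m
    D′∣m = coprime-divisor coprime (*-cancelʳ-∣ h (subst₂ _∣_ D≡
      (trans (cong (_* m) n≡) (solve 3 (λ a b c → a :* b :* c := a :* c :* b) refl n′ h m)) from))
      where open +-*-Solver

  coprime-∣ : ∀ {a b a′ b′} → Coprime a b → a′ ∣ a → b′ ∣ b → Coprime a′ b′
  coprime-∣ c a′∣a b′∣b (i∣a′ , i∣b′) = c (∣-trans i∣a′ a′∣a , ∣-trans i∣b′ b′∣b)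

  coprime-* : ∀ {a b c} → Coprime a b → Coprime a c → Coprime a (b * c)
  coprime-* ab ac (i∣a , i∣bc) = ac (i∣a , coprime-divisor (coprime-∣ ab i∣a ∣-refl) i∣bc)

  coprime-prime : ∀ {p a} → Prime p → ¬ p ∣ a → Coprime a p
  coprime-prime pr p∤a (i∣a , i∣p) with prime⇒irreducible pr i∣p
  ... | inj₁ i≡1  = i≡1
  ... | inj₂ refl = ⊥-elim (p∤a i∣a)

  -- Prime by prime: if p divides k₁ = k + ux, coprime to r and to u, then k₁ + ur is coprime to p * r.
  coprime-lift : ∀ k u n → .{{NonZero n}} → Coprime k u → Σ ℕ λ x → Coprime (k + u * x) n
  coprime-lift k u n k⊥u = let x , c = go factors factorsPrime in x , subst (Coprime _) (sym isFactorisation) c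
    where
    open PrimeFactorisation (factorise n)
    go : ∀ ps → All Prime ps → Σ ℕ λ x → Coprime (k + u * x) (product ps)
    go []       []         = 0 , λ (_ , i∣1) → ∣1⇒≡1 i∣1
    go (p ∷ ps) (pr ∷ prs) with go ps prs
    ... | x , c with p ∣? (k + u * x)
    ...   | no p∤  = x , coprime-* (coprime-prime pr p∤) c
    ...   | yes p∣ = x + r , subst (λ z → Coprime z (p * r)) (sym k₂≡) (coprime-* (coprime-prime pr p∤k₂) k₂⊥r)
      where
      r = product ps
      k₁ = k + u * x
      k₂≡ : k + u * (x + r) ≡ k₁ + u * r
      k₂≡ = trans (cong (k +_) (ℕₚ.*-distribˡ-+ u x r)) (sym (ℕₚ.+-assoc k (u * x) (u * r)))

      p≢1 : p ≢ 1
      p≢1 refl with () ← prime⇒nonTrivial pr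

      p∤k₂ : ¬ p ∣ k₁ + u * r
      p∤k₂ p∣k₂ with euclidsLemma u r pr (∣m+n∣m⇒∣n p∣k₂ p∣)
      ... | inj₁ p∣u = p≢1 (k⊥u (∣m+n∣m⇒∣n (subst (p ∣_) (ℕₚ.+-comm k (u * x)) p∣) (∣m⇒∣m*n x p∣u) , p∣u))
      ... | inj₂ p∣r = p≢1 (c (p∣ , p∣r))

      k₂⊥r : Coprime (k₁ + u * r) r
      k₂⊥r {i} (i∣k₂ , i∣r) = c (∣m+n∣m⇒∣n (subst (i ∣_) (ℕₚ.+-comm k₁ (u * r)) i∣k₂) (∣n⇒∣m*n u i∣r) , i∣r)

  -- Residues are taken in 1, ..., n, so remainder 0 becomes n; the extra n on the left avoids a
  -- subtraction in that case.
  representative : ∀ w n → 1 ≤ n → Σ ℕ λ i → Σ ℕ λ y → 1 ≤ i × i ≤ n × w + n ≡ i + n * y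
  representative w n 1≤n with (w % n) {{>-nonZero 1≤n}} in eq
  ... | zero  = n , (w / n) , 1≤n , ℕₚ.≤-refl , trans (ℕₚ.+-comm w n) (cong (n +_)
                  (trans (m≡m%n+[m/n]*n w n) (trans (cong (_+ w / n * n) eq) (ℕₚ.*-comm (w / n) n))))
    where instance _ = >-nonZero 1≤n
  ... | suc j = suc j , w / n + 1 , s≤s z≤n , subst (_≤ n) eq (ℕₚ.<⇒≤ (m%n<n w n)) , (begin
      w + n                        ≡⟨ cong (_+ n) (m≡m%n+[m/n]*n w n) ⟩
      w % n + w / n * n + n        ≡⟨ cong (λ z → z + w / n * n + n) eq ⟩
      suc j + w / n * n + n        ≡⟨ ℕₚ.+-assoc (suc j) (w / n * n) n ⟩
      suc j + (w / n * n + n)      ≡⟨ cong (suc j +_) (solve 2 (λ a n → a :* n :+ n := n :* (a :+ con 1)) refl (w / n) n) ⟩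
      suc j + n * (w / n + 1)      ∎)
    where
    instance _ = >-nonZero 1≤n
    open ≡-Reasoning
    open +-*-Solver

  -- k is first moved within its class modulo u to a number coprime to n and then reduced modulo n,
  -- which respects the class as u ∣ n. The final equation is k ≡ i modulo u, with multiples of u on
  -- both sides instead of a difference.
  coprime-representative : ∀ k u n → 1 ≤ n → Coprime k u → u ∣ n →
    Σ ℕ λ i → Σ ℕ λ a → Σ ℕ λ b → 1 ≤ i × i ≤ n × gcd i n ≡ 1 × k + u * a ≡ i + u * b
  coprime-representative k u n 1≤n k⊥u (divides c n≡cu) = conclude (coprime-lift k u n {{>-nonZero 1≤n}} k⊥u)
    where
    conclude : (Σ ℕ λ x → Coprime (k + u * x) n) →
      Σ ℕ λ i → Σ ℕ λ a → Σ ℕ λ b → 1 ≤ i × i ≤ n × gcd i n ≡ 1 × k + u * a ≡ i + u * b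
    conclude (x , w⊥n) with representative (k + u * x) n 1≤n
    ... | i , y , 1≤i , i≤n , eq = i , x + c , c * y , 1≤i , i≤n , coprime⇒gcd≡1 i⊥n , (begin
        k + u * (x + c)         ≡⟨ solve 4 (λ k u x c → k :+ u :* (x :+ c) := k :+ u :* x :+ c :* u) refl k u x c ⟩
        k + u * x + c * u       ≡⟨ cong (k + u * x +_) n≡cu ⟨
        k + u * x + n           ≡⟨ eq ⟩
        i + n * y               ≡⟨ cong (λ z → i + z * y) n≡cu ⟩
        i + c * u * y           ≡⟨ solve 4 (λ i u y c → i :+ c :* u :* y := i :+ u :* (c :* y)) refl i u y c ⟩
        i + u * (c * y)         ∎)
      where
      open ≡-Reasoning
      open +-*-Solver
      i⊥n : Coprime i n
      i⊥n {j} (j∣i , j∣n) = w⊥n (∣m+n∣m⇒∣n (subst (j ∣_) (trans (sym eq) (ℕₚ.+-comm (k + u * x) n))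
        (∣m∣n⇒∣m+n j∣i (∣m⇒∣m*n y j∣n))) j∣n , j∣n)

  module _ (d n s : ℕ) .{{_ : NonZero (gcd d n)}} (1≤d : 1 ≤ d) (1≤s : 1 ≤ s) (gcd-sn : gcd s n ≡ 1) where
    private
      d₀ = gcd d n
      d′ = d / d₀
      m = d′ * s
      d≡ : d′ * d₀ ≡ d
      d≡ = m/n*n≡m (gcd[m,n]∣m d n)

      d′≢0 : NonZero d′
      d′≢0 = ≢-nonZero (λ e → ℕₚ.<⇒≢ 1≤d (trans (sym (cong (_* d₀) e)) d≡))

      d≢0 : NonZero d
      d≢0 = >-nonZero 1≤d

      s≢0 : NonZero s
      s≢0 = >-nonZero 1≤s

      ds≡ : m * d₀ ≡ d * s
      ds≡ = trans (solve 3 (λ a b c → a :* b :* c := a :* c :* b) refl d′ s d₀) (cong (_* s) d≡)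
        where open +-*-Solver

    -- Cancelling d′ from the two factorisations of D leaves d₀g = sh with g = gcd(D, k) and h =
    -- gcd(D, n). Here h is coprime to g because k is coprime to n, and d₀ is coprime to s because
    -- it divides n; so h and d₀ divide each other.
    period-from-invariance : ∀ D k → D ≡ m * gcd D n → D ≡ d * gcd D k → gcd k n ≡ 1 → D ≡ d * s
    period-from-invariance D k D≡mh D≡dg k⊥n = trans D≡mh (trans (cong (m *_) h≡d₀) ds≡)
      where
      h = gcd D n
      g = gcd D k
      d₀g≡sh : d₀ * g ≡ s * h
      d₀g≡sh = ℕₚ.*-cancelˡ-≡ _ _ d′ {{d′≢0}} (begin
        d′ * (d₀ * g)   ≡⟨ ℕₚ.*-assoc d′ d₀ g ⟨
        d′ * d₀ * g     ≡⟨ cong (_* g) d≡ ⟩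
        d * g           ≡⟨ D≡dg ⟨
        D               ≡⟨ D≡mh ⟩
        d′ * s * h      ≡⟨ ℕₚ.*-assoc d′ s h ⟩
        d′ * (s * h)    ∎)
        where open ≡-Reasoning

      h⊥g : Coprime h g
      h⊥g = Coprimality.sym (coprime-∣ (gcd≡1⇒coprime k⊥n) (gcd[m,n]∣n D k) (gcd[m,n]∣n D n))

      d₀⊥s : Coprime d₀ s
      d₀⊥s = Coprimality.sym (coprime-∣ (gcd≡1⇒coprime gcd-sn) ∣-refl (gcd[m,n]∣n d n))

      h≡d₀ : h ≡ d₀
      h≡d₀ = ∣-antisym
        (coprime-divisor h⊥g (subst (h ∣_) (trans (sym d₀g≡sh) (ℕₚ.*-comm d₀ g)) (n∣m*n s)))
        (coprime-divisor d₀⊥s (subst (d₀ ∣_) d₀g≡sh (m∣m*n g)))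

    gcd-period-n : ∀ D → D ≡ m * gcd D n → D ≡ d * s → gcd D n ≡ d₀
    gcd-period-n D D≡mh D≡ds = ℕₚ.*-cancelˡ-≡ _ _ m {{ℕₚ.m*n≢0 d′ s {{d′≢0}} {{s≢0}}}}
      (trans (sym D≡mh) (trans D≡ds (sym ds≡)))

    -- The two expressions for D give gcd(D, k) = s. A common divisor of k and d₀ divides d, hence
    -- D, hence s, and it divides n as well.
    coprime-exponent : ∀ D k → D ≡ d * s → D ≡ d * gcd D k → Coprime k d₀
    coprime-exponent D k D≡ds D≡dg {i} (i∣k , i∣d₀) = gcd≡1⇒coprime gcd-sn
      (subst (i ∣_) g≡s (gcd-greatest i∣D i∣k) , ∣-trans i∣d₀ (gcd[m,n]∣n d n))
      where
      g≡s : gcd D k ≡ s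
      g≡s = ℕₚ.*-cancelˡ-≡ _ _ d {{d≢0}} (trans (sym D≡dg) D≡ds)
      i∣D : i ∣ D
      i∣D = subst (i ∣_) (sym D≡ds) (∣m⇒∣m*n s (∣-trans i∣d₀ (gcd[m,n]∣m d n)))

-- The numerator of the composition of a polynomial with a Möbius map.

module Homogenisation (K : FiniteField) (q : ℕ) where
  open FiniteField K
  open FF K q
  open Polynomials K q
  open Degrees K q

  -- A named copy of the sum local to `_∘ₚ_`: (cx+d)^m times the terms of h((ax+b)/(cx+d)) from
  -- index k on.
  homogenise : Mat → ℕ → ℕ → List Carrier → Poly
  homogenise A                 m k []       = []
  homogenise A@(mat a b c d) m k (x ∷ xs) =
    scale x (((b ∷ a ∷ []) ^ₚ k) *ₚ ((d ∷ c ∷ []) ^ₚ (m ∸ k))) +ₚ homogenise A m (suc k) xs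

  -- The local function of _∘ₚ_ cannot be named from here; ∘ₚ≡local solves the metavariable to it.
  private
    mutual
      local : (a b c d : Carrier) → Poly → ℕ → List Carrier → Poly
      local a b c d h = _

      ∘ₚ≡local : ∀ a b c d h → (mat a b c d ∘ₚ h) ≡
                 scale (inv (lead (local a b c d h 0 (strip h)))) (local a b c d h 0 (strip h))
      -- Abstracting both arguments to variables makes the constraint on the metavariable a pattern
      -- problem, which has a unique solution.
      ∘ₚ≡local a b c d h with strip h | 0
      ... | w | k = refl

    local≡homogenise : ∀ a b c d h k xs → local a b c d h k xs ≡ homogenise (mat a b c d) (deg h) k xs
    local≡homogenise a b c d h k []       = refl
    local≡homogenise a b c d h k (x ∷ xs) = cong (scale x _ +ₚ_) (local≡homogenise a b c d h (suc k) xs)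

  numerator : Mat → Poly → Poly
  numerator A h = homogenise A (deg h) 0 (strip h)

  ∘ₚ≡ : ∀ A h → (A ∘ₚ h) ≡ scale (inv (lead (numerator A h))) (numerator A h)
  ∘ₚ≡ (mat a b c d) h = trans (∘ₚ≡local a b c d h)
    (cong (λ H → scale (inv (lead H)) H) (local≡homogenise a b c d h 0 (strip h)))

  private
    -- The length bound gives k ≤ m at every term, so `m ∸ k` is a true difference and the degrees k
    -- and m - k add up to m.
    DegLE-homogenise : ∀ A m k xs → k ℕ.+ length xs ≤ suc m → DegLE (homogenise A m k xs) m
    DegLE-homogenise A               m k []       le j lt = refl
    DegLE-homogenise A@(mat a b c d) m k (x ∷ xs) le =
      DegLE-+ₚ {scale x (Lᵏ *ₚ Mᵐ⁻ᵏ)} {homogenise A m (suc k) xs}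
        (DegLE-scale {Lᵏ *ₚ Mᵐ⁻ᵏ} x (subst (DegLE (Lᵏ *ₚ Mᵐ⁻ᵏ)) (ℕₚ.m+[n∸m]≡n k≤m)
          (DegLE-*ₚ Lᵏ Mᵐ⁻ᵏ (DegLE-^ₚ (b ∷ a ∷ []) k (coeff-beyond (b ∷ a ∷ []))) (DegLE-^ₚ (d ∷ c ∷ []) (m ∸ k) (coeff-beyond (d ∷ c ∷ []))))))
        (DegLE-homogenise A m (suc k) xs le′)
      where
      Lᵏ = (b ∷ a ∷ []) ^ₚ k
      Mᵐ⁻ᵏ = (d ∷ c ∷ []) ^ₚ (m ∸ k)
      le′ : suc k ℕ.+ length xs ≤ suc m
      le′ = subst (_≤ suc m) (ℕₚ.+-suc k (length xs)) le
      k≤m : k ≤ m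
      k≤m = ℕₚ.≤-pred (ℕₚ.≤-trans (ℕₚ.m≤m+n (suc k) (length xs)) le′)

  DegLE-numerator : ∀ A h → DegLE (numerator A h) (deg h)
  DegLE-numerator A h = DegLE-homogenise A (deg h) 0 (strip h) (length-strip h)

-- The action of A on the conjugates of α.

module Moebius (K : FiniteField) (p k n : ℕ) (pr : Prime p) (1≤n : 1 ≤ n)
  (card-K : FiniteField.card K ≡ (p ℕ.^ k) ℕ.^ n)
  (f : FF.Poly K (p ℕ.^ k)) (monic : FF.Monic K (p ℕ.^ k) f) (irreducible : FF.Irreducible K (p ℕ.^ k) f)
  (extension : SimpleExtension K (p ℕ.^ k) f)
  (2<deg-f : 2 < FF.deg K (p ℕ.^ k) f)
  (a b c d : FiniteField.Carrier K) (A∈GL : FF.InGL2q K (p ℕ.^ k) (FF.mat a b c d)) where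

  open Conjugates K p k n pr 1≤n card-K f monic irreducible extension public
  open Homogenisation K q public

  A : K.Mat
  A = K.mat a b c d

  num den : L.Carrier → L.Carrier
  num x = ι a L.* x L.+ ι b
  den x = ι c L.* x L.+ ι d

  -- The relation A·x = y with the denominator cleared; it determines y only where `den x` is
  -- nonzero.
  Maps : L.Carrier → L.Carrier → Set
  Maps x y = num x ≡ den x L.* y

  private
    ev-linear : ∀ u v x → ev (v ∷ u ∷ []) x ≡ ι u L.* x L.+ ι v
    ev-linear u v x = L.eval-linear (ι u) (ι v) x

    ev-^ₚ : ∀ g j x → ev (g K.^ₚ j) x ≡ ev g x L.^ j
    ev-^ₚ g zero    x = trans (cong₂ L._+_ ι.hom-1 (L.zeroʳ x)) (L.+-identityʳ _)
    ev-^ₚ g (suc j) x = trans (ev-*ₚ g (g K.^ₚ j) x) (cong (ev g x L.*_) (ev-^ₚ g j x))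

    ev-homogenise : ∀ {x y} → Maps x y → ∀ m j zs → j ℕ.+ length zs ≤ suc m →
                    ev (homogenise A m j zs) x ≡ den x L.^ m L.* (y L.^ j L.* ev zs y)
    ev-homogenise {x} {y} maps m j []       le = sym (trans (cong (den x L.^ m L.*_) (L.zeroʳ _)) (L.zeroʳ _))
    ev-homogenise {x} {y} maps m j (z ∷ zs) le = begin
      ev (K.scale z (Lʲ K.*ₚ Mᵐ⁻ʲ) K.+ₚ homogenise A m (suc j) zs) x
        ≡⟨ ev-+ₚ (K.scale z (Lʲ K.*ₚ Mᵐ⁻ʲ)) (homogenise A m (suc j) zs) x ⟩
      ev (K.scale z (Lʲ K.*ₚ Mᵐ⁻ʲ)) x L.+ ev (homogenise A m (suc j) zs) x
        ≡⟨ cong₂ L._+_ (trans (ev-scale z (Lʲ K.*ₚ Mᵐ⁻ʲ) x) (cong (ι z L.*_) monomial))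
                       (ev-homogenise maps m (suc j) zs le′) ⟩
      ι z L.* (Δ L.* Y) L.+ Δ L.* ((y L.* Y) L.* E)
        ≡⟨ L.solve 5 (λ z Δ Y y E → (z L.:* (Δ L.:* Y) L.:+ Δ L.:* ((y L.:* Y) L.:* E)) L.:= (Δ L.:* (Y L.:* (z L.:+ y L.:* E)))) refl (ι z) Δ Y y E ⟩
      Δ L.* (Y L.* (ι z L.+ y L.* E))
        ∎
      where
      open ≡-Reasoning
      Lʲ = (b ∷ a ∷ []) K.^ₚ j
      Mᵐ⁻ʲ = (d ∷ c ∷ []) K.^ₚ (m ∸ j)
      Δ = den x L.^ m
      Y = y L.^ j
      E = ev zs y
      le′ : suc j ℕ.+ length zs ≤ suc m
      le′ = subst (_≤ suc m) (ℕₚ.+-suc j (length zs)) le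
      j≤m : j ≤ m
      j≤m = ℕₚ.≤-pred (ℕₚ.≤-trans (ℕₚ.m≤m+n (suc j) (length zs)) le′)
      monomial : ev (Lʲ K.*ₚ Mᵐ⁻ʲ) x ≡ Δ L.* Y
      monomial = begin
        ev (Lʲ K.*ₚ Mᵐ⁻ʲ) x
          ≡⟨ ev-*ₚ Lʲ Mᵐ⁻ʲ x ⟩
        ev Lʲ x L.* ev Mᵐ⁻ʲ x
          ≡⟨ cong₂ L._*_ (trans (ev-^ₚ (b ∷ a ∷ []) j x) (cong (L._^ j) (trans (ev-linear a b x) maps)))
                         (trans (ev-^ₚ (d ∷ c ∷ []) (m ∸ j) x) (cong (L._^ (m ∸ j)) (ev-linear c d x))) ⟩
        (den x L.* y) L.^ j L.* den x L.^ (m ∸ j)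
          ≡⟨ cong (L._* den x L.^ (m ∸ j)) (L.^-distrib-* (den x) y j) ⟩
        den x L.^ j L.* Y L.* den x L.^ (m ∸ j)
          ≡⟨ L.solve 3 (λ a b c → (a L.:* b L.:* c) L.:= (a L.:* c L.:* b)) refl (den x L.^ j) Y (den x L.^ (m ∸ j)) ⟩
        den x L.^ j L.* den x L.^ (m ∸ j) L.* Y
          ≡⟨ cong (L._* Y) (trans (sym (L.^-homo-* (den x) j (m ∸ j))) (cong (den x L.^_) (ℕₚ.m+[n∸m]≡n j≤m))) ⟩
        Δ L.* Y ∎

  ev-numerator : ∀ {x y} → Maps x y → ∀ h → ev (numerator A h) x ≡ den x L.^ K.deg h L.* ev h y
  ev-numerator {x} {y} maps h = trans (ev-homogenise maps (K.deg h) 0 (K.strip h) (K.length-strip h))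
    (cong (den x L.^ K.deg h L.*_) (trans (L.*-identityˡ _) (ev-cong {K.strip h} {h} (K.strip-≈ h) y)))

  -- At x the numerator equals (den x)^m h(y), and g is u times the numerator with u nonzero because
  -- g is monic.
  ∘ₚ-root : ∀ h g → K.Monic g → (A K.∘ₚ h) K.≈ₚ g → ∀ {x y} → den x ≢ L.0# → Maps x y → ev g x ≡ L.0# → ev h y ≡ L.0#
  ∘ₚ-root h g g-monic A∘h≈g {x} {y} den≢0 maps root =
    L.xy≡0⇒y≡0 (L.*-nonZero ιu≢0 (L.^-nonZero den≢0 (K.deg h))) (begin
      ι u L.* den x L.^ K.deg h L.* ev h y        ≡⟨ L.*-assoc _ _ _ ⟩
      ι u L.* (den x L.^ K.deg h L.* ev h y)      ≡⟨ cong (ι u L.*_) (ev-numerator maps h) ⟨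
      ι u L.* ev (numerator A h) x                ≡⟨ ev-scale u (numerator A h) x ⟨
      ev (K.scale u (numerator A h)) x            ≡⟨ ev-cong {K.scale u (numerator A h)} {g} scale≈g x ⟩
      ev g x                                      ≡⟨ root ⟩
      L.0#                                        ∎)
    where
    open ≡-Reasoning
    u = K.inv (K.lead (numerator A h))

    scale≈g : K.scale u (numerator A h) K.≈ₚ g
    scale≈g j = trans (cong (λ z → K.coeff z j) (sym (∘ₚ≡ A h))) (A∘h≈g j)

    ιu≢0 : ι u ≢ L.0#
    ιu≢0 e = K.coeff≡1⇒≢0 {g} (trans (K.coeff-deg g) g-monic) (trans (sym (scale≈g (K.deg g)))
      (trans (K.coeff-scale u (numerator A h) _) (trans (cong (K._* K.coeff (numerator A h) (K.deg g)) (ι.hom-≡0 e)) (K.zeroˡ _))))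

  private
    A-fixed : ∀ {u} → K.InFq u → ∀ i → σ i (ι u) ≡ ι u
    A-fixed {u} u∈Fq i = σ-fixed-∣ (1∣ i) (trans (σ-ι 1 u) (cong ι u∈Fq))

    a∈Fq = proj₁ A∈GL
    b∈Fq = proj₁ (proj₂ A∈GL)
    c∈Fq = proj₁ (proj₂ (proj₂ A∈GL))
    d∈Fq = proj₁ (proj₂ (proj₂ (proj₂ A∈GL)))
    det≢0 : K.det A ≢ K.0#
    det≢0 = proj₂ (proj₂ (proj₂ (proj₂ A∈GL)))

    c≢0∨d≢0 : ¬ (c ≡ K.0# × d ≡ K.0#)
    c≢0∨d≢0 (c≡0 , d≡0) = det≢0 (begin
      a K.* d K.+ K.- (b K.* c)         ≡⟨ cong₂ (λ x y → a K.* x K.+ K.- (b K.* y)) d≡0 c≡0 ⟩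
      a K.* K.0# K.+ K.- (b K.* K.0#)   ≡⟨ cong₂ (λ x y → x K.+ K.- y) (K.zeroʳ a) (K.zeroʳ b) ⟩
      K.0# K.+ K.- K.0#                 ≡⟨ K.-‿inverseʳ _ ⟩
      K.0#                              ∎)
      where open ≡-Reasoning

    module σL′ (i : ℕ) = HomLemmas (σL.σ-hom i) q

    σ-affine : ∀ {u v} → K.InFq u → K.InFq v → ∀ i x → σ i (ι u L.* x L.+ ι v) ≡ ι u L.* σ i x L.+ ι v
    σ-affine {u} {v} hu hv i x = trans (σL′.hom-+ i (ι u L.* x) (ι v))
      (cong₂ L._+_ (trans (σL′.hom-* i (ι u) x) (cong (L._* σ i x) (A-fixed hu i))) (A-fixed hv i))

  den-σ : ∀ i x → σ i (den x) ≡ den (σ i x)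
  den-σ = σ-affine c∈Fq d∈Fq

  -- The entries of A lie in 𝔽_q, so Frobenius commutes with A.
  Maps-σ : ∀ i {x y} → Maps x y → Maps (σ i x) (σ i y)
  Maps-σ i {x} {y} maps = trans (sym (σ-affine a∈Fq b∈Fq i x)) (trans (cong (σ i) maps)
    (trans (σL′.hom-* i (den x) y) (cong (L._* σ i y) (den-σ i x))))

  -- cx + d has degree below deg f, so vanishing at α would force c = d = 0 and a zero determinant.
  den-α≢0 : den α ≢ L.0#
  den-α≢0 e = c≢0∨d≢0 (zero-coeffs 1 , zero-coeffs 0)
    where
    zero-coeffs : (d ∷ c ∷ []) K.≈ₚ []
    zero-coeffs = independent (d ∷ c ∷ []) (ℕₚ.<⇒≤ 2<deg-f) (trans (ev-linear c d α) e)

  den-conjugate≢0 : ∀ i → den (σ i α) ≢ L.0#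
  den-conjugate≢0 i e = den-α≢0 (σL′.hom-≡0 i (trans (den-σ i α) e))

  A·α : Σ L.Carrier (Maps α)
  A·α = L.inv (den α) L.* num α , sym (trans (sym (L.*-assoc _ _ _))
    (trans (cong (L._* num α) (L.inverseʳ (den α) den-α≢0)) (L.*-identityˡ _)))

  -- After j(N - 1) further Frobenius steps σ^j α is back at α, while ι y has stayed in ι K; α would
  -- then be a root of a linear polynomial over K.
  ι≢conjugate : ∀ y j → ι y ≢ σ j α
  ι≢conjugate y j e = K.1≢0 (zero-coeffs 1)
    where
    y′ = K.σ (j ℕ.* ℕ.pred N) y

    ιy′≡α : ι y′ ≡ α
    ιy′≡α = begin
      ι y′                                  ≡⟨ σ-ι (j ℕ.* ℕ.pred N) y ⟨
      σ (j ℕ.* ℕ.pred N) (ι y)              ≡⟨ cong (σ (j ℕ.* ℕ.pred N)) e ⟩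
      σ (j ℕ.* ℕ.pred N) (σ j α)            ≡⟨ σL.σ-+ (j ℕ.* ℕ.pred N) j α ⟨
      σ (j ℕ.* ℕ.pred N ℕ.+ j) α            ≡⟨ cong (λ z → σ z α) (trans (ℕₚ.+-comm (j ℕ.* ℕ.pred N) j)
                                                 (trans (sym (ℕₚ.*-suc j (ℕ.pred N))) (cong (j ℕ.*_) (ℕₚ.suc-pred N {{ℕ.>-nonZero 1≤N}})))) ⟩
      σ (j ℕ.* N) α                         ≡⟨ σL.σ-fixed-* N (σL.σ-N α) j ⟩
      α                                     ∎
      where open ≡-Reasoning

    zero-coeffs : (K.- y′ ∷ K.1# ∷ []) K.≈ₚ []
    zero-coeffs = independent (K.- y′ ∷ K.1# ∷ []) (ℕₚ.<⇒≤ 2<deg-f) (begin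
      ev (K.- y′ ∷ K.1# ∷ []) α              ≡⟨ ev-linear K.1# (K.- y′) α ⟩
      ι K.1# L.* α L.+ ι (K.- y′)            ≡⟨ cong₂ L._+_ (trans (cong (L._* α) ι.hom-1) (L.*-identityˡ α)) (trans (ι.hom-neg y′) (cong L.-_ ιy′≡α)) ⟩
      α L.+ L.- α                            ≡⟨ L.-‿inverseʳ α ⟩
      L.0#                                   ∎)
      where open ≡-Reasoning

  private
    -- Either d is nonzero and 0 is not a pole of A, or d = 0, hence c is nonzero and 1 is not a
    -- pole.
    finite-point : Σ K.Carrier λ x → c K.* x K.+ d ≢ K.0#
    finite-point with d K.≟ K.0#
    ... | no d≢0  = K.0# , λ e → d≢0 (trans (sym (trans (cong (K._+ d) (K.zeroʳ c)) (K.+-identityˡ d))) e)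
    ... | yes d≡0 = K.1# , λ e → c≢0∨d≢0 (trans (sym (trans (cong₂ K._+_ (K.*-identityʳ c) d≡0) (K.+-identityʳ c))) e , d≡0)

    ι-affine : ∀ u x v → ι (u K.* x K.+ v) ≡ ι u L.* ι x L.+ ι v
    ι-affine u x v = trans (ι.hom-+ (u K.* x) v) (cong (L._+ ι v) (ι.hom-* u x))

  -- At a point x of K that is not a pole, the numerator takes the value (den x)^m h(A·x), and h has
  -- no root in K.
  numerator-≉0 : ∀ h → (∀ y → ev h (ι y) ≢ L.0#) → ¬ numerator A h K.≈ₚ []
  numerator-≉0 h no-root H≈0 = conclude finite-point
    where
    conclude : (Σ K.Carrier λ x → c K.* x K.+ d ≢ K.0#) → ⊥
    conclude (x , den≢0) = L.*-nonZero (L.^-nonZero ιden≢0 (K.deg h)) (no-root y)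
      (trans (sym (ev-numerator maps h)) (ev-cong {numerator A h} {[]} H≈0 (ι x)))
      where
      y = K.inv (c K.* x K.+ d) K.* (a K.* x K.+ b)
      ιden≢0 : den (ι x) ≢ L.0#
      ιden≢0 e = den≢0 (ι.hom-≡0 (trans (ι-affine c x d) e))
      maps : Maps (ι x) (ι y)
      maps = trans (sym (ι-affine a x b)) (trans (cong ι (sym (trans (sym (K.*-assoc _ _ _))
        (trans (cong (K._* (a K.* x K.+ b)) (K.inverseʳ _ den≢0)) (K.*-identityˡ _)))))
        (trans (ι.hom-* _ y) (cong (L._* ι y) (ι-affine c x d))))

  module _ (e : ℕ) (e∣n : e ∣ n) where
    open Orbit e

    -- Serves f (with e = n and h = σᵢ f) and G (with e = 1) alike. A sends ρ j to σ^κ(ρ j), a root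
    -- of h, so the numerator vanishes on the orbit. Its degree is at most the period, so it is a
    -- nonzero multiple of `minPoly`, and making it monic removes the factor.
    ∘ₚ≈minPoly : ∀ h κ → Maps α (σ κ α) → K.deg h ≡ period → (∀ j → ev h (σ κ (ρ j)) ≡ L.0#) →
                 (∀ y → ev h (ι y) ≢ L.0#) → (A K.∘ₚ h) K.≈ₚ minPoly e∣n
    ∘ₚ≈minPoly h κ maps deg-h roots no-root j = begin
      K.coeff (A K.∘ₚ h) j                              ≡⟨ cong (λ z → K.coeff z j) (∘ₚ≡ A h) ⟩
      K.coeff (K.scale (K.inv (K.lead H)) H) j          ≡⟨ K.coeff-scale _ H j ⟩
      K.inv (K.lead H) K.* K.coeff H j                  ≡⟨ cong₂ (λ x y → K.inv x K.* y) lead-H (trans (H≈ j) (K.coeff-scale u (minPoly e∣n) j)) ⟩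
      K.inv u K.* (u K.* K.coeff (minPoly e∣n) j)       ≡⟨ K.*-assoc _ _ _ ⟨
      K.inv u K.* u K.* K.coeff (minPoly e∣n) j         ≡⟨ cong (K._* K.coeff (minPoly e∣n) j) (K.inverseˡ u u≢0) ⟩
      K.1# K.* K.coeff (minPoly e∣n) j                  ≡⟨ K.*-identityˡ _ ⟩
      K.coeff (minPoly e∣n) j                           ∎
      where
      open ≡-Reasoning
      H = numerator A h
      u = K.coeff H period

      DegLE-H : K.DegLE H period
      DegLE-H = subst (K.DegLE H) deg-h (DegLE-numerator A h)

      H≈ : H K.≈ₚ K.scale u (minPoly e∣n)
      H≈ = ≈-scale-minPoly e∣n H DegLE-H (λ j → trans
        (ev-numerator (subst (Maps (ρ j)) (σL.σ-comm (e ℕ.* j) κ α) (Maps-σ (e ℕ.* j) maps)) h)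
        (trans (cong (den (ρ j) L.^ K.deg h L.*_) (roots j)) (L.zeroʳ _)))

      u≢0 : u ≢ K.0#
      u≢0 u≡0 = numerator-≉0 h no-root (λ j → trans (H≈ j) (trans (K.coeff-scale u (minPoly e∣n) j)
        (trans (cong (K._* K.coeff (minPoly e∣n) j) u≡0) (K.zeroˡ _))))

      lead-H : K.lead H ≡ u
      lead-H = K.lead-unique H DegLE-H u≢0

  module _ (κ : ℕ) (maps : Maps α (σ κ α)) where
    private
      -- In homogeneous coordinates: A^e sends (α, 1) to t times (σ^(κe) α, 1). The induction step
      -- applies A to σ^(κe) α, which gives σ^(κe)(σ^κ α) because A commutes with Frobenius.
      entries : ∀ e → let open K.Mat (A K.^ₘ e) renaming (a to aₑ; b to bₑ; c to cₑ; d to dₑ) in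
        Σ L.Carrier λ t → t ≢ L.0# × ι aₑ L.* α L.+ ι bₑ ≡ t L.* σ (κ ℕ.* e) α × ι cₑ L.* α L.+ ι dₑ ≡ t
      entries zero    = L.1# , L.1≢0 ,
        trans (cong₂ (λ x y → x L.* α L.+ y) ι.hom-1 ι.hom-0) (trans (L.+-identityʳ _)
          (cong (L.1# L.*_) (sym (trans (cong (λ z → σ z α) (ℕₚ.*-zeroʳ κ)) (σL.σ-zero α))))) ,
        trans (cong₂ (λ x y → x L.* α L.+ y) ι.hom-0 ι.hom-1) (trans (cong (L._+ L.1#) (L.zeroˡ α)) (L.+-identityˡ _))
      entries (suc e) = step (entries e)
        where
        open K.Mat (A K.^ₘ e) renaming (a to aₑ; b to bₑ; c to cₑ; d to dₑ)
        β = σ (κ ℕ.* e) α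

        row : ∀ u v {t} → ι aₑ L.* α L.+ ι bₑ ≡ t L.* β → ι cₑ L.* α L.+ ι dₑ ≡ t →
              ι (u K.* aₑ K.+ v K.* cₑ) L.* α L.+ ι (u K.* bₑ K.+ v K.* dₑ) ≡ t L.* (ι u L.* β L.+ ι v)
        row u v {t} h₁ h₂ = begin
          ι (u K.* aₑ K.+ v K.* cₑ) L.* α L.+ ι (u K.* bₑ K.+ v K.* dₑ)
            ≡⟨ cong₂ (λ x y → x L.* α L.+ y) (ι-bilinear aₑ cₑ) (ι-bilinear bₑ dₑ) ⟩
          (ι u L.* ι aₑ L.+ ι v L.* ι cₑ) L.* α L.+ (ι u L.* ι bₑ L.+ ι v L.* ι dₑ)
            ≡⟨ L.solve 7 (λ u v a b c d x → ((u L.:* a L.:+ v L.:* c) L.:* x L.:+ (u L.:* b L.:+ v L.:* d)) L.:=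
                 (u L.:* (a L.:* x L.:+ b) L.:+ v L.:* (c L.:* x L.:+ d))) refl (ι u) (ι v) (ι aₑ) (ι bₑ) (ι cₑ) (ι dₑ) α ⟩
          ι u L.* (ι aₑ L.* α L.+ ι bₑ) L.+ ι v L.* (ι cₑ L.* α L.+ ι dₑ)
            ≡⟨ cong₂ (λ x y → ι u L.* x L.+ ι v L.* y) h₁ h₂ ⟩
          ι u L.* (t L.* β) L.+ ι v L.* t
            ≡⟨ L.solve 4 (λ u v t x → (u L.:* (t L.:* x) L.:+ v L.:* t) L.:= (t L.:* (u L.:* x L.:+ v))) refl (ι u) (ι v) t β ⟩
          t L.* (ι u L.* β L.+ ι v) ∎
          where
          open ≡-Reasoning
          ι-bilinear : ∀ x y → ι (u K.* x K.+ v K.* y) ≡ ι u L.* ι x L.+ ι v L.* ι y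
          ι-bilinear x y = trans (ι-affine u x (v K.* y)) (cong (ι u L.* ι x L.+_) (ι.hom-* v y))

        step : (Σ L.Carrier λ t → t ≢ L.0# × ι aₑ L.* α L.+ ι bₑ ≡ t L.* β × ι cₑ L.* α L.+ ι dₑ ≡ t) →
          Σ L.Carrier λ t → t ≢ L.0# ×
            ι (a K.* aₑ K.+ b K.* cₑ) L.* α L.+ ι (a K.* bₑ K.+ b K.* dₑ) ≡ t L.* σ (κ ℕ.* suc e) α ×
            ι (c K.* aₑ K.+ d K.* cₑ) L.* α L.+ ι (c K.* bₑ K.+ d K.* dₑ) ≡ t
        step (t , t≢0 , h₁ , h₂) = t L.* den β , L.*-nonZero t≢0 (den-conjugate≢0 (κ ℕ.* e)) ,
          trans (row a b h₁ h₂) (trans (cong (t L.*_) num-β) (sym (L.*-assoc t _ _))) , row c d h₁ h₂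
          where
          num-β : num β ≡ den β L.* σ (κ ℕ.* suc e) α
          num-β = trans (Maps-σ (κ ℕ.* e) maps) (cong (den β L.*_) (trans (sym (σL.σ-+ (κ ℕ.* e) κ α))
            (cong (λ z → σ z α) (trans (ℕₚ.+-comm (κ ℕ.* e) κ) (sym (ℕₚ.*-suc κ e))))))

    scalar⇒fixed : ∀ e → K.Scalar (A K.^ₘ e) → σ (κ ℕ.* e) α ≡ α
    scalar⇒fixed e (bₑ≡0 , cₑ≡0 , aₑ≡dₑ) = conclude (entries e)
      where
      open K.Mat (A K.^ₘ e) renaming (a to aₑ; b to bₑ; c to cₑ; d to dₑ)
      conclude : (Σ L.Carrier λ t → t ≢ L.0# × ι aₑ L.* α L.+ ι bₑ ≡ t L.* σ (κ ℕ.* e) α × ι cₑ L.* α L.+ ι dₑ ≡ t) →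
                 σ (κ ℕ.* e) α ≡ α
      conclude (t , t≢0 , h₁ , h₂) = L.*-cancelˡ t≢0 (begin
        t L.* σ (κ ℕ.* e) α             ≡⟨ h₁ ⟨
        ι aₑ L.* α L.+ ι bₑ             ≡⟨ cong₂ (λ x y → x L.* α L.+ y) (trans (cong ι aₑ≡dₑ) ιdₑ≡t) (trans (cong ι bₑ≡0) ι.hom-0) ⟩
        t L.* α L.+ L.0#                ≡⟨ L.+-identityʳ _ ⟩
        t L.* α                         ∎)
        where
        open ≡-Reasoning
        ιdₑ≡t : ι dₑ ≡ t
        ιdₑ≡t = trans (sym (trans (cong (L._+ ι dₑ) (trans (cong (L._* α) (trans (cong ι cₑ≡0) ι.hom-0)) (L.zeroˡ α))) (L.+-identityˡ _))) h₂

    -- A conjugate fixed by A^e would make α a root of a quadratic over K.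
    fixed⇒scalar : ∀ e → σ (κ ℕ.* e) α ≡ α → K.Scalar (A K.^ₘ e)
    fixed⇒scalar e fixed = zero-coeffs 0 , c≡0 , K.x-y≡0⇒x≡y (zero-coeffs 1)
      where
      open K.Mat (A K.^ₘ e) renaming (a to aₑ; b to bₑ; c to cₑ; d to dₑ)
      quadratic : K.Poly
      quadratic = bₑ ∷ (aₑ K.+ K.- dₑ) ∷ (K.- cₑ) ∷ []

      A^e-fixes-α : ι aₑ L.* α L.+ ι bₑ ≡ (ι cₑ L.* α L.+ ι dₑ) L.* α
      A^e-fixes-α = let t , _ , h₁ , h₂ = entries e in trans h₁ (cong₂ L._*_ (sym h₂) fixed)

      ev-quadratic : ev quadratic α ≡ L.0#
      -- The semiring solver sees the negatives only as atoms; adding R supplies the terms with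
      -- which they cancel.
      ev-quadratic = L.+-cancelʳ R _ _ (begin
        ι bₑ L.+ α L.* (ι (aₑ K.+ K.- dₑ) L.+ α L.* (ι (K.- cₑ) L.+ α L.* L.0#)) L.+ R
          ≡⟨ cong₂ (λ x y → ι bₑ L.+ α L.* (x L.+ α L.* y) L.+ R) (trans (ι.hom-+ aₑ (K.- dₑ)) (cong (ι aₑ L.+_) (ι.hom-neg dₑ)))
               (trans (cong₂ L._+_ (ι.hom-neg cₑ) (L.zeroʳ α)) (L.+-identityʳ _)) ⟩
        ι bₑ L.+ α L.* (ι aₑ L.+ L.- ι dₑ L.+ α L.* L.- ι cₑ) L.+ R
          ≡⟨ L.solve 7 (λ a b c d c⁻ d⁻ x → (b L.:+ x L.:* (a L.:+ d⁻ L.:+ x L.:* c⁻) L.:+ (c L.:* x L.:+ d) L.:* x) L.:=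
               ((a L.:* x L.:+ b) L.:+ (x L.:* (d L.:+ d⁻) L.:+ x L.:* x L.:* (c L.:+ c⁻)))) refl
               (ι aₑ) (ι bₑ) (ι cₑ) (ι dₑ) (L.- ι cₑ) (L.- ι dₑ) α ⟩
        (ι aₑ L.* α L.+ ι bₑ) L.+ (α L.* (ι dₑ L.+ L.- ι dₑ) L.+ α L.* α L.* (ι cₑ L.+ L.- ι cₑ))
          ≡⟨ cong₂ (λ x y → (ι aₑ L.* α L.+ ι bₑ) L.+ (α L.* x L.+ α L.* α L.* y)) (L.-‿inverseʳ _) (L.-‿inverseʳ _) ⟩
        (ι aₑ L.* α L.+ ι bₑ) L.+ (α L.* L.0# L.+ α L.* α L.* L.0#)
          ≡⟨ cong₂ L._+_ A^e-fixes-α (trans (cong₂ L._+_ (L.zeroʳ α) (L.zeroʳ _)) (L.+-identityˡ _)) ⟩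
        R L.+ L.0#
          ≡⟨ L.+-comm R L.0# ⟩
        L.0# L.+ R ∎)
        where
        open ≡-Reasoning
        R = (ι cₑ L.* α L.+ ι dₑ) L.* α

      zero-coeffs : quadratic K.≈ₚ []
      zero-coeffs = independent quadratic 2<deg-f ev-quadratic

      c≡0 : cₑ ≡ K.0#
      c≡0 = trans (sym (K.-‿involutive cₑ)) (trans (cong K.-_ (zero-coeffs 2)) K.-0#≈0#)

-- The three conditions and the implications between them.

module Equivalence (K : FiniteField) (p k n : ℕ) (pr : Prime p) (1≤n : 1 ≤ n)
  (card-K : FiniteField.card K ≡ (p ℕ.^ k) ℕ.^ n)
  (f : FF.Poly K (p ℕ.^ k)) (monic : FF.Monic K (p ℕ.^ k) f) (irreducible : FF.Irreducible K (p ℕ.^ k) f)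
  (extension : SimpleExtension K (p ℕ.^ k) f)
  (2<deg-f : 2 < FF.deg K (p ℕ.^ k) f)
  (a b c d : FiniteField.Carrier K) (A∈GL : FF.InGL2q K (p ℕ.^ k) (FF.mat a b c d))
  (e : ℕ) (order : FF.PGLOrder K (p ℕ.^ k) (FF.mat a b c d) e) .{{_ : NonZero (gcd e n)}}
  (s : ℕ) (1≤s : 1 ≤ s) (gcd-sn : gcd s n ≡ 1)
  (deg-f≡ : FF.deg K (p ℕ.^ k) f ≡ (e / gcd e n) ℕ.* s) where

  open Arithmetic
  open Moebius K p k n pr 1≤n card-K f monic irreducible extension 2<deg-f a b c d A∈GL

  module Oₙ = Orbit n
  module O₁ = Orbit 1

  -- The d₀ of the statement: here d is an entry of A, and e is the order of [A].
  e₀ : ℕ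
  e₀ = gcd e n

  D : ℕ
  D = O₁.period

  private
    σ-1* : ∀ t → O₁.ρ t ≡ σ t α
    σ-1* t = cong (λ z → σ z α) (ℕₚ.*-identityˡ t)

    D∣ : ∀ {t} → σ t α ≡ α → D ∣ t
    D∣ {t} h = O₁.period-∣ (trans (σ-1* t) h)

    ∣D : ∀ {t} → D ∣ t → σ t α ≡ α
    ∣D {t} h = trans (sym (σ-1* t)) (O₁.∣-period h)

    CoeffsIn-n : ∀ g → K.CoeffsIn (K.InFq^ n) g
    CoeffsIn-n g = universal σK.σ-N g

    f-minPoly : f K.≈ₚ Oₙ.minPoly (n∣n {n}) × deg-f ≡ Oₙ.period
    f-minPoly = Oₙ.irreducible⇒minPoly (n∣n {n}) f monic
      (CoeffsIn-n f , 1≤deg-f , λ g h _ _ → proj₂ (proj₂ irreducible) g h (universal (λ x → x) g) (universal (λ x → x) h)) root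

    f≈ = proj₁ f-minPoly
    deg-f≡period = proj₂ f-minPoly

    f-root : ∀ {x} → ev f x ≡ L.0# → Σ ℕ λ j → x ≡ σ (n ℕ.* j) α
    f-root {x} h = Oₙ.minPoly-root (n∣n {n}) (trans (sym (ev-cong {f} {Oₙ.minPoly (n∣n {n})} f≈ x)) h)

    f-rootless : ∀ y → ev f (ι y) ≢ L.0#
    f-rootless y h = let j , eq = f-root h in ι≢conjugate y (n ℕ.* j) eq

  -- The orbit of α under σ^n has deg f elements, so D ∣ nr exactly when deg f ∣ r.
  period-deg-f : D ≡ deg-f ℕ.* gcd D n
  period-deg-f = period-formula D n deg-f O₁.1≤period
    (λ r h → subst (_∣ r) (sym deg-f≡period) (Oₙ.period-∣ (∣D h)))
    (D∣ (trans (cong (λ z → σ (n ℕ.* z) α) deg-f≡period) Oₙ.ρ-period))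

  module _ (κ : ℕ) (maps : Maps α (σ κ α)) where
    private
      1≤e = proj₁ order
      instance
        e≢0 : NonZero e
        e≢0 = ℕ.>-nonZero 1≤e

      D∣κe : D ∣ κ ℕ.* e
      D∣κe = D∣ (scalar⇒fixed κ maps e (proj₁ (proj₂ order)))

      -- The remainder of r modulo e is again an exponent for which A fixes α, so that power of A is
      -- scalar; below the order only the exponent 0 is left.
      e∣ : ∀ r → D ∣ κ ℕ.* r → e ∣ r
      e∣ r h = m%n≡0⇒n∣m r e (small (r % e) (m%n<n r e) D∣remainder)
        where
        D∣remainder : D ∣ κ ℕ.* (r % e)
        D∣remainder = ∣m+n∣m⇒∣n (subst (D ∣_) (begin
          κ ℕ.* r                                           ≡⟨ cong (κ ℕ.*_) (m≡m%n+[m/n]*n r e) ⟩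
          κ ℕ.* (r % e ℕ.+ r / e ℕ.* e)                     ≡⟨ ℕₚ.*-distribˡ-+ κ (r % e) _ ⟩
          κ ℕ.* (r % e) ℕ.+ κ ℕ.* (r / e ℕ.* e)             ≡⟨ ℕₚ.+-comm (κ ℕ.* (r % e)) _ ⟩
          κ ℕ.* (r / e ℕ.* e) ℕ.+ κ ℕ.* (r % e)             ∎) h)
          (subst (D ∣_) (x∙yz≈y∙xz (r / e) κ e) (∣n⇒∣m*n (r / e) D∣κe))
          where
          open ≡-Reasoning
          x∙yz≈y∙xz : ∀ x y z → x ℕ.* (y ℕ.* z) ≡ y ℕ.* (x ℕ.* z)
          x∙yz≈y∙xz x y z = trans (sym (ℕₚ.*-assoc x y z)) (trans (cong (ℕ._* z) (ℕₚ.*-comm x y)) (ℕₚ.*-assoc y x z))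
        small : ∀ j → j < e → D ∣ κ ℕ.* j → j ≡ 0
        small zero    _  _ = refl
        small (suc j) lt h = ⊥-elim (proj₂ (proj₂ order) (suc j) (s≤s z≤n) lt (fixed⇒scalar κ maps (suc j) (∣D h)))

    period-order : D ≡ e ℕ.* gcd D κ
    period-order = period-formula D κ e O₁.1≤period e∣ D∣κe

  condI condII condIII : Set
  condI = Σ ℕ λ i → 1 ≤ i × i ≤ n × gcd i n ≡ 1 × K.Invariant A i f
  condII = condI × K.CoeffsIn (K.InFq^ e₀) f × (∀ t → 1 ≤ t → t < e₀ → ¬ K.CoeffsIn (K.InFq^ t) f)
  condIII = Σ K.Poly λ G → K.Monic G × K.IrreducibleIn K.InFq G
            × K.deg G ≡ e ℕ.* s × (A K.∘ₚ G) K.≈ₚ G × f K.∣ₚ G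

  private
    -- A·α is a root of σᵢ f, hence σ^i of a root σ^(nj) α of f. So κ = i + nj, which is coprime to
    -- n along with i.
    f-conjugate-exponent : ∀ i → K.Invariant A i f → gcd i n ≡ 1 → Σ ℕ λ κ → gcd κ n ≡ 1 × Maps α (σ κ α)
    f-conjugate-exponent i invariant gcd-in = conclude A·α
      where
      conclude : Σ L.Carrier (Maps α) → Σ ℕ λ κ → gcd κ n ≡ 1 × Maps α (σ κ α)
      conclude (y , maps) = pull (σL.σ-surjective 1≤N i y)
        where
        y-root : ev (K.σₚ i f) y ≡ L.0#
        y-root = ∘ₚ-root (K.σₚ i f) f monic invariant den-α≢0 maps root

        pull : (Σ L.Carrier λ γ → σ i γ ≡ y) → Σ ℕ λ κ → gcd κ n ≡ 1 × Maps α (σ κ α)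
        pull (γ , σγ≡y) = finish (f-root (HomLemmas.hom-≡0 (σL.σ-hom i) q
            (trans (sym (ev-σₚ i f γ)) (trans (cong (ev (K.σₚ i f)) σγ≡y) y-root))))
          where
          finish : (Σ ℕ λ j → γ ≡ σ (n ℕ.* j) α) → Σ ℕ λ κ → gcd κ n ≡ 1 × Maps α (σ κ α)
          finish (j , γ≡) = i ℕ.+ n ℕ.* j , coprime⇒gcd≡1 coprime ,
            subst (Maps α) (trans (sym σγ≡y) (trans (cong (σ i) γ≡) (sym (σL.σ-+ i (n ℕ.* j) α)))) maps
            where
            coprime : Coprime (i ℕ.+ n ℕ.* j) n
            coprime {x} (x∣κ , x∣n) = gcd≡1⇒coprime gcd-in
              (∣m+n∣m⇒∣n (subst (x ∣_) (ℕₚ.+-comm i (n ℕ.* j)) x∣κ) (∣m⇒∣m*n j x∣n) , x∣n)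

    invariant⇒period : condI → D ≡ e ℕ.* s
    invariant⇒period (i , _ , _ , gcd-in , invariant) = conclude (f-conjugate-exponent i invariant gcd-in)
      where
      conclude : (Σ ℕ λ κ → gcd κ n ≡ 1 × Maps α (σ κ α)) → D ≡ e ℕ.* s
      conclude (κ , gcd-κn , maps) = period-from-invariance e n s (proj₁ order) 1≤s gcd-sn D κ
        (trans period-deg-f (cong (ℕ._* gcd D n) deg-f≡)) (period-order κ maps) gcd-κn

    module FieldOfDefinition (D≡es : D ≡ e ℕ.* s) where
      e₀∣n = gcd[m,n]∣n e n

      gcd-Dn : gcd D n ≡ e₀
      gcd-Dn = gcd-period-n e n s (proj₁ order) 1≤s gcd-sn D (trans period-deg-f (cong (ℕ._* gcd D n) deg-f≡)) D≡es

      D≡deg-f*e₀ : D ≡ deg-f ℕ.* e₀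
      D≡deg-f*e₀ = trans period-deg-f (cong (deg-f ℕ.*_) gcd-Dn)

      e₀∣D : e₀ ∣ D
      e₀∣D = divides deg-f D≡deg-f*e₀

      module O₀ = Orbit e₀

      -- As D = e₀ deg f, the power σ^(e₀r) fixes α exactly when deg f ∣ r.
      period≡ : O₀.period ≡ deg-f
      period≡ = ∣-antisym
        (O₀.period-∣ (∣D (divides 1 (trans (ℕₚ.*-comm e₀ deg-f) (trans (sym D≡deg-f*e₀) (sym (ℕₚ.*-identityˡ D)))))))
        (*-cancelʳ-∣ e₀ (subst₂ _∣_ D≡deg-f*e₀ (ℕₚ.*-comm e₀ O₀.period) (D∣ O₀.ρ-period)))

      -- Since e₀ ∣ n, the orbit under σ^n lies in the one under σ^(e₀); both have deg f elements,
      -- so the monic polynomials they define coincide.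
      minPoly≈f : O₀.minPoly e₀∣n K.≈ₚ f
      minPoly≈f j = begin
        K.coeff m₀ j
          ≡⟨ Oₙ.≈-scale-minPoly (n∣n {n}) m₀ (subst (K.DegLE m₀) periods≡ (O₀.DegLE-minPoly e₀∣n)) roots j ⟩
        K.coeff (K.scale (K.coeff m₀ Oₙ.period) (Oₙ.minPoly (n∣n {n}))) j
          ≡⟨ K.coeff-scale _ (Oₙ.minPoly (n∣n {n})) j ⟩
        K.coeff m₀ Oₙ.period K.* K.coeff (Oₙ.minPoly (n∣n {n})) j
          ≡⟨ cong₂ K._*_ (trans (cong (K.coeff m₀) (sym periods≡)) (O₀.coeff-minPoly e₀∣n)) (sym (f≈ j)) ⟩
        K.1# K.* K.coeff f j
          ≡⟨ K.*-identityˡ _ ⟩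
        K.coeff f j ∎
        where
        open ≡-Reasoning
        m₀ = O₀.minPoly e₀∣n
        periods≡ : O₀.period ≡ Oₙ.period
        periods≡ = trans period≡ deg-f≡period
        roots : ∀ j → ev m₀ (Oₙ.ρ j) ≡ L.0#
        roots j = trans (cong (λ z → ev m₀ (σ z α)) (begin
          n ℕ.* j                              ≡⟨ cong (ℕ._* j) (trans (_∣_.equality e₀∣n) (ℕₚ.*-comm (quotient e₀∣n) e₀)) ⟩
          e₀ ℕ.* quotient e₀∣n ℕ.* j           ≡⟨ ℕₚ.*-assoc e₀ _ j ⟩
          e₀ ℕ.* (quotient e₀∣n ℕ.* j)         ∎)) (O₀.ev-minPoly e₀∣n (quotient e₀∣n ℕ.* j))

      -- The list f may carry trailing zeros, so membership is passed on coefficient by coefficient.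
      f-coeffs : K.CoeffsIn (K.InFq^ e₀) f
      f-coeffs = fromCoeffs f (λ j → trans (cong (K.σ e₀) (sym (minPoly≈f j)))
        (trans (coeff-fixed (O₀.minPoly-coeffs e₀∣n) j) (minPoly≈f j)))
        where
        fromCoeffs : ∀ g → (∀ j → K.InFq^ e₀ (K.coeff g j)) → K.CoeffsIn (K.InFq^ e₀) g
        fromCoeffs []      h = []
        fromCoeffs (x ∷ g) h = h 0 ∷ fromCoeffs g (h ∘ suc)

        coeff-fixed : ∀ {g} → K.CoeffsIn (K.InFq^ e₀) g → ∀ j → K.InFq^ e₀ (K.coeff g j)
        coeff-fixed []       j       = Hom.hom-0 (σK.σ-hom e₀)
        coeff-fixed (x ∷ hs) zero    = x
        coeff-fixed (x ∷ hs) (suc j) = coeff-fixed hs j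

      -- If σ^t fixed the coefficients, σ^t α would be a root σ^(nj) α of f, so t ≡ nj modulo D. As
      -- e₀ divides D and n, it would divide t, which is smaller.
      f-coeffs-minimal : ∀ t → 1 ≤ t → t < e₀ → ¬ K.CoeffsIn (K.InFq^ t) f
      f-coeffs-minimal t 1≤t t<e₀ h = conclude (f-root (ev-σ-root t f h root))
        where
        conclude : (Σ ℕ λ j → σ t α ≡ σ (n ℕ.* j) α) → ⊥
        conclude (j , eq) = ℕₚ.<⇒≱ t<e₀ (∣⇒≤ {{ℕ.>-nonZero 1≤t}} (∣m+n∣m⇒∣n (∣-trans e₀∣D D∣z+t) e₀∣z))
          where
          -- Stands for -nj: adding nj gives a multiple of N.
          z = n ℕ.* j ℕ.* ℕ.pred N
          e₀∣z : e₀ ∣ z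
          e₀∣z = ∣m⇒∣m*n (ℕ.pred N) (∣m⇒∣m*n j e₀∣n)
          D∣z+t : D ∣ z ℕ.+ t
          D∣z+t = D∣ (begin
            σ (z ℕ.+ t) α              ≡⟨ σL.σ-+ z t α ⟩
            σ z (σ t α)                ≡⟨ cong (σ z) eq ⟩
            σ z (σ (n ℕ.* j) α)        ≡⟨ σL.σ-+ z (n ℕ.* j) α ⟨
            σ (z ℕ.+ n ℕ.* j) α        ≡⟨ cong (λ x → σ x α) (trans (ℕₚ.+-comm z (n ℕ.* j)) (trans (sym (ℕₚ.*-suc (n ℕ.* j) (ℕ.pred N)))
                                            (cong (n ℕ.* j ℕ.*_) (ℕₚ.suc-pred N {{ℕ.>-nonZero 1≤N}})))) ⟩
            σ (n ℕ.* j ℕ.* N) α        ≡⟨ σL.σ-fixed-* N (σL.σ-N α) (n ℕ.* j) ⟩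
            α                          ∎)
            where open ≡-Reasoning

  I⇒II : condI → condII
  I⇒II cond = cond , f-coeffs , f-coeffs-minimal
    where open FieldOfDefinition (invariant⇒period cond)

  private
    G : K.Poly
    G = O₁.minPoly (1∣ n)

    f∣G : f K.∣ₚ G
    f∣G = conclude (Oₙ.minPoly-divides (n∣n {n}) G (CoeffsIn-n G) (trans (cong (ev G) (sym O₁.ρ-zero)) (O₁.ev-minPoly (1∣ n) 0)))
      where
      conclude : (Σ K.Poly λ h → K.CoeffsIn (K.InFq^ n) h × G K.≈ₚ (h K.*ₚ Oₙ.minPoly (n∣n {n}))) → f K.∣ₚ G
      conclude (h , _ , G≈) = h , λ j → trans (G≈ j) (trans (K.*ₚ-congˡ h (Oₙ.minPoly (n∣n {n})) f (λ i → sym (f≈ i)) j) (K.*ₚ-comm h f j))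

    -- No condition on κ is needed here: G vanishes at every conjugate over 𝔽_q, whichever one A
    -- sends α to.
    A∘G≈G : ∀ κ → Maps α (σ κ α) → (A K.∘ₚ G) K.≈ₚ G
    A∘G≈G κ maps = ∘ₚ≈minPoly 1 (1∣ n) G κ maps (O₁.deg-minPoly (1∣ n))
      (λ j → trans (cong (ev G) (trans (cong (σ κ) (σ-1* j)) (trans (sym (σL.σ-+ κ j α)) (sym (σ-1* (κ ℕ.+ j))))))
               (O₁.ev-minPoly (1∣ n) (κ ℕ.+ j)))
      (λ y h → let j , eq = O₁.minPoly-root (1∣ n) h in ι≢conjugate y (1 ℕ.* j) eq)

  I⇒III : condI → condIII
  I⇒III cond@(i , _ , _ , gcd-in , invariant) = conclude (f-conjugate-exponent i invariant gcd-in)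
    where
    conclude : (Σ ℕ λ κ → gcd κ n ≡ 1 × Maps α (σ κ α)) → condIII
    conclude (κ , _ , maps) = G , O₁.minPoly-monic (1∣ n) , O₁.minPoly-irreducible (1∣ n) ,
      trans (O₁.deg-minPoly (1∣ n)) (invariant⇒period cond) , A∘G≈G κ maps , f∣G

  module FromG (D≡es : D ≡ e ℕ.* s) (κ : ℕ) (maps : Maps α (σ κ α)) where
    open FieldOfDefinition D≡es

    κ⊥e₀ : Coprime κ e₀
    κ⊥e₀ = coprime-exponent e n s (proj₁ order) 1≤s gcd-sn D κ D≡es (period-order κ maps)

    -- With x = κ + i(N − 1) we have σ_i(σ_x α) = σ_κ α, and e₀ ∣ x makes σ_x α a root of f.
    invariant : ∀ i u v → κ ℕ.+ e₀ ℕ.* u ≡ i ℕ.+ e₀ ℕ.* v → K.Invariant A i f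
    invariant i u v eq j = trans (∘ₚ≈minPoly n (n∣n {n}) (K.σₚ i f) κ maps (trans deg-σf deg-f≡period) roots rootless j) (sym (f≈ j))
      where
      module σᵢ = HomLemmas (σK.σ-hom i) q
      x = κ ℕ.+ i ℕ.* ℕ.pred N

      e₀∣N : e₀ ∣ N
      e₀∣N = ∣m⇒∣m*n deg-f e₀∣n

      i+i*pred : i ℕ.+ i ℕ.* ℕ.pred N ≡ i ℕ.* N
      i+i*pred = trans (sym (ℕₚ.*-suc i (ℕ.pred N))) (cong (i ℕ.*_) (ℕₚ.suc-pred N {{ℕ.>-nonZero 1≤N}}))

      e₀∣x : e₀ ∣ x
      -- Adding e₀u to x turns κ into i + e₀v, and i + i(N - 1) = iN is a multiple of e₀.
      e₀∣x = ∣m+n∣m⇒∣n (subst (e₀ ∣_) (sym (begin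
        e₀ ℕ.* u ℕ.+ (κ ℕ.+ i ℕ.* ℕ.pred N)    ≡⟨ ℕₚ.+-assoc (e₀ ℕ.* u) κ _ ⟨
        e₀ ℕ.* u ℕ.+ κ ℕ.+ i ℕ.* ℕ.pred N      ≡⟨ cong (ℕ._+ i ℕ.* ℕ.pred N) (trans (ℕₚ.+-comm (e₀ ℕ.* u) κ) (trans eq (ℕₚ.+-comm i _))) ⟩
        e₀ ℕ.* v ℕ.+ i ℕ.+ i ℕ.* ℕ.pred N      ≡⟨ ℕₚ.+-assoc (e₀ ℕ.* v) i _ ⟩
        e₀ ℕ.* v ℕ.+ (i ℕ.+ i ℕ.* ℕ.pred N)    ≡⟨ cong (e₀ ℕ.* v ℕ.+_) i+i*pred ⟩
        e₀ ℕ.* v ℕ.+ i ℕ.* N                   ∎))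
        (∣m∣n⇒∣m+n (m∣m*n v) (∣n⇒∣m*n i e₀∣N))) (m∣m*n u)
        where open ≡-Reasoning

      σᵢσₓ : σ i (σ x α) ≡ σ κ α
      σᵢσₓ = begin
        σ i (σ x α)                          ≡⟨ σL.σ-+ i x α ⟨
        σ (i ℕ.+ (κ ℕ.+ i ℕ.* ℕ.pred N)) α   ≡⟨ cong (λ z → σ z α) (trans (sym (ℕₚ.+-assoc i κ _)) (trans (cong (ℕ._+ i ℕ.* ℕ.pred N) (ℕₚ.+-comm i κ))
                                                  (trans (ℕₚ.+-assoc κ i _) (cong (κ ℕ.+_) i+i*pred)))) ⟩
        σ (κ ℕ.+ i ℕ.* N) α                  ≡⟨ σL.σ-+ κ (i ℕ.* N) α ⟩
        σ κ (σ (i ℕ.* N) α)                  ≡⟨ cong (σ κ) (σL.σ-fixed-* N (σL.σ-N α) i) ⟩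
        σ κ α                                ∎
        where open ≡-Reasoning

      κ-root : ev (K.σₚ i f) (σ κ α) ≡ L.0#
      κ-root = trans (cong (ev (K.σₚ i f)) (sym σᵢσₓ)) (trans (ev-σₚ i f (σ x α))
        (trans (cong (σ i) (trans (cong (λ z → ev f (σ z α)) (trans (_∣_.equality e₀∣x) (ℕₚ.*-comm (quotient e₀∣x) e₀)))
          (ev-conjugate-root e₀ f f-coeffs root (quotient e₀∣x)))) (Hom.hom-0 (σL.σ-hom i))))

      roots : ∀ j → ev (K.σₚ i f) (σ κ (Oₙ.ρ j)) ≡ L.0#
      roots j = trans (cong (ev (K.σₚ i f)) (σL.σ-comm κ (n ℕ.* j) α))
        (ev-conjugate-root n (K.σₚ i f) (CoeffsIn-n (K.σₚ i f)) κ-root j)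

      rootless : ∀ y → ev (K.σₚ i f) (ι y) ≢ L.0#
      -- σ^i maps K onto K, so a root of σᵢ f in K would come from a root of f in K.
      rootless y h = pull (σK.σ-surjective 1≤n i y)
        where
        pull : (Σ K.Carrier λ y′ → K.σ i y′ ≡ y) → ⊥
        pull (y′ , σy′≡y) = f-rootless y′ (HomLemmas.hom-≡0 (σL.σ-hom i) q (trans (sym (ev-σₚ i f (ι y′)))
          (trans (cong (ev (K.σₚ i f)) (trans (σ-ι i y′) (cong ι σy′≡y))) h)))

      deg-σf : K.deg (K.σₚ i f) ≡ deg-f
      deg-σf = K.deg-unique (K.σₚ i f) (σᵢ.DegLE-map {f} (K.DegLE-deg f)) (λ h → K.coeff≡1⇒≢0 {f} (trans (K.coeff-deg f) monic)
        (σᵢ.hom-≡0 (trans (sym (σᵢ.coeff-map f deg-f)) h)))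

    II : condII
    II = conclude (coprime-representative κ e₀ n 1≤n κ⊥e₀ e₀∣n)
      where
      conclude : (Σ ℕ λ i → Σ ℕ λ u → Σ ℕ λ v → 1 ≤ i × i ≤ n × gcd i n ≡ 1 × κ ℕ.+ e₀ ℕ.* u ≡ i ℕ.+ e₀ ℕ.* v) → condII
      conclude (i , u , v , 1≤i , i≤n , gcd-in , eq) = (i , 1≤i , i≤n , gcd-in , invariant i u v eq) , f-coeffs , f-coeffs-minimal

  -- G is the minimal polynomial of α over 𝔽_q, so D = deg G = ds. Invariance of G makes A·α a root
  -- of G, hence some conjugate σ^j α, and `FromG` replaces j by an admissible index.
  III⇒II : condIII → condII
  III⇒II (G , G-monic , G-irr , deg-G , A∘G≈G , (h , G≈fh)) = conclude A·α
    where
    G-root : ev G α ≡ L.0#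
    G-root = trans (ev-cong {G} {f K.*ₚ h} G≈fh α) (trans (ev-*ₚ f h α) (trans (cong (L._* ev h α) root) (L.zeroˡ _)))

    G-minPoly : G K.≈ₚ O₁.minPoly (1∣ n) × K.deg G ≡ D
    G-minPoly = O₁.irreducible⇒minPoly (1∣ n) G G-monic G-irr G-root

    conclude : Σ L.Carrier (Maps α) → condII
    conclude (y , maps) = finish (O₁.minPoly-root (1∣ n) (trans (sym (ev-cong {G} {O₁.minPoly (1∣ n)} (proj₁ G-minPoly) y))
        (∘ₚ-root G G G-monic A∘G≈G den-α≢0 maps G-root)))
      where
      finish : (Σ ℕ λ j → y ≡ O₁.ρ j) → condII
      finish (j , y≡) = FromG.II (trans (sym (proj₂ G-minPoly)) deg-G) j (subst (Maps α) (trans y≡ (σ-1* j)) maps)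

open import Data.Nat using (_*_; _/_; _^_)

theorem4p1 : (q n : ℕ) → IsPrimePower q → 1 ≤ n →
  (K : FiniteField) → FiniteField.card K ≡ q ^ n →
  (A : FF.Mat K q) → FF.InGL2q K q A →
  (d : ℕ) → FF.PGLOrder K q A d →
  .{{_ : NonZero (gcd d n)}} →
  (s : ℕ) → 1 ≤ s → gcd s n ≡ 1 →
  (f : FF.Poly K q) → FF.Monic K q f → FF.Irreducible K q f →
  FF.deg K q f ≡ (d / gcd d n) * s → 2 < FF.deg K q f →
  let
    condI = Σ ℕ λ i → 1 ≤ i × i ≤ n × gcd i n ≡ 1 × FF.Invariant K q A i f
    condII = condI × FF.CoeffsIn K q (FF.InFq^ K q (gcd d n)) f
                   × (∀ t → 1 ≤ t → t < gcd d n → ¬ FF.CoeffsIn K q (FF.InFq^ K q t) f)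
    condIII = Σ (FF.Poly K q) λ G → FF.Monic K q G × FF.IrreducibleIn K q (FF.InFq K q) G
                   × FF.deg K q G ≡ d * s × FF._≈ₚ_ K q (FF._∘ₚ_ K q A G) G
                   × FF._∣ₚ_ K q f G
  in (condI ⇔ condII) × (condII ⇔ condIII)
theorem4p1 q n (p , k , pr , 1≤k , refl) 1≤n K card-K (FF.mat a b c d) A∈GL e order s 1≤s gcd-sn f monic irreducible deg-f≡ 2<deg-f =
  -- The second condition contains the first, so it reaches the third through it.
  mk⇔ E.I⇒II proj₁ , mk⇔ (λ cond → E.I⇒III (proj₁ cond)) E.III⇒II
  where
  extension : SimpleExtension K (p ^ k) f
  extension = Quotient.extension K (p ^ k) f monic irreducible (ℕ.pred (FF.deg K (p ^ k) f))
    (sym (ℕₚ.suc-pred (FF.deg K (p ^ k) f) {{ℕ.>-nonZero (ℕₚ.≤-trans (s≤s z≤n) 2<deg-f)}}))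
  module E = Equivalence K p k n pr 1≤n card-K f monic irreducible extension 2<deg-f a b c d A∈GL e order s 1≤s gcd-sn deg-f≡
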